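{- Let $\varepsilon\in(0,1/2)$, let $n^{1/2+\varepsilon}\leq d=d(n)\leq n/2$ (with $dn$ even), let $\mathbf{G}_n\sim\mathcal{G}_{n,d}$, and let $k\in\mathbb{N}$ be an arbitrary constant. Then with high probability the following holds: for every non-trivial partition $[n]=V_1\sqcup V_2$ of the vertex set of $\mathbf{G}_n$, after two rounds of colour refinement (started from the colouring given by this partition) there exists a partition $[n]=W_1\sqcup\dots\sqcup W_k$ such that for every $i\in[k]$, $n/(3k)\le|W_i|\le 3n/k$ and $W_i$ is a union of some colour classes.
   Context: $\mathcal{G}_{n,d}$ is the uniform distribution over $d$-regular graphs on $[n]=\{1,\dots,n\}$; "with high probability" means with probability tending to $1$ as $n\to\infty$. Colour refinement: from a colouring $C_{t-1}$, $C_t(v)=(C_{t-1}(v),\{\!\{C_{t-1}(w):w\in N(v)\}\!\})$ (multiset of neighbours' colours); the initial colouring gives colour $i$ to vertices of $V_i$. A two-part partition is non-trivial if both parts are non-empty. -}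

module Defs where

open import Data.Nat using (ℕ; zero; suc; _+_; _*_; _≤_; _≡ᵇ_)
open import Data.Fin using (Fin; zero; suc)
open import Data.Bool using (Bool; true; false; _∧_; not; if_then_else_)
open import Data.List using (List; []; _∷_; map; concatMap; filter; length)
open import Data.Product using (Σ; ∃; ∃-syntax; _×_; _,_)
open import Relation.Binary.PropositionalEquality using (_≡_)
open import Relation.Nullary using (does)
open import Data.Bool.Properties using (T?)

Graph : ℕ → Set
Graph n = Fin n → Fin n → Bool

countTrue : {n : ℕ} → (Fin n → Bool) → ℕ
countTrue {zero} f = 0
countTrue {suc n} f = (if f zero then 1 else 0) + countTrue (λ i → f (suc i))

allB : {n : ℕ} → (Fin n → Bool) → Bool
allB {zero} f = true
allB {suc n} f = f zero ∧ allB (λ i → f (suc i))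

_==B_ : Bool → Bool → Bool
true ==B b = b
false ==B b = not b

degree : {n : ℕ} → Graph n → Fin n → ℕ
degree G v = countTrue (G v)

isRegular : {n : ℕ} → ℕ → Graph n → Bool
isRegular d G =
  allB (λ i → allB (λ j → G i j ==B G j i) ∧ not (G i i) ∧ (degree G i ≡ᵇ d))

consF : {A : Set} {k : ℕ} → A → (Fin k → A) → Fin (suc k) → A
consF a f zero = a
consF a f (suc i) = f i

allFunsTo : {A : Set} → List A → (k : ℕ) → List (Fin k → A)
allFunsTo xs zero = (λ ()) ∷ []
allFunsTo xs (suc k) = concatMap (λ a → map (consF a) (allFunsTo xs k)) xs

allGraphs : (n : ℕ) → List (Graph n)
allGraphs n = allFunsTo (allFunsTo (true ∷ false ∷ []) n) n

-- the support of G(n,d): all d-regular graphs on [n], each listed exactly once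
regGraphs : (n d : ℕ) → List (Graph n)
regGraphs n d = filter (λ G → T? (isRegular d G)) (allGraphs n)

-- Colour refinement started from the colouring given by the partition
-- [n] = V₁ ⊔ V₂ with V₁ = {v | part v = true}, V₂ = {v | part v = false}.
-- sameColour G part t v w = true  iff  C_t(v) = C_t(w).
-- C_t(v) = C_t(w) iff C_{t-1}(v) = C_{t-1}(w) and the multisets
-- {{C_{t-1}(x) : x ∈ N(v)}} and {{C_{t-1}(x) : x ∈ N(w)}} agree, i.e. every
-- colour C_{t-1}(u) occurs with the same multiplicity in both.
sameColour : {n : ℕ} → Graph n → (Fin n → Bool) → ℕ → Fin n → Fin n → Bool
sameColour G part zero v w = part v ==B part w
sameColour G part (suc t) v w =
  sameColour G part t v w ∧
  allB (λ u → countTrue (λ x → G v x ∧ sameColour G part t x u)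
              ≡ᵇ countTrue (λ x → G w x ∧ sameColour G part t x u))

Good : {n : ℕ} → ℕ → Graph n → Set
Good {n} k G =
  (part : Fin n → Bool) →
  (∃[ v ] part v ≡ true) → (∃[ w ] part w ≡ false) →
  Σ (Fin n → Fin k) λ W → ((i : Fin k) →
            n ≤ 3 * k * countTrue (λ v → does (W v Data.Fin.≟ i))
          × k * countTrue (λ v → does (W v Data.Fin.≟ i)) ≤ 3 * n)
       × ((v w : Fin n) → sameColour G part 2 v w ≡ true → W v ≡ W w)

-- A switch replaces two edges ax, by by ay, bx. Toggling the four entries concerned is an involution of all
-- matrices, so double counting of switches yields the ratio between the numbers of regular graphs with
-- neighbouring values of a statistic; chained ratios give tail bounds and anti-concentration.
--
-- Codegrees: for every x some z has codegree at most about d²/n with x. If y has a codegree larger by a constant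
-- factor, every switch of the rows y, z that lowers it enlarges the count by a factor bounded away from 1, and
-- about d²/n ≫ log n switches are available. So with high probability all codegrees are at most (1 + o(1))d²/n,
-- and Chebyshev's inequality shows that the rows of almost all pairs a, b differ in both directions on any
-- given set of size ≫ n/d.
--
-- Balanced sets: let D and its complement have size ≫ n/d. Constant degree into D on a set S of linear size has
-- probability o(1)ⁿ: in linearly many disjoint pairs of S one can switch independently, and each pair has many
-- almost equally likely outcomes. This beats the union bound over all D and S.
--
-- Small sets: if U is the smaller side of the partition and |U| = O(n/d), then some {v : deg_U v ≥ j} is balanced
-- in this sense. Otherwise deg_U is constant outside O(n/d) vertices, which a single switch in each of linearly
-- many pairs shows to have probability exp(-Ω(n)), against n^O(n/d) choices of U and of the exceptional set.
--
-- After two rounds a colour class has constant degree into every union of first-round classes, in particular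
-- into a balanced one. So all classes have size o(n), and they can be grouped into k parts of nearly equal size.

module Submission where

open import Defs
open import Data.Nat using (ℕ; suc; _+_; _*_; _∸_; _^_; _≤_; _<_)
open import Data.Nat.Divisibility using (_∣_)
open import Data.Fin using (Fin)
open import Data.Bool using (Bool; true)
open import Data.List using (length; lookup)
open import Data.Product using (∃-syntax; _×_)
open import Relation.Binary.PropositionalEquality using (_≡_)

open import Data.Nat using (zero; _≤?_; _<?_; z≤n; s≤s; s≤s⁻¹; NonZero; >-nonZero; nonZero; _/_; _≡ᵇ_)
open import Data.Nat.Properties hiding (≡-irrelevant) renaming (_≟_ to _≟ℕ_)
open import Data.Nat.DivMod using (m/n*n≤m; m≡m%n+[m/n]*n; m%n<n; /-mono-≤; m*n/n≡m; m<n*o⇒m/o<n)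
open import Data.Nat.Tactic.RingSolver using (solve-∀)
open import Data.Fin using (zero; suc; toℕ; fromℕ<)
open import Data.Fin.Properties using (all?; any?; toℕ<n; toℕ-injective; toℕ-fromℕ<) renaming (_≟_ to _≟F_; suc-injective to sucF-injective)
open import Data.Bool using (false; _∧_; _∨_; not; if_then_else_; _xor_)
open import Data.Bool.Properties using (T?; ∧-zeroʳ; ∨-zeroʳ; ∨-comm; ∧-comm; xor-identityʳ; xor-same; xor-assoc) renaming (_≟_ to _≟B_)
open import Data.List using (List; []; _∷_; _++_; map; concatMap; filter; upTo; allFin; cartesianProduct)
open import Data.List.Properties using (length-++; length-map; length-upTo; length-tabulate)
open import Data.List.Membership.Propositional using (_∈_; lose)
open import Data.List.Membership.Propositional.Properties using (∈-map⁺; ∈-++⁺ˡ; ∈-++⁺ʳ; ∈-cartesianProduct⁺; ∈-upTo⁺; ∈-allFin; ∈-lookup)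
open import Data.List.Relation.Unary.All as All using (All; []; _∷_)
open import Data.List.Relation.Unary.All.Properties using (all-filter)
open import Data.List.Relation.Unary.AllPairs using (AllPairs; []; _∷_)
open import Data.List.Relation.Unary.Any as Any using (Any; here)
open import Data.List.Relation.Unary.Unique.Propositional using (Unique)
open import Data.List.Relation.Unary.Unique.Propositional.Properties using (cartesianProduct⁺; allFin⁺; filter⁺)
open import Data.Vec using (Vec; []; _∷_; tabulate)
open import Data.Vec.Properties using (lookup∘tabulate; tabulate∘lookup; tabulate-cong; ≡-dec)
open import Data.Product using (Σ; _,_; proj₁; proj₂)
open import Data.Sum using (_⊎_; inj₁; inj₂)
open import Data.Empty using (⊥; ⊥-elim)
open import Data.Unit using (tt)
open import Function using (_∘_; id)
open import Relation.Nullary using (¬_; Dec; yes; no; does; _×-dec_; _⊎-dec_; ¬?; contradiction)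
open import Relation.Binary.Definitions using (DecidableEquality; tri<; tri≈; tri>)
open import Relation.Binary.PropositionalEquality using (refl; sym; trans; cong; cong₂; subst; subst₂; module ≡-Reasoning)
open import Algebra.Properties.Semiring.Sum +-*-semiring using (sum)
  renaming (sum-cong-≗ to sum-cong-std; ∑-distrib-+ to sum-+-std; ∑-comm to sum-comm-std; *-distribˡ-sum to sum-*ˡ-std; *-distribʳ-sum to sum-*ʳ-std)
import Data.Bool
import Data.List
import Data.Vec

-- Sums and indicators

-- In the argument about degrees, switches use only columns in two small sets `E` and `E′`, of at
-- most `L ≈ T n / d` vertices each, and only rows outside both. A switch then touches its own pair
-- of rows and two rows in `E` or `E′`, so it preserves every condition on the rows of the other
-- pairs, and the gains of disjoint pairs multiply. Smallness makes the rows given up negligible,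
-- whereas `L d ≥ T n` lets two typical rows differ on a set of size `L` in a number of places of
-- order `T`: enough for concentration and for long chains of switches.
--
-- Balanced sets are the expensive case. The choices of `E`, `E′`, `D` and `S` cost `16ⁿ`, while
-- only about `n / (256 k²)` pairs are switched, so a single pair must gain an arbitrarily large
-- constant; it does so by reaching `K` different degrees through up to `K` successive switches. For
-- a small set one switch gains merely a bounded factor. There `E`, `E′` and the complement of `S`
-- have `O(L)` vertices, and `L log n` is at most a small multiple of `n`.

⟦_⟧ : Bool → ℕ
⟦ b ⟧ = if b then 1 else 0

[_] : {P : Set} → Dec P → ℕ
[ d ] = ⟦ does d ⟧

module _ {P : Set} where

  []-true : (d : Dec P) → P → [ d ] ≡ 1
  []-true (yes _) _ = refl
  []-true (no ¬p) p = contradiction p ¬p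

  []-false : (d : Dec P) → ¬ P → [ d ] ≡ 0
  []-false (yes p) ¬p = contradiction p ¬p
  []-false (no _) _ = refl

  []≤1 : (d : Dec P) → [ d ] ≤ 1
  []≤1 (yes _) = s≤s z≤n
  []≤1 (no _) = z≤n

module _ {P Q : Set} where

  []-mono : (p : Dec P) (q : Dec Q) → (P → Q) → [ p ] ≤ [ q ]
  []-mono (yes p) q f = ≤-reflexive (sym ([]-true q (f p)))
  []-mono (no _) q f = z≤n

  []-cong : (p : Dec P) (q : Dec Q) → (P → Q) → (Q → P) → [ p ] ≡ [ q ]
  []-cong (yes p) q f g = sym ([]-true q (f p))
  []-cong (no ¬p) q f g = sym ([]-false q (¬p ∘ g))

  []-× : (p : Dec P) (q : Dec Q) → [ p ×-dec q ] ≡ [ p ] * [ q ]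
  []-× (yes _) (yes _) = refl
  []-× (yes _) (no _) = refl
  []-× (no _) _ = refl

  []-split : (p : Dec P) (q : Dec Q) → [ p ] ≡ [ p ×-dec q ] + [ p ×-dec ¬? q ]
  []-split (yes _) (yes _) = refl
  []-split (yes _) (no _) = refl
  []-split (no _) _ = refl

⟦⟧≤1 : ∀ b → ⟦ b ⟧ ≤ 1
⟦⟧≤1 true = s≤s z≤n
⟦⟧≤1 false = z≤n

⟦⟧-∧ : ∀ a b → ⟦ a ∧ b ⟧ ≡ ⟦ a ⟧ * ⟦ b ⟧
⟦⟧-∧ true true = refl
⟦⟧-∧ true false = refl
⟦⟧-∧ false _ = refl

⟦⟧-mono : ∀ {a b} → (a ≡ true → b ≡ true) → ⟦ a ⟧ ≤ ⟦ b ⟧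
⟦⟧-mono {true} f rewrite f refl = ≤-refl
⟦⟧-mono {false} f = z≤n

⟦⟧-elim : ∀ {b} → 1 ≤ ⟦ b ⟧ → b ≡ true
⟦⟧-elim {true} _ = refl

∧-true : ∀ {a b} → a ∧ b ≡ true → (a ≡ true) × (b ≡ true)
∧-true {true} e = refl , e

∧-intro : ∀ {a b} → a ≡ true → b ≡ true → a ∧ b ≡ true
∧-intro refl e = e

not-true : ∀ {a} → not a ≡ true → a ≡ false
not-true {false} _ = refl

not-false : ∀ {a} → a ≡ false → not a ≡ true
not-false refl = refl

true≢false : ∀ {a} → a ≡ true → a ≡ false → ⊥
true≢false refl ()

opaque

  ∑ : ∀ {n} → (Fin n → ℕ) → ℕ
  ∑ = sum

  sum-cong : ∀ {n} {f g : Fin n → ℕ} → (∀ i → f i ≡ g i) → ∑ f ≡ ∑ g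
  sum-cong = sum-cong-std

  sum-+ : ∀ {n} (f g : Fin n → ℕ) → ∑ (λ i → f i + g i) ≡ ∑ f + ∑ g
  sum-+ = sum-+-std

  sum-comm : ∀ {m n} (f : Fin m → Fin n → ℕ) → ∑ (λ i → ∑ (λ j → f i j)) ≡ ∑ (λ j → ∑ (λ i → f i j))
  sum-comm = sum-comm-std

  sum-suc : ∀ {n} (f : Fin (suc n) → ℕ) → ∑ f ≡ f zero + ∑ (f ∘ suc)
  sum-suc f = refl

  sum-*ˡ : ∀ {n} c (f : Fin n → ℕ) → ∑ (λ i → c * f i) ≡ c * ∑ f
  sum-*ˡ c f = sym (sum-*ˡ-std c f)

  sum-*ʳ : ∀ {n} c (f : Fin n → ℕ) → ∑ (λ i → f i * c) ≡ ∑ f * c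
  sum-*ʳ c f = sym (sum-*ʳ-std c f)

  sum-mono : ∀ {n} {f g : Fin n → ℕ} → (∀ i → f i ≤ g i) → ∑ f ≤ ∑ g
  sum-mono {zero} h = z≤n
  sum-mono {suc n} h = +-mono-≤ (h zero) (sum-mono (h ∘ suc))

  countTrue≡∑ : ∀ {n} (f : Fin n → Bool) → countTrue f ≡ ∑ (λ i → ⟦ f i ⟧)
  countTrue≡∑ {zero} f = refl
  countTrue≡∑ {suc n} f = cong (⟦ f zero ⟧ +_) (countTrue≡∑ (f ∘ suc))

  sum-const : ∀ n c → ∑ {n} (λ _ → c) ≡ n * c
  sum-const zero c = refl
  sum-const (suc n) c = cong (c +_) (sum-const n c)

  sum-elem : ∀ {n} (f : Fin n → ℕ) i → f i ≤ ∑ f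
  sum-elem f zero = m≤m+n _ _
  sum-elem f (suc i) = ≤-trans (sum-elem (f ∘ suc) i) (m≤n+m _ _)

  sum-pos : ∀ {n} (f : Fin n → ℕ) → 1 ≤ ∑ f → ∃[ i ] (1 ≤ f i)
  sum-pos {suc n} f h with f zero in eq
  ... | suc _ = zero , subst (1 ≤_) (sym eq) (s≤s z≤n)
  ... | zero with sum-pos (f ∘ suc) h
  ... | i , p = suc i , p

  sum-large : ∀ {n} (f : Fin n → ℕ) c → n * c < ∑ f → ∃[ i ] (c < f i)
  sum-large {suc n} f c h with c <? f zero
  ... | yes p = zero , p
  ... | no ¬p with sum-large (f ∘ suc) c (+-cancelˡ-< c _ _ (<-≤-trans h (+-monoˡ-≤ _ (≮⇒≥ ¬p))))
  ... | i , p = suc i , p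

  sum-replace : ∀ {n} (f g : Fin n → ℕ) u → (∀ i → ¬ i ≡ u → f i ≡ g i) →
                ∑ f + g u ≡ ∑ g + f u
  sum-replace f g zero h = begin
    f zero + ∑ (f ∘ suc) + g zero ≡⟨ cong (λ z → f zero + z + g zero) (sum-cong (λ i → h (suc i) (λ ()))) ⟩
    f zero + ∑ (g ∘ suc) + g zero ≡⟨ swap (f zero) _ (g zero) ⟩
    g zero + ∑ (g ∘ suc) + f zero ∎
    where
    open ≡-Reasoning
    swap : ∀ a b c → a + b + c ≡ c + b + a
    swap = solve-∀
  sum-replace f g (suc u) h = begin
    f zero + ∑ (f ∘ suc) + g (suc u) ≡⟨ +-assoc (f zero) _ _ ⟩
    f zero + (∑ (f ∘ suc) + g (suc u)) ≡⟨ cong₂ _+_ (h zero (λ ())) (sum-replace (f ∘ suc) (g ∘ suc) u (λ i ne → h (suc i) (ne ∘ sucF-injective))) ⟩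
    g zero + (∑ (g ∘ suc) + f (suc u)) ≡⟨ sym (+-assoc (g zero) _ _) ⟩
    g zero + ∑ (g ∘ suc) + f (suc u) ∎
    where
    open ≡-Reasoning

sum-zero : ∀ {n} {f : Fin n → ℕ} → (∀ i → f i ≡ 0) → ∑ f ≡ 0
sum-zero {n} h = trans (sum-cong h) (trans (sum-const n 0) (*-zeroʳ n))

sum-product : ∀ {m n} (f : Fin m → ℕ) (g : Fin n → ℕ) →
              ∑ (λ i → ∑ (λ j → f i * g j)) ≡ ∑ f * ∑ g
sum-product f g = trans (sum-cong (λ i → sum-*ˡ (f i) g)) (sum-*ʳ (∑ g) f)

sum-≥ : ∀ {n} (f : Fin n → ℕ) X c → X ≤ ∑ f → (∀ i → f i ≤ c) → X ≤ n * c
sum-≥ {n} f X c h k = ≤-trans h (≤-trans (sum-mono k) (≤-reflexive (sum-const n c)))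

sum-replace₂ : ∀ {n} (f g : Fin n → ℕ) u v → ¬ u ≡ v →
               (∀ i → ¬ i ≡ u → ¬ i ≡ v → f i ≡ g i) →
               ∑ f + (g u + g v) ≡ ∑ g + (f u + f v)
sum-replace₂ f g u v u≢v h = +-cancelʳ-≡ (∑ m) _ _ (begin
  ∑ f + (g u + g v) + ∑ m ≡⟨ lem₁ (∑ f) (g u) (g v) (∑ m) ⟩
  (∑ f + g u) + (∑ m + g v) ≡⟨ cong₂ _+_ first second ⟩
  (∑ m + f u) + (∑ g + f v) ≡⟨ lem₂ (∑ m) (f u) (∑ g) (f v) ⟩
  ∑ g + (f u + f v) + ∑ m ∎)
  where
  open ≡-Reasoning
  m : Fin _ → ℕ
  m i with i ≟F u
  ... | yes _ = g i
  ... | no _ = f i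
  mu : m u ≡ g u
  mu with u ≟F u
  ... | yes _ = refl
  ... | no ¬p = contradiction refl ¬p
  mne : ∀ i → ¬ i ≡ u → m i ≡ f i
  mne i ne with i ≟F u
  ... | yes p = contradiction p ne
  ... | no _ = refl
  mo : ∀ i → ¬ i ≡ v → m i ≡ g i
  mo i ne with i ≟F u
  ... | yes _ = refl
  ... | no ¬p = h i ¬p ne
  first : ∑ f + g u ≡ ∑ m + f u
  first = trans (cong (∑ f +_) (sym mu)) (sum-replace f m u (λ i ne → sym (mne i ne)))
  second : ∑ m + g v ≡ ∑ g + f v
  second = trans (sum-replace m g v mo) (cong (∑ g +_) (mne v (u≢v ∘ sym)))
  lem₁ : ∀ a b c d → a + (b + c) + d ≡ (a + b) + (d + c)
  lem₁ = solve-∀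
  lem₂ : ∀ a b c d → (a + b) + (c + d) ≡ c + (b + d) + a
  lem₂ = solve-∀

sum-δ : ∀ {n} (f : Fin n → ℕ) j → ∑ (λ i → [ i ≟F j ] * f i) ≡ f j
sum-δ {n} f j = begin
  ∑ g ≡⟨ sym (+-identityʳ _) ⟩
  ∑ g + 0 ≡⟨ sum-replace g (λ _ → 0) j off ⟩
  ∑ {n} (λ _ → 0) + g j ≡⟨ cong₂ _+_ (sum-zero {n} (λ _ → refl)) gj ⟩
  f j ∎
  where
  open ≡-Reasoning
  g : Fin _ → ℕ
  g i = [ i ≟F j ] * f i
  off : ∀ i → ¬ i ≡ j → g i ≡ 0
  off i ne = cong (_* f i) ([]-false (i ≟F j) ne)
  gj : g j ≡ f j
  gj = trans (cong (_* f j) ([]-true (j ≟F j) refl)) (*-identityˡ _)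

sum-≤1 : ∀ {n} {P : Fin n → Set} (P? : ∀ i → Dec (P i)) → (∀ i j → P i → P j → i ≡ j) → ∑ (λ i → [ P? i ]) ≤ 1
sum-≤1 {n} P? uniq with any? P?
... | no ¬∃ = ≤-trans (≤-reflexive (sum-zero {n} (λ i → []-false (P? i) (λ p → ¬∃ (i , p))))) z≤n
... | yes (j , pj) = ≤-trans (sum-mono (λ i → ≤-trans ([]-mono (P? i) (i ≟F j) (λ p → uniq i j p pj)) (≤-reflexive (sym (*-identityʳ _)))))
                             (≤-reflexive (sum-δ (λ _ → 1) j))

-- Counting

-- `once` says that `ω` lists the sample space without repetition, so `total` is a sum over all of
-- `A`. A bound `c′ / c` on a quotient of counts is written `c * # P? ≤ c′ * # R?`, which avoids
-- division and empty denominators.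
module Counting {A : Set} (_≟_ : DecidableEquality A) {N : ℕ} (ω : Fin N → A)
                (once : ∀ M → ∑ (λ i → [ ω i ≟ M ]) ≡ 1) where

  opaque

    total : (A → ℕ) → ℕ
    total F = ∑ (λ i → F (ω i))

    total≡∑ : ∀ F → total F ≡ ∑ (λ i → F (ω i))
    total≡∑ F = refl

    # : {P : A → Set} → (∀ M → Dec (P M)) → ℕ
    # P? = total (λ M → [ P? M ])

    #≡total : {P : A → Set} (P? : ∀ M → Dec (P M)) → # P? ≡ total (λ M → [ P? M ])
    #≡total P? = refl

    total-mono : ∀ {F G : A → ℕ} → (∀ M → F M ≤ G M) → total F ≤ total G
    total-mono h = sum-mono (λ i → h (ω i))

    total-cong : ∀ {F G : A → ℕ} → (∀ M → F M ≡ G M) → total F ≡ total G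
    total-cong h = sum-cong (λ i → h (ω i))

    total-sum : ∀ {m} (F : Fin m → A → ℕ) → total (λ M → ∑ (λ j → F j M)) ≡ ∑ (λ j → total (F j))
    total-sum F = sum-comm (λ i j → F j (ω i))

    total-+ : (F G : A → ℕ) → total (λ M → F M + G M) ≡ total F + total G
    total-+ F G = sum-+ (F ∘ ω) (G ∘ ω)

    total-* : ∀ c (F : A → ℕ) → total (λ M → c * F M) ≡ c * total F
    total-* c F = sum-*ˡ c (F ∘ ω)

    #-mono : ∀ {P R : A → Set} (P? : ∀ M → Dec (P M)) (R? : ∀ M → Dec (R M)) →
             (∀ M → P M → R M) → # P? ≤ # R?
    #-mono P? R? h = total-mono (λ M → []-mono (P? M) (R? M) (h M))

    #-empty : ∀ {P : A → Set} (P? : ∀ M → Dec (P M)) → (∀ M → ¬ P M) → # P? ≡ 0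
    #-empty P? h = sum-zero (λ i → []-false (P? (ω i)) (h (ω i)))

    #-split : ∀ {P R : A → Set} (P? : ∀ M → Dec (P M)) (R? : ∀ M → Dec (R M)) →
              # P? ≡ # (λ M → P? M ×-dec R? M) + # (λ M → P? M ×-dec ¬? (R? M))
    #-split P? R? = trans (total-cong (λ M → []-split (P? M) (R? M))) (total-+ (λ M → [ P? M ×-dec R? M ]) (λ M → [ P? M ×-dec ¬? (R? M) ]))

    -- `φ` acts on `A`, not on indices. Writing `F (φ (ω i))` as a sum over the `j` with
    -- `ω j ≡ φ (ω i)`, and turning this condition into `ω i ≡ φ (ω j)`, lets `once` remove the sum
    -- over `i` instead.
    total-involution : (φ : A → A) → (∀ M → φ (φ M) ≡ M) → (F : A → ℕ) →
                       total (F ∘ φ) ≡ total F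
    total-involution φ inv F = begin
      ∑ (λ i → F (φ (ω i))) ≡⟨ sum-cong (λ i → sym (expand (φ (ω i)))) ⟩
      ∑ (λ i → ∑ (λ j → [ ω j ≟ φ (ω i) ] * F (ω j))) ≡⟨ sum-comm (λ i j → [ ω j ≟ φ (ω i) ] * F (ω j)) ⟩
      ∑ (λ j → ∑ (λ i → [ ω j ≟ φ (ω i) ] * F (ω j))) ≡⟨ sum-cong (λ j → sum-*ʳ (F (ω j)) (λ i → [ ω j ≟ φ (ω i) ])) ⟩
      ∑ (λ j → ∑ (λ i → [ ω j ≟ φ (ω i) ]) * F (ω j)) ≡⟨ sum-cong (λ j → cong (_* F (ω j)) (trans (sum-cong (λ i → flip i j)) (once (φ (ω j))))) ⟩
      ∑ (λ j → 1 * F (ω j)) ≡⟨ sum-cong (λ j → *-identityˡ _) ⟩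
      ∑ (λ j → F (ω j)) ∎
      where
      open ≡-Reasoning
      pick : ∀ X M → [ X ≟ M ] * F X ≡ [ X ≟ M ] * F M
      pick X M with X ≟ M
      ... | yes refl = refl
      ... | no _ = refl
      expand : ∀ M → ∑ (λ j → [ ω j ≟ M ] * F (ω j)) ≡ F M
      expand M = trans (sum-cong (λ j → pick (ω j) M))
                (trans (sum-*ʳ (F M) (λ j → [ ω j ≟ M ])) (trans (cong (_* F M) (once M)) (*-identityˡ _)))
      flip : ∀ i j → [ ω j ≟ φ (ω i) ] ≡ [ ω i ≟ φ (ω j) ]
      flip i j = []-cong (ω j ≟ φ (ω i)) (ω i ≟ φ (ω j)) (λ e → sym (trans (cong φ e) (inv _))) (λ e → sym (trans (cong φ e) (inv _)))

    -- Comparing two events class by class, where the classes are the fibres of two (possibly different) keys.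
    stratify : ∀ {P R : A → Set} (P? : ∀ M → Dec (P M)) (R? : ∀ M → Dec (R M))
               {K : Set} (_≟K_ : DecidableEquality K) {B : ℕ} (κ : Fin B → K) (key key′ : A → K) →
               (∀ M → P M → 1 ≤ ∑ (λ j → [ κ j ≟K key M ])) →
               (∀ M → ∑ (λ j → [ κ j ≟K key′ M ]) ≤ 1) → ∀ c c′ →
               (∀ v → c * # (λ M → P? M ×-dec (v ≟K key M)) ≤ c′ * # (λ M → R? M ×-dec (v ≟K key′ M))) →
               c * # P? ≤ c′ * # R?
    stratify P? R? _≟K_ κ key key′ cover uniq c c′ h = begin
      c * # P? ≤⟨ *-monoʳ-≤ c (total-mono lower) ⟩
      c * total (λ M → ∑ (λ j → [ P? M ×-dec (κ j ≟K key M) ])) ≡⟨ cong (c *_) (total-sum (λ j M → [ P? M ×-dec (κ j ≟K key M) ])) ⟩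
      c * ∑ (λ j → # (λ M → P? M ×-dec (κ j ≟K key M))) ≡⟨ sym (sum-*ˡ c _) ⟩
      ∑ (λ j → c * # (λ M → P? M ×-dec (κ j ≟K key M))) ≤⟨ sum-mono (λ j → h (κ j)) ⟩
      ∑ (λ j → c′ * # (λ M → R? M ×-dec (κ j ≟K key′ M))) ≡⟨ sum-*ˡ c′ _ ⟩
      c′ * ∑ (λ j → # (λ M → R? M ×-dec (κ j ≟K key′ M))) ≡⟨ cong (c′ *_) (sym (total-sum (λ j M → [ R? M ×-dec (κ j ≟K key′ M) ]))) ⟩
      c′ * total (λ M → ∑ (λ j → [ R? M ×-dec (κ j ≟K key′ M) ])) ≤⟨ *-monoʳ-≤ c′ (total-mono upper) ⟩
      c′ * # R? ∎
      where
      open ≤-Reasoning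
      factor : ∀ {S : Set} (s : Dec S) k → ∑ (λ j → [ s ×-dec (κ j ≟K k) ]) ≡ [ s ] * ∑ (λ j → [ κ j ≟K k ])
      factor s k = trans (sum-cong (λ j → []-× s (κ j ≟K k))) (sum-*ˡ [ s ] (λ j → [ κ j ≟K k ]))
      lower : ∀ M → [ P? M ] ≤ ∑ (λ j → [ P? M ×-dec (κ j ≟K key M) ])
      lower M with P? M | factor (P? M) (key M) | cover M
      ... | no _ | _ | _ = z≤n
      ... | yes p | eq | c = ≤-trans (c p) (≤-reflexive (sym (trans eq (*-identityˡ _))))
      upper : ∀ M → ∑ (λ j → [ R? M ×-dec (κ j ≟K key′ M) ]) ≤ [ R? M ]
      upper M = ≤-trans (≤-reflexive (factor (R? M) (key′ M)))
               (≤-trans (*-monoʳ-≤ [ R? M ] (uniq M)) (≤-reflexive (*-identityʳ _)))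

    union-bound : ∀ {X : Set} {P : X → A → Set} (P? : ∀ x M → Dec (P x M)) (L : List X) c c′ →
                  (∀ x → c * # (P? x) ≤ c′) →
                  c * # (λ M → Any.any? (λ x → P? x M) L) ≤ length L * c′
    union-bound P? [] c c′ h = ≤-reflexive (trans (cong (c *_) (sum-zero {f = λ _ → 0} (λ _ → refl))) (*-zeroʳ c))
    union-bound P? (x ∷ L) c c′ h = begin
      c * # (λ M → Any.any? (λ y → P? y M) (x ∷ L)) ≤⟨ *-monoʳ-≤ c (≤-trans (total-mono sub) (≤-reflexive (total-+ (λ M → [ P? x M ]) (λ M → [ Any.any? (λ y → P? y M) L ])))) ⟩
      c * (# (P? x) + # (λ M → Any.any? (λ y → P? y M) L)) ≡⟨ *-distribˡ-+ c _ _ ⟩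
      c * # (P? x) + c * # (λ M → Any.any? (λ y → P? y M) L) ≤⟨ +-mono-≤ (h x) (union-bound P? L c c′ h) ⟩
      c′ + length L * c′ ∎
      where
      open ≤-Reasoning
      sub : ∀ M → [ Any.any? (λ y → P? y M) (x ∷ L) ] ≤ [ P? x M ] + [ Any.any? (λ y → P? y M) L ]
      sub M with P? x M
      ... | yes _ = s≤s z≤n
      ... | no _ = ≤-refl

-- Switches

Row : ℕ → Set
Row n = Vec Bool n

VG : ℕ → Set
VG n = Vec (Row n) n

infixl 20 _!_
_!_ : ∀ {A : Set} {n} → Vec A n → Fin n → A
v ! i = Data.Vec.lookup v i

_≟R_ : ∀ {n} → DecidableEquality (Row n)
_≟R_ = ≡-dec _≟B_

_≟G_ : ∀ {n} → DecidableEquality (VG n)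
_≟G_ = ≡-dec _≟R_

Vec-ext : ∀ {A : Set} {n} {u v : Vec A n} → (∀ i → u ! i ≡ v ! i) → u ≡ v
Vec-ext {u = u} {v} h = trans (sym (tabulate∘lookup u)) (trans (tabulate-cong h) (tabulate∘lookup v))

module _ {n : ℕ} where

  eq : Fin n → Fin n → Bool
  eq i j = does (i ≟F j)

  eq-refl : ∀ i → eq i i ≡ true
  eq-refl i with i ≟F i
  ... | yes _ = refl
  ... | no ¬p = contradiction refl ¬p

  eq-≢ : ∀ {i j} → ¬ i ≡ j → eq i j ≡ false
  eq-≢ {i} {j} ne with i ≟F j
  ... | yes p = contradiction p ne
  ... | no _ = refl

  -- The columns of `A` in which an edge could be moved from row `r` to row `s`. Products of two
  -- such counts are numbers of switches.
  e : (Fin n → Bool) → Row n → Row n → ℕ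
  e A r s = ∑ (λ j → ⟦ A j ∧ (r ! j ∧ not (s ! j)) ⟧)

  dg : (Fin n → Bool) → Row n → ℕ
  dg D r = ∑ (λ j → ⟦ D j ∧ r ! j ⟧)

  Reg : ℕ → VG n → Set
  Reg d M = (∀ i j → M ! i ! j ≡ M ! j ! i) × (∀ i → M ! i ! i ≡ false) × (∀ i → dg (λ _ → true) (M ! i) ≡ d)

  Reg? : ∀ d M → Dec (Reg d M)
  Reg? d M = all? (λ i → all? (λ j → (M ! i ! j) ≟B (M ! j ! i)))
       ×-dec (all? (λ i → (M ! i ! i) ≟B false) ×-dec all? (λ i → dg (λ _ → true) (M ! i) ≟ℕ d))

  -- Only columns `u` and `w` may change. In the uses below `w` lies outside the set in which edges
  -- are counted, so its two values agree.
  sum-drop : (f g : Fin n → Bool) (u w : Fin n) → ¬ u ≡ w →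
             (∀ j → ¬ j ≡ u → ¬ j ≡ w → f j ≡ g j) →
             f u ≡ true → g u ≡ false → f w ≡ g w → ∑ (λ j → ⟦ f j ⟧) ≡ suc (∑ (λ j → ⟦ g j ⟧))
  sum-drop f g u w ne h fu gu fw = +-cancelʳ-≡ ⟦ g w ⟧ _ _ (begin
    ∑ (λ j → ⟦ f j ⟧) + ⟦ g w ⟧ ≡⟨ cong (λ z → ∑ (λ j → ⟦ f j ⟧) + (⟦ z ⟧ + ⟦ g w ⟧)) (sym gu) ⟩
    ∑ (λ j → ⟦ f j ⟧) + (⟦ g u ⟧ + ⟦ g w ⟧) ≡⟨ sum-replace₂ (λ j → ⟦ f j ⟧) (λ j → ⟦ g j ⟧) u w ne (λ j p q → cong ⟦_⟧ (h j p q)) ⟩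
    ∑ (λ j → ⟦ g j ⟧) + (⟦ f u ⟧ + ⟦ f w ⟧) ≡⟨ cong₂ (λ y z → ∑ (λ j → ⟦ g j ⟧) + (⟦ y ⟧ + ⟦ z ⟧)) fu fw ⟩
    ∑ (λ j → ⟦ g j ⟧) + suc ⟦ g w ⟧ ≡⟨ +-suc _ _ ⟩
    suc (∑ (λ j → ⟦ g j ⟧) + ⟦ g w ⟧) ∎)
    where open ≡-Reasoning

  sum-swap : (f g : Fin n → Bool) (u w : Fin n) → ¬ u ≡ w →
             (∀ j → ¬ j ≡ u → ¬ j ≡ w → f j ≡ g j) →
             f u ≡ true → f w ≡ false → g u ≡ false → g w ≡ true →
             ∑ (λ j → ⟦ f j ⟧) ≡ ∑ (λ j → ⟦ g j ⟧)
  sum-swap f g u w ne h fu fw gu gw = +-cancelʳ-≡ 1 _ _ (begin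
    ∑ (λ j → ⟦ f j ⟧) + 1 ≡⟨ cong₂ (λ y z → ∑ (λ j → ⟦ f j ⟧) + (⟦ y ⟧ + ⟦ z ⟧)) (sym gu) (sym gw) ⟩
    ∑ (λ j → ⟦ f j ⟧) + (⟦ g u ⟧ + ⟦ g w ⟧) ≡⟨ sum-replace₂ (λ j → ⟦ f j ⟧) (λ j → ⟦ g j ⟧) u w ne (λ j p q → cong ⟦_⟧ (h j p q)) ⟩
    ∑ (λ j → ⟦ g j ⟧) + (⟦ f u ⟧ + ⟦ f w ⟧) ≡⟨ cong₂ (λ y z → ∑ (λ j → ⟦ g j ⟧) + (⟦ y ⟧ + ⟦ z ⟧)) fu fw ⟩
    ∑ (λ j → ⟦ g j ⟧) + 1 ∎)
    where open ≡-Reasoning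

  module _ (a b x y : Fin n) where

    -- The second disjunct is the first one transposed, which keeps matrices symmetric.
    toggled : Fin n → Fin n → Bool
    toggled i j = ((eq i a ∨ eq i b) ∧ (eq j x ∨ eq j y)) ∨ ((eq i x ∨ eq i y) ∧ (eq j a ∨ eq j b))

    -- Toggling unconditionally makes τ an involution of all matrices; it preserves regularity where Sw holds.
    τ : VG n → VG n
    τ M = tabulate (λ i → tabulate (λ j → (M ! i ! j) xor toggled i j))

    τ-entry : ∀ M i j → τ M ! i ! j ≡ (M ! i ! j) xor toggled i j
    τ-entry M i j = trans (cong (_! j) (lookup∘tabulate (λ i → tabulate (λ j → (M ! i ! j) xor toggled i j)) i)) (lookup∘tabulate _ j)

    τ-involutive : ∀ M → τ (τ M) ≡ M
    τ-involutive M = Vec-ext (λ i → Vec-ext (λ j →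
      trans (τ-entry (τ M) i j) (trans (cong (_xor toggled i j) (τ-entry M i j))
      (trans (xor-assoc (M ! i ! j) _ _) (trans (cong ((M ! i ! j) xor_) (xor-same (toggled i j))) (xor-identityʳ _))))))

    Sw : VG n → Set
    Sw M = (M ! a ! x ≡ true) × (M ! b ! y ≡ true) × (M ! a ! y ≡ false) × (M ! b ! x ≡ false)

    toggled-sym : ∀ i j → toggled i j ≡ toggled j i
    toggled-sym i j = trans (∨-comm ((eq i a ∨ eq i b) ∧ (eq j x ∨ eq j y)) _)
      (cong₂ _∨_ (∧-comm (eq i x ∨ eq i y) _) (∧-comm (eq i a ∨ eq i b) _))

  module Switching (a b x y : Fin n) (a≢b : ¬ a ≡ b) (x≢y : ¬ x ≡ y)
                   (a≢x : ¬ a ≡ x) (a≢y : ¬ a ≡ y) (b≢x : ¬ b ≡ x) (b≢y : ¬ b ≡ y) where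

    private
      tog : Fin n → Fin n → Bool
      tog = toggled a b x y

      flip : ∀ {M i j} → tog i j ≡ true → τ a b x y M ! i ! j ≡ not (M ! i ! j)
      flip {M} {i} {j} h = trans (τ-entry a b x y M i j) (trans (cong ((M ! i ! j) xor_) h) (lem (M ! i ! j)))
        where
        lem : ∀ p → p xor true ≡ not p
        lem true = refl
        lem false = refl

      keep : ∀ {M i j} → tog i j ≡ false → τ a b x y M ! i ! j ≡ M ! i ! j
      keep {M} {i} {j} h = trans (τ-entry a b x y M i j) (trans (cong ((M ! i ! j) xor_) h) (xor-identityʳ _))

      ∨-left : ∀ {p q} → p ≡ true → p ∨ q ≡ true
      ∨-left refl = refl

      ∨-right : ∀ {p q} → q ≡ true → p ∨ q ≡ true
      ∨-right {p} refl = ∨-zeroʳ p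

      ∨-false : ∀ {p q} → p ≡ false → q ≡ false → p ∨ q ≡ false
      ∨-false refl refl = refl

      ∧-falseˡ : ∀ {p q} → p ≡ false → p ∧ q ≡ false
      ∧-falseˡ refl = refl

      ∧-falseʳ : ∀ {p q} → q ≡ false → p ∧ q ≡ false
      ∧-falseʳ {p} refl = ∧-zeroʳ p

      untouched : ∀ {i j} → (¬ i ≡ a × ¬ i ≡ b) ⊎ (¬ j ≡ x × ¬ j ≡ y) →
                  (¬ i ≡ x × ¬ i ≡ y) ⊎ (¬ j ≡ a × ¬ j ≡ b) → tog i j ≡ false
      untouched {i} {j} h k = ∨-false (one h) (two k)
        where
        one : (¬ i ≡ a × ¬ i ≡ b) ⊎ (¬ j ≡ x × ¬ j ≡ y) → (eq i a ∨ eq i b) ∧ (eq j x ∨ eq j y) ≡ false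
        one (inj₁ (p , q)) = ∧-falseˡ (∨-false (eq-≢ p) (eq-≢ q))
        one (inj₂ (p , q)) = ∧-falseʳ {eq i a ∨ eq i b} (∨-false (eq-≢ p) (eq-≢ q))
        two : (¬ i ≡ x × ¬ i ≡ y) ⊎ (¬ j ≡ a × ¬ j ≡ b) → (eq i x ∨ eq i y) ∧ (eq j a ∨ eq j b) ≡ false
        two (inj₁ (p , q)) = ∧-falseˡ (∨-false (eq-≢ p) (eq-≢ q))
        two (inj₂ (p , q)) = ∧-falseʳ {eq i x ∨ eq i y} (∨-false (eq-≢ p) (eq-≢ q))

      touched : ∀ {i j} → (i ≡ a ⊎ i ≡ b) → (j ≡ x ⊎ j ≡ y) → tog i j ≡ true
      touched {i} {j} h k = ∨-left (∧-intro (one h) (two k))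
        where
        one : (i ≡ a ⊎ i ≡ b) → eq i a ∨ eq i b ≡ true
        one (inj₁ refl) = ∨-left (eq-refl i)
        one (inj₂ refl) = ∨-right {eq i a} (eq-refl i)
        two : (j ≡ x ⊎ j ≡ y) → eq j x ∨ eq j y ≡ true
        two (inj₁ refl) = ∨-left (eq-refl j)
        two (inj₂ refl) = ∨-right {eq j x} (eq-refl j)

      diag : ∀ i → tog i i ≡ false
      diag i = go (i ≟F x) (i ≟F y)
        where
        go : Dec (i ≡ x) → Dec (i ≡ y) → tog i i ≡ false
        go (yes refl) _ = untouched (inj₁ (a≢x ∘ sym , b≢x ∘ sym)) (inj₂ (a≢x ∘ sym , b≢x ∘ sym))
        go (no _) (yes refl) = untouched (inj₁ (a≢y ∘ sym , b≢y ∘ sym)) (inj₂ (a≢y ∘ sym , b≢y ∘ sym))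
        go (no p) (no q) = untouched (inj₂ (p , q)) (inj₁ (p , q))

    row-other : ∀ M i → ¬ i ≡ a → ¬ i ≡ b → ¬ i ≡ x → ¬ i ≡ y → τ a b x y M ! i ≡ M ! i
    row-other M i p q r s = Vec-ext (λ j → keep {M} {i} {j} (untouched {i} {j} (inj₁ (p , q)) (inj₁ (r , s))))

    row-a : ∀ M j → ¬ j ≡ x → ¬ j ≡ y → τ a b x y M ! a ! j ≡ M ! a ! j
    row-a M j p q = keep {M} (untouched (inj₂ (p , q)) (inj₁ (a≢x , a≢y)))

    row-b : ∀ M j → ¬ j ≡ x → ¬ j ≡ y → τ a b x y M ! b ! j ≡ M ! b ! j
    row-b M j p q = keep {M} (untouched (inj₂ (p , q)) (inj₁ (b≢x , b≢y)))

    Sw-reverse : ∀ M → Sw a b x y M → Sw b a x y (τ a b x y M)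
    Sw-reverse M (ax , by , ay , bx) =
      trans (flip {M} (touched (inj₂ refl) (inj₁ refl))) (cong not bx) ,
      trans (flip {M} (touched (inj₁ refl) (inj₂ refl))) (cong not ay) ,
      trans (flip {M} (touched (inj₂ refl) (inj₂ refl))) (cong not by) ,
      trans (flip {M} (touched (inj₁ refl) (inj₁ refl))) (cong not ax)

    Reg-τ : ∀ {d} M → Sw a b x y M → Reg d M → Reg d (τ a b x y M)
    Reg-τ {d} M sw@(ax , by , ay , bx) (symm , irr , deg) = symm′ , irr′ , deg′
      where
      M′ : VG n
      M′ = τ a b x y M
      symm′ : ∀ i j → M′ ! i ! j ≡ M′ ! j ! i
      symm′ i j = trans (τ-entry a b x y M i j) (trans (cong₂ _xor_ (symm i j) (toggled-sym a b x y i j)) (sym (τ-entry a b x y M j i)))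
      irr′ : ∀ i → M′ ! i ! i ≡ false
      irr′ i = trans (keep {M} (diag i)) (irr i)
      bx′ : M′ ! b ! x ≡ true
      bx′ = proj₁ (Sw-reverse M sw)
      ay′ : M′ ! a ! y ≡ true
      ay′ = proj₁ (proj₂ (Sw-reverse M sw))
      by′ : M′ ! b ! y ≡ false
      by′ = proj₁ (proj₂ (proj₂ (Sw-reverse M sw)))
      ax′ : M′ ! a ! x ≡ false
      ax′ = proj₂ (proj₂ (proj₂ (Sw-reverse M sw)))
      swap : ∀ i u w → ¬ u ≡ w → (∀ j → ¬ j ≡ u → ¬ j ≡ w → M ! i ! j ≡ M′ ! i ! j) →
             M ! i ! u ≡ true → M ! i ! w ≡ false → M′ ! i ! u ≡ false → M′ ! i ! w ≡ true →
             dg (λ _ → true) (M′ ! i) ≡ d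
      swap i u w ne h p q r s = trans (sym (sum-swap (M ! i !_) (M′ ! i !_) u w ne h p q r s)) (deg i)
      deg′ : ∀ i → dg (λ _ → true) (M′ ! i) ≡ d
      deg′ i = go (i ≟F a) (i ≟F b) (i ≟F x) (i ≟F y)
        where
        go : Dec (i ≡ a) → Dec (i ≡ b) → Dec (i ≡ x) → Dec (i ≡ y) → dg (λ _ → true) (M′ ! i) ≡ d
        go (yes refl) _ _ _ = swap a x y x≢y (λ j p q → sym (row-a M j p q)) ax ay ax′ ay′
        go (no _) (yes refl) _ _ = swap b y x (x≢y ∘ sym) (λ j p q → sym (row-b M j q p)) by bx by′ bx′
        go (no p) (no q) (yes refl) _ = swap x a b a≢b
              (λ j r s → sym (keep {M} (untouched (inj₁ (p , q)) (inj₂ (r , s)))))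
              (trans (symm x a) ax) (trans (symm x b) bx) (trans (symm′ x a) ax′) (trans (symm′ x b) bx′)
        go (no p) (no q) (no _) (yes refl) = swap y b a (a≢b ∘ sym)
              (λ j r s → sym (keep {M} (untouched (inj₁ (p , q)) (inj₂ (s , r)))))
              (trans (symm y b) by) (trans (symm y a) ay) (trans (symm′ y b) by′) (trans (symm′ y a) ay′)
        go (no p) (no q) (no r) (no s) = trans (cong (dg (λ _ → true)) (row-other M i p q r s)) (deg i)

    private
      e-drop : ∀ A u w r s r′ s′ → ¬ u ≡ w → A u ≡ true → A w ≡ false →
               (∀ j → ¬ j ≡ u → ¬ j ≡ w → r ! j ≡ r′ ! j) → (∀ j → ¬ j ≡ u → ¬ j ≡ w → s ! j ≡ s′ ! j) →
               r ! u ≡ true → s ! u ≡ false → r′ ! u ≡ false → e A r s ≡ suc (e A r′ s′)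
      e-drop A u w r s r′ s′ ne Au Aw hr hs ru su ru′ =
        sum-drop (λ j → A j ∧ (r ! j ∧ not (s ! j))) (λ j → A j ∧ (r′ ! j ∧ not (s′ ! j))) u w ne
          (λ j p q → cong₂ (λ y z → A j ∧ (y ∧ not z)) (hr j p q) (hs j p q))
          (∧-intro Au (∧-intro ru (cong not su)))
          (∧-falseʳ {A u} (∧-falseˡ ru′)) (trans (∧-falseˡ Aw) (sym (∧-falseˡ Aw)))

      dg-drop : ∀ D u w r r′ → ¬ u ≡ w → D u ≡ true → D w ≡ false →
                (∀ j → ¬ j ≡ u → ¬ j ≡ w → r ! j ≡ r′ ! j) → r ! u ≡ true → r′ ! u ≡ false →
                dg D r ≡ suc (dg D r′)
      dg-drop D u w r r′ ne Du Dw hr ru ru′ =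
        sum-drop (λ j → D j ∧ r ! j) (λ j → D j ∧ r′ ! j) u w ne (λ j p q → cong (D j ∧_) (hr j p q))
          (∧-intro Du ru) (∧-falseʳ {D u} ru′) (trans (∧-falseˡ Dw) (sym (∧-falseˡ Dw)))

    -- A switch changes each count by exactly one, with a sign that depends only on which of `x` and
    -- `y` lies in `A`. Hence the counts after several switches are determined by those before,
    -- whichever switches were chosen.
    module Effect (M : VG n) (sw : Sw a b x y M) where
      private
        M′ : VG n
        M′ = τ a b x y M
        ka : ∀ j → ¬ j ≡ x → ¬ j ≡ y → M ! a ! j ≡ M′ ! a ! j
        ka j p q = sym (row-a M j p q)
        kb : ∀ j → ¬ j ≡ x → ¬ j ≡ y → M ! b ! j ≡ M′ ! b ! j
        kb j p q = sym (row-b M j p q)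
        ax : M ! a ! x ≡ true
        ax = proj₁ sw
        by : M ! b ! y ≡ true
        by = proj₁ (proj₂ sw)
        ay : M ! a ! y ≡ false
        ay = proj₁ (proj₂ (proj₂ sw))
        bx : M ! b ! x ≡ false
        bx = proj₂ (proj₂ (proj₂ sw))
        bx′ : M′ ! b ! x ≡ true
        bx′ = proj₁ (Sw-reverse M sw)
        ay′ : M′ ! a ! y ≡ true
        ay′ = proj₁ (proj₂ (Sw-reverse M sw))
        by′ : M′ ! b ! y ≡ false
        by′ = proj₁ (proj₂ (proj₂ (Sw-reverse M sw)))
        ax′ : M′ ! a ! x ≡ false
        ax′ = proj₂ (proj₂ (proj₂ (Sw-reverse M sw)))

      module _ (A : Fin n → Bool) (Ax : A x ≡ true) (Ay : A y ≡ false) where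
        e₁ : e A (M ! a) (M ! b) ≡ suc (e A (M′ ! a) (M′ ! b))
        e₁ = e-drop A x y (M ! a) (M ! b) (M′ ! a) (M′ ! b) x≢y Ax Ay ka kb ax bx ax′
        e₂ : e A (M′ ! b) (M′ ! a) ≡ suc (e A (M ! b) (M ! a))
        e₂ = e-drop A x y (M′ ! b) (M′ ! a) (M ! b) (M ! a) x≢y Ax Ay (λ j p q → sym (kb j p q)) (λ j p q → sym (ka j p q)) bx′ ax′ bx
        dg-b : dg A (M′ ! b) ≡ suc (dg A (M ! b))
        dg-b = dg-drop A x y (M′ ! b) (M ! b) x≢y Ax Ay (λ j p q → sym (kb j p q)) bx′ bx

      module _ (A : Fin n → Bool) (Ax : A x ≡ false) (Ay : A y ≡ true) where
        e₃ : e A (M′ ! a) (M′ ! b) ≡ suc (e A (M ! a) (M ! b))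
        e₃ = e-drop A y x (M′ ! a) (M′ ! b) (M ! a) (M ! b) (x≢y ∘ sym) Ay Ax (λ j p q → sym (ka j q p)) (λ j p q → sym (kb j q p)) ay′ by′ ay
        e₄ : e A (M ! b) (M ! a) ≡ suc (e A (M′ ! b) (M′ ! a))
        e₄ = e-drop A y x (M ! b) (M ! a) (M′ ! b) (M′ ! a) (x≢y ∘ sym) Ay Ax (λ j p q → kb j q p) (λ j p q → ka j q p) by ay by′

-- Ratios and chains of ratios

does-true : ∀ {P : Set} (d : Dec P) → does d ≡ true → P
does-true (yes p) _ = p

true-does : ∀ {P : Set} (d : Dec P) → P → does d ≡ true
true-does (yes _) _ = refl
true-does (no ¬p) p = contradiction p ¬p

module Switches {n N : ℕ} (ω : Fin N → VG n) (once : ∀ M → ∑ (λ i → [ ω i ≟G M ]) ≡ 1) where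

  open Counting _≟G_ ω once public

  stratifyℕ : ∀ {P R : VG n → Set} (P? : ∀ M → Dec (P M)) (R? : ∀ M → Dec (R M))
              (B : ℕ) (key key′ : VG n → ℕ) → (∀ {M} → key M < B) → ∀ c c′ →
              (∀ v → c * # (λ M → P? M ×-dec (v ≟ℕ key M)) ≤ c′ * # (λ M → R? M ×-dec (v ≟ℕ key′ M))) →
              c * # P? ≤ c′ * # R?
  stratifyℕ P? R? B key key′ bd = stratify P? R? _≟ℕ_ {B} toℕ key key′ (λ M _ → cover bd) (λ M → uniq (key′ M))
    where
    cover : ∀ {k} → k < B → 1 ≤ ∑ {B} (λ j → [ toℕ j ≟ℕ k ])
    cover {k} k<B = ≤-trans (≤-reflexive (sym ([]-true (toℕ (fromℕ< k<B) ≟ℕ k) (toℕ-fromℕ< k<B)))) (sum-elem (λ j → [ toℕ j ≟ℕ k ]) (fromℕ< k<B))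
    uniq : ∀ k → ∑ {B} (λ j → [ toℕ j ≟ℕ k ]) ≤ 1
    uniq k = sum-≤1 (λ j → toℕ j ≟ℕ k) (λ i j p q → toℕ-injective (trans p (sym q)))

  -- With `x` in `E` and `y` in `E′` these conditions make `a`, `b`, `x`, `y` distinct. They also
  -- keep the rows `x` and `y` apart from the rows of every framed pair.
  record Frame (E E′ : Fin n → Bool) (a b : Fin n) : Set where
    field
      a≢b : ¬ a ≡ b
      disj : ∀ j → E j ≡ true → E′ j ≡ false
      Ea : E a ≡ false
      E′a : E′ a ≡ false
      Eb : E b ≡ false
      E′b : E′ b ≡ false

  Frame-sym : ∀ {E E′ a b} → Frame E E′ a b → Frame E E′ b a
  Frame-sym F = record { a≢b = a≢b ∘ sym ; disj = disj ; Ea = Eb ; E′a = E′b ; Eb = Ea ; E′b = E′a }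
    where open Frame F

  outside : ∀ (A : Fin n → Bool) {i x} → A i ≡ false → A x ≡ true → ¬ i ≡ x
  outside A p q refl = true≢false q p

  Closed : (E E′ : Fin n → Bool) (a b : Fin n) (P R : VG n → Set) → Set
  Closed E E′ a b P R = ∀ M x y → E x ≡ true → E′ y ≡ true → Sw a b x y M → P M → R (τ a b x y M)

  module Pair (E E′ : Fin n → Bool) (a b : Fin n) (F : Frame E E′ a b) where
    open Frame F

    -- `s₁ M * s₄ M` is the number of switches available at `M`, and `s₂ M * s₃ M` the number of
    -- reversed ones, that is, of switches ending in `M`.
    s₁ s₂ s₃ s₄ : VG n → ℕ
    s₁ M = e E (M ! a) (M ! b)
    s₂ M = e E (M ! b) (M ! a)
    s₃ M = e E′ (M ! a) (M ! b)
    s₄ M = e E′ (M ! b) (M ! a)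

    disj′ : ∀ {x y} → E x ≡ true → E′ y ≡ true → ¬ x ≡ y
    disj′ Ex E′y refl = true≢false E′y (disj _ Ex)

    E-at : ∀ {y} → E′ y ≡ true → E y ≡ false
    E-at {y} E′y with E y in eqn
    ... | true = ⊥-elim (true≢false E′y (disj y eqn))
    ... | false = refl

    module Sg (x y : Fin n) (Ex : E x ≡ true) (E′y : E′ y ≡ true) =
      Switching a b x y a≢b (disj′ Ex E′y) (outside E Ea Ex) (outside E′ E′a E′y) (outside E Eb Ex) (outside E′ E′b E′y)

    private
      down up : VG n → Fin n → Fin n → Bool
      down M x y = (E x ∧ (M ! a ! x ∧ not (M ! b ! x))) ∧ (E′ y ∧ (M ! b ! y ∧ not (M ! a ! y)))
      up M x y = (E x ∧ (M ! b ! x ∧ not (M ! a ! x))) ∧ (E′ y ∧ (M ! a ! y ∧ not (M ! b ! y)))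

      down-sum : ∀ M → s₁ M * s₄ M ≡ ∑ (λ x → ∑ (λ y → ⟦ down M x y ⟧))
      down-sum M = trans (sym (sum-product _ _)) (sum-cong (λ x → sum-cong (λ y →
        sym (⟦⟧-∧ (E x ∧ (M ! a ! x ∧ not (M ! b ! x))) (E′ y ∧ (M ! b ! y ∧ not (M ! a ! y)))))))

      up-sum : ∀ M → s₂ M * s₃ M ≡ ∑ (λ x → ∑ (λ y → ⟦ up M x y ⟧))
      up-sum M = trans (sym (sum-product _ _)) (sum-cong (λ x → sum-cong (λ y →
        sym (⟦⟧-∧ (E x ∧ (M ! b ! x ∧ not (M ! a ! x))) (E′ y ∧ (M ! a ! y ∧ not (M ! b ! y)))))))

      distribute : ∀ c (f : Fin n → Fin n → Bool) → ⟦ c ⟧ * ∑ (λ x → ∑ (λ y → ⟦ f x y ⟧)) ≡ ∑ (λ x → ∑ (λ y → ⟦ c ∧ f x y ⟧))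
      distribute c f = trans (sym (sum-*ˡ ⟦ c ⟧ _)) (sum-cong (λ x → trans (sym (sum-*ˡ ⟦ c ⟧ _)) (sum-cong (λ y → sym (⟦⟧-∧ c (f x y))))))

    -- Double counting of the switches leading from P to R.
    step : ∀ {P R : VG n → Set} (P? : ∀ M → Dec (P M)) (R? : ∀ M → Dec (R M)) → Closed E E′ a b P R →
           ∀ α β → (∀ M → P M → α ≤ s₁ M * s₄ M) → (∀ M → R M → s₂ M * s₃ M ≤ β) →
           α * # P? ≤ β * # R?
    step {P} {R} P? R? cl α β lo hi = begin
      α * # P? ≡⟨ cong (α *_) (#≡total P?) ⟩
      α * total (λ M → [ P? M ]) ≡⟨ sym (total-* α _) ⟩
      total (λ M → α * [ P? M ]) ≤⟨ total-mono lower ⟩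
      total (λ M → ∑ (λ x → ∑ (λ y → ⟦ does (P? M) ∧ down M x y ⟧))) ≡⟨ exchange (λ M x y → ⟦ does (P? M) ∧ down M x y ⟧) ⟩
      ∑ (λ x → ∑ (λ y → total (λ M → ⟦ does (P? M) ∧ down M x y ⟧))) ≤⟨ sum-mono (λ x → sum-mono (λ y → move x y)) ⟩
      ∑ (λ x → ∑ (λ y → total (λ M → ⟦ does (R? M) ∧ up M x y ⟧))) ≡⟨ sym (exchange (λ M x y → ⟦ does (R? M) ∧ up M x y ⟧)) ⟩
      total (λ M → ∑ (λ x → ∑ (λ y → ⟦ does (R? M) ∧ up M x y ⟧))) ≤⟨ total-mono upper ⟩
      total (λ M → β * [ R? M ]) ≡⟨ total-* β _ ⟩
      β * total (λ M → [ R? M ]) ≡⟨ cong (β *_) (sym (#≡total R?)) ⟩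
      β * # R? ∎
      where
      open ≤-Reasoning
      exchange : ∀ (G : VG n → Fin n → Fin n → ℕ) →
                 total (λ M → ∑ (λ x → ∑ (λ y → G M x y))) ≡ ∑ (λ x → ∑ (λ y → total (λ M → G M x y)))
      exchange G = trans (total-sum (λ x M → ∑ (λ y → G M x y))) (sum-cong (λ x → total-sum (λ y M → G M x y)))
      lower : ∀ M → α * [ P? M ] ≤ ∑ (λ x → ∑ (λ y → ⟦ does (P? M) ∧ down M x y ⟧))
      lower M = ≤-trans (bound (P? M) (lo M)) (≤-reflexive (trans (cong (⟦ does (P? M) ⟧ *_) (down-sum M)) (distribute (does (P? M)) (down M))))
        where
        bound : ∀ {S : Set} (s : Dec S) → (S → α ≤ s₁ M * s₄ M) → α * [ s ] ≤ [ s ] * (s₁ M * s₄ M)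
        bound (yes p) f = ≤-trans (≤-reflexive (*-identityʳ α)) (≤-trans (f p) (≤-reflexive (sym (*-identityˡ _))))
        bound (no _) f = ≤-reflexive (*-zeroʳ α)
      upper : ∀ M → ∑ (λ x → ∑ (λ y → ⟦ does (R? M) ∧ up M x y ⟧)) ≤ β * [ R? M ]
      upper M = ≤-trans (≤-reflexive (sym (trans (cong (⟦ does (R? M) ⟧ *_) (up-sum M)) (distribute (does (R? M)) (up M))))) (bound (R? M) (hi M))
        where
        bound : ∀ {S : Set} (s : Dec S) → (S → s₂ M * s₃ M ≤ β) → [ s ] * (s₂ M * s₃ M) ≤ β * [ s ]
        bound (yes p) f = ≤-trans (≤-reflexive (*-identityˡ _)) (≤-trans (f p) (≤-reflexive (sym (*-identityʳ _))))
        bound (no _) f = z≤n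
      move : ∀ x y → total (λ M → ⟦ does (P? M) ∧ down M x y ⟧) ≤ total (λ M → ⟦ does (R? M) ∧ up M x y ⟧)
      -- Reindexing by the involution puts the matrix before the switch in place of `M`; a switch
      -- there is a reversed switch at `M`.
      move x y = ≤-trans (≤-reflexive (sym (total-involution (τ a b x y) (τ-involutive a b x y) (λ M → ⟦ does (P? M) ∧ down M x y ⟧))))
                         (total-mono (λ M → ⟦⟧-mono (arrow M)))
        where
        arrow : ∀ M → does (P? (τ a b x y M)) ∧ down (τ a b x y M) x y ≡ true → does (R? M) ∧ up M x y ≡ true
        arrow M h = ∧-intro (true-does (R? M) (subst R (τ-involutive a b x y M) (cl M′ x y Ex E′y sw (does-true (P? M′) (proj₁ (∧-true h))))))
                            (∧-intro (∧-intro Ex (∧-intro (proj₁ sw′) (not-false (proj₂ (proj₂ (proj₂ sw′))))))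
                                     (∧-intro E′y (∧-intro (proj₁ (proj₂ sw′)) (not-false (proj₁ (proj₂ (proj₂ sw′)))))))
          where
          M′ : VG n
          M′ = τ a b x y M
          d : down M′ x y ≡ true
          d = proj₂ (∧-true {does (P? M′)} h)
          dx : E x ∧ (M′ ! a ! x ∧ not (M′ ! b ! x)) ≡ true
          dx = proj₁ (∧-true d)
          dy : E′ y ∧ (M′ ! b ! y ∧ not (M′ ! a ! y)) ≡ true
          dy = proj₂ (∧-true {E x ∧ (M′ ! a ! x ∧ not (M′ ! b ! x))} d)
          Ex : E x ≡ true
          Ex = proj₁ (∧-true dx)
          E′y : E′ y ≡ true
          E′y = proj₁ (∧-true dy)
          x∈ : M′ ! a ! x ∧ not (M′ ! b ! x) ≡ true
          x∈ = proj₂ (∧-true {E x} dx)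
          y∈ : M′ ! b ! y ∧ not (M′ ! a ! y) ≡ true
          y∈ = proj₂ (∧-true {E′ y} dy)
          sw : Sw a b x y M′
          sw = proj₁ (∧-true x∈) , proj₁ (∧-true y∈) , not-true (proj₂ (∧-true {M′ ! b ! y} y∈)) , not-true (proj₂ (∧-true {M′ ! a ! x} x∈))
          sw′ : Sw b a x y M
          sw′ = subst (Sw b a x y) (τ-involutive a b x y M) (Sg.Sw-reverse x y Ex E′y M′ sw)

    module _ {Q : ℕ → VG n → Set} (Q? : ∀ i M → Dec (Q i M))
             (closed : ∀ i → Closed E E′ a b (Q i) (Q (suc i))) where

      private
        -- `t₁` to `t₄` are the counts at the start of a chain and `i` is the number of switches
        -- made. The decreasing counts `s₁` and `s₄` have `i` added to them, so that no truncated
        -- subtraction enters.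
        At : (t₁ t₂ t₃ t₄ i : ℕ) → VG n → Set
        At t₁ t₂ t₃ t₄ i M = Q i M × (s₁ M + i ≡ t₁ × s₂ M ≡ t₂ + i) × (s₃ M ≡ t₃ + i × s₄ M + i ≡ t₄)

        At? : ∀ t₁ t₂ t₃ t₄ i M → Dec (At t₁ t₂ t₃ t₄ i M)
        At? t₁ t₂ t₃ t₄ i M = Q? i M ×-dec ((s₁ M + i ≟ℕ t₁) ×-dec (s₂ M ≟ℕ t₂ + i)) ×-dec ((s₃ M ≟ℕ t₃ + i) ×-dec (s₄ M + i ≟ℕ t₄))

        At-closed : ∀ t₁ t₂ t₃ t₄ i → Closed E E′ a b (At t₁ t₂ t₃ t₄ i) (At t₁ t₂ t₃ t₄ (suc i))
        At-closed t₁ t₂ t₃ t₄ i M x y Ex E′y sw (q , (h₁ , h₂) , (h₃ , h₄)) =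
          closed i M x y Ex E′y sw q ,
          (trans (+-suc _ i) (trans (cong (_+ i) (sym (Ef.e₁ E Ex (E-at E′y)))) h₁) ,
           trans (Ef.e₂ E Ex (E-at E′y)) (trans (cong suc h₂) (sym (+-suc t₂ i)))) ,
          (trans (Ef.e₃ E′ (disj x Ex) E′y) (trans (cong suc h₃) (sym (+-suc t₃ i))) ,
           trans (+-suc _ i) (trans (cong (_+ i) (sym (Ef.e₄ E′ (disj x Ex) E′y))) h₄))
          where module Ef = Sg.Effect x y Ex E′y M sw

        at-step : ∀ p q t₁ t₂ t₃ t₄ i → p * (suc (t₂ + i) * suc (t₃ + i)) ≤ q * ((t₁ ∸ i) * (t₄ ∸ i)) →
                  p * # (At? t₁ t₂ t₃ t₄ i) ≤ q * # (At? t₁ t₂ t₃ t₄ (suc i))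
        at-step p q t₁ t₂ t₃ t₄ i ratio = *-cancelˡ-≤ (suc (t₂ + i) * suc (t₃ + i)) (begin
          β * (p * P) ≡⟨ trans (sym (*-assoc β p P)) (cong (_* P) (*-comm β p)) ⟩
          p * β * P ≤⟨ *-monoˡ-≤ P ratio ⟩
          q * α * P ≡⟨ *-assoc q α P ⟩
          q * (α * P) ≤⟨ *-monoʳ-≤ q (step (At? t₁ t₂ t₃ t₄ i) (At? t₁ t₂ t₃ t₄ (suc i)) (At-closed t₁ t₂ t₃ t₄ i) α β lo hi) ⟩
          q * (β * R) ≡⟨ trans (sym (*-assoc q β R)) (trans (cong (_* R) (*-comm q β)) (*-assoc β q R)) ⟩
          β * (q * R) ∎)
          where
          open ≤-Reasoning
          α β P R : ℕ
          α = (t₁ ∸ i) * (t₄ ∸ i)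
          β = suc (t₂ + i) * suc (t₃ + i)
          P = # (At? t₁ t₂ t₃ t₄ i)
          R = # (At? t₁ t₂ t₃ t₄ (suc i))
          lo : ∀ M → At t₁ t₂ t₃ t₄ i M → α ≤ s₁ M * s₄ M
          lo M (_ , (h₁ , _) , (_ , h₄)) = *-mono-≤ (≤-reflexive (trans (cong (_∸ i) (sym h₁)) (m+n∸n≡m _ i)))
                                                    (≤-reflexive (trans (cong (_∸ i) (sym h₄)) (m+n∸n≡m _ i)))
          hi : ∀ M → At t₁ t₂ t₃ t₄ (suc i) M → s₂ M * s₃ M ≤ β
          hi M (_ , (_ , h₂) , (h₃ , _)) = *-mono-≤ (≤-reflexive (trans h₂ (+-suc t₂ i))) (≤-reflexive (trans h₃ (+-suc t₃ i)))

      at-chain : ∀ p q t₁ t₂ t₃ t₄ m → (∀ i → i < m → p * (suc (t₂ + i) * suc (t₃ + i)) ≤ q * ((t₁ ∸ i) * (t₄ ∸ i))) →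
                 p ^ m * # (At? t₁ t₂ t₃ t₄ 0) ≤ q ^ m * # (At? t₁ t₂ t₃ t₄ m)
      at-chain p q t₁ t₂ t₃ t₄ zero ratio = ≤-refl
      at-chain p q t₁ t₂ t₃ t₄ (suc m) ratio = begin
        p * p ^ m * X ≡⟨ *-assoc p _ X ⟩
        p * (p ^ m * X) ≤⟨ *-monoʳ-≤ p (at-chain p q t₁ t₂ t₃ t₄ m (λ i i<m → ratio i (m<n⇒m<1+n i<m))) ⟩
        p * (q ^ m * Y) ≡⟨ trans (sym (*-assoc p (q ^ m) Y)) (trans (cong (_* Y) (*-comm p (q ^ m))) (*-assoc (q ^ m) p Y)) ⟩
        q ^ m * (p * Y) ≤⟨ *-monoʳ-≤ (q ^ m) (at-step p q t₁ t₂ t₃ t₄ m (ratio m ≤-refl)) ⟩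
        q ^ m * (q * Z) ≡⟨ trans (sym (*-assoc (q ^ m) q Z)) (cong (_* Z) (*-comm (q ^ m) q)) ⟩
        q * q ^ m * Z ∎
        where
        open ≤-Reasoning
        X Y Z : ℕ
        X = # (At? t₁ t₂ t₃ t₄ 0)
        Y = # (At? t₁ t₂ t₃ t₄ m)
        Z = # (At? t₁ t₂ t₃ t₄ (suc m))

      -- The ratios of the single steps depend on the starting counts, so the start is stratified by
      -- all four of them. The end is stratified by the counts shifted back, which recover the
      -- starting values: different strata end in disjoint events, and the bounds add up.
      chain : ∀ p q m {B : ℕ → ℕ → ℕ → ℕ → Set} (B? : ∀ t₁ t₂ t₃ t₄ → Dec (B t₁ t₂ t₃ t₄)) →
              (∀ t₁ t₂ t₃ t₄ → B t₁ t₂ t₃ t₄ → ∀ i → i < m → p * (suc (t₂ + i) * suc (t₃ + i)) ≤ q * ((t₁ ∸ i) * (t₄ ∸ i))) →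
              p ^ m * # (λ M → Q? 0 M ×-dec B? (s₁ M) (s₂ M) (s₃ M) (s₄ M)) ≤ q ^ m * # (Q? m)
      chain p q m {B} B? ratio =
        stratifyℕ P₀ R₀ (suc n) s₁ (λ M → s₁ M + m) (λ {M} → e≤n E (M ! a) (M ! b)) c c′ (λ t₁ →
        stratifyℕ (P₁ t₁) (R₁ t₁) (suc n) s₂ (λ M → s₂ M ∸ m) (λ {M} → e≤n E (M ! b) (M ! a)) c c′ (λ t₂ →
        stratifyℕ (P₂ t₁ t₂) (R₂ t₁ t₂) (suc n) s₃ (λ M → s₃ M ∸ m) (λ {M} → e≤n E′ (M ! a) (M ! b)) c c′ (λ t₃ →
        stratifyℕ (P₃ t₁ t₂ t₃) (R₃ t₁ t₂ t₃) (suc n) s₄ (λ M → s₄ M + m) (λ {M} → e≤n E′ (M ! b) (M ! a)) c c′ (λ t₄ → final t₁ t₂ t₃ t₄))))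
        where
        c c′ : ℕ
        c = p ^ m
        c′ = q ^ m
        e≤n : ∀ A (r s : Row n) → e A r s < suc n
        e≤n A r s = s≤s (≤-trans (sum-≥ (λ j → ⟦ A j ∧ (r ! j ∧ not (s ! j)) ⟧) _ 1 ≤-refl (λ j → ⟦⟧≤1 _)) (≤-reflexive (*-identityʳ n)))
        P₀ = λ M → Q? 0 M ×-dec B? (s₁ M) (s₂ M) (s₃ M) (s₄ M)
        P₁ = λ t₁ M → P₀ M ×-dec (t₁ ≟ℕ s₁ M)
        P₂ = λ t₁ t₂ M → P₁ t₁ M ×-dec (t₂ ≟ℕ s₂ M)
        P₃ = λ t₁ t₂ t₃ M → P₂ t₁ t₂ M ×-dec (t₃ ≟ℕ s₃ M)
        R₀ = λ M → Q? m M
        R₁ = λ t₁ M → R₀ M ×-dec (t₁ ≟ℕ s₁ M + m)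
        R₂ = λ t₁ t₂ M → R₁ t₁ M ×-dec (t₂ ≟ℕ s₂ M ∸ m)
        R₃ = λ t₁ t₂ t₃ M → R₂ t₁ t₂ M ×-dec (t₃ ≟ℕ s₃ M ∸ m)
        final : ∀ t₁ t₂ t₃ t₄ → c * # (λ M → P₃ t₁ t₂ t₃ M ×-dec (t₄ ≟ℕ s₄ M)) ≤ c′ * # (λ M → R₃ t₁ t₂ t₃ M ×-dec (t₄ ≟ℕ s₄ M + m))
        final t₁ t₂ t₃ t₄ with B? t₁ t₂ t₃ t₄
        ... | no ¬B = ≤-trans (≤-reflexive (trans (cong (c *_) (#-empty _ (λ { M (((((_ , b) , refl) , refl) , refl) , refl) → ¬B b }))) (*-zeroʳ c))) z≤n
        ... | yes b = begin
          c * # (λ M → P₃ t₁ t₂ t₃ M ×-dec (t₄ ≟ℕ s₄ M)) ≤⟨ *-monoʳ-≤ c (#-mono (λ M → P₃ t₁ t₂ t₃ M ×-dec (t₄ ≟ℕ s₄ M)) (At? t₁ t₂ t₃ t₄ 0)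
                                                                     (λ { M (((((q₀ , _) , refl) , refl) , refl) , refl) →
                                                                        q₀ , (+-identityʳ _ , sym (+-identityʳ _)) , (sym (+-identityʳ _) , +-identityʳ _) })) ⟩
          c * # (At? t₁ t₂ t₃ t₄ 0) ≤⟨ at-chain p q t₁ t₂ t₃ t₄ m (ratio t₁ t₂ t₃ t₄ b) ⟩
          c′ * # (At? t₁ t₂ t₃ t₄ m) ≤⟨ *-monoʳ-≤ c′ (#-mono (At? t₁ t₂ t₃ t₄ m) (λ M → R₃ t₁ t₂ t₃ M ×-dec (t₄ ≟ℕ s₄ M + m))
                                                                     (λ { M (qm , (h₁ , h₂) , (h₃ , h₄)) →
                                                                        (((qm , sym h₁) , sym (trans (cong (_∸ m) h₂) (m+n∸n≡m t₂ m))) ,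
                                                                          sym (trans (cong (_∸ m) h₃) (m+n∸n≡m t₃ m))) , sym h₄ })) ⟩
          c′ * # (λ M → R₃ t₁ t₂ t₃ M ×-dec (t₄ ≟ℕ s₄ M + m)) ∎
          where open ≤-Reasoning

-- Lists of disjoint pairs

Disjoint : ∀ {n} → Fin n × Fin n → Fin n × Fin n → Set
Disjoint (a , b) (a′ , b′) = (¬ a ≡ a′ × ¬ a ≡ b′) × (¬ b ≡ a′ × ¬ b ≡ b′)

module PairLists {n N : ℕ} (ω : Fin N → VG n) (once : ∀ M → ∑ (λ i → [ ω i ≟G M ]) ≡ 1)
                 (E E′ : Fin n → Bool) where

  open Switches ω once

  Frameᵖ : Fin n × Fin n → Set
  Frameᵖ (a , b) = Frame E E′ a b

  Invariant : (VG n → Set) → Fin n × Fin n → Set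
  Invariant Q (a , b) = Closed E E′ a b Q Q × Closed E E′ b a Q Q

  -- A switch of `a′`, `b′` touches four rows: its own pair, which is disjoint from `a`, `b`, and
  -- two rows in `E` or `E′`, where `a` and `b` do not lie.
  rows-invariant : (X : Row n → Row n → Set) → ∀ {a b a′ b′} → Frame E E′ a b → Frame E E′ a′ b′ → Disjoint (a , b) (a′ , b′) →
                   Invariant (λ M → X (M ! a) (M ! b)) (a′ , b′)
  rows-invariant X {a} {b} {a′} {b′} F F′ ((aa , ab) , (ba , bb)) = cl F′ aa ab ba bb , cl (Frame-sym F′) ab aa bb ba
    where
    open Frame F
    cl : ∀ {u v} → Frame E E′ u v → ¬ a ≡ u → ¬ a ≡ v → ¬ b ≡ u → ¬ b ≡ v →
         Closed E E′ u v (λ M → X (M ! a) (M ! b)) (λ M → X (M ! a) (M ! b))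
    cl {u} {v} G au av bu bv M x y Ex E′y sw = subst₂ X
      (sym (S.row-other M a au av (outside E Ea Ex) (outside E′ E′a E′y)))
      (sym (S.row-other M b bu bv (outside E Eb Ex) (outside E′ E′b E′y)))
      where module S = Pair.Sg E E′ u v G x y Ex E′y

  ∧-invariant : ∀ {P Q : VG n → Set} {ab} → Invariant P ab → Invariant Q ab → Invariant (λ M → P M × Q M) ab
  ∧-invariant (c₁ , c₂) (d₁ , d₂) =
    (λ { M x y Ex E′y sw (p , q) → c₁ M x y Ex E′y sw p , d₁ M x y Ex E′y sw q }) ,
    (λ { M x y Ex E′y sw (p , q) → c₂ M x y Ex E′y sw p , d₂ M x y Ex E′y sw q })

  module _ {C G : Row n → Row n → Set} (C? : ∀ r s → Dec (C r s)) (G? : ∀ r s → Dec (G r s)) where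

    goodCount : List (Fin n × Fin n) → VG n → ℕ
    goodCount [] M = 0
    goodCount ((a , b) ∷ L) M = [ G? (M ! a) (M ! b) ] + goodCount L M

    Cᵖ : VG n → Fin n × Fin n → Set
    Cᵖ M (a , b) = C (M ! a) (M ! b)

    Cᵖ? : ∀ M ab → Dec (Cᵖ M ab)
    Cᵖ? M (a , b) = C? (M ! a) (M ! b)

    -- Each pair whose rows are good costs a factor q / (p + q), whatever is required of the other pairs.
    pair-list : ∀ p q →
      (∀ {a b} → Frame E E′ a b → ∀ {Q : VG n → Set} (Q? : ∀ M → Dec (Q M)) → Invariant Q (a , b) →
         p * # (λ M → (Q? M ×-dec C? (M ! a) (M ! b)) ×-dec G? (M ! a) (M ! b)) ≤
         q * # (λ M → Q? M ×-dec ¬? (C? (M ! a) (M ! b)))) →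
      ∀ L → All Frameᵖ L → AllPairs Disjoint L → ∀ {Q : VG n → Set} (Q? : ∀ M → Dec (Q M)) → All (Invariant Q) L →
      ∀ s → (p + q) ^ s * # (λ M → Q? M ×-dec (All.all? (Cᵖ? M) L ×-dec (s ≤? goodCount L M))) ≤ q ^ s * # Q?
    pair-list p q local L frames disj Q? inv zero =
      *-monoʳ-≤ 1 (#-mono (λ M → Q? M ×-dec (All.all? (Cᵖ? M) L ×-dec (0 ≤? goodCount L M))) Q? (λ M → proj₁))
    pair-list p q local [] frames disj Q? inv (suc s) =
      ≤-trans (≤-reflexive (trans (cong ((p + q) ^ suc s *_) (#-empty _ (λ { M (_ , _ , ()) }))) (*-zeroʳ ((p + q) ^ suc s)))) z≤n
    pair-list p q local ((a , b) ∷ L) (F ∷ frames) (d ∷ disj) {Q} Q? (iv ∷ inv) (suc s) = begin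
      (p + q) * T * # Event ≡⟨ cong ((p + q) * T *_) (#-split Event Gd) ⟩
      (p + q) * T * (# EventG + # EventN) ≡⟨ lem₁ (p + q) T (# EventG) (# EventN) ⟩
      (p + q) * (T * # EventG) + (p + q) * T * # EventN ≤⟨ +-mono-≤ (*-monoʳ-≤ (p + q) first) second ⟩
      (p + q) * (U * # Q₁) + q * U * # Q₀ ≡⟨ lem₂ p q U (# Q₁) (# Q₀) ⟩
      -- The outcomes violating the constraint at the head pay for the good ones:
      -- `p * # Q₁ ≤ q * # QN`. With `q * # Q₁` added on both sides this gives the factor `p + q`.
      U * (p * # Q₁ + q * (# Q₁ + # Q₀)) ≤⟨ *-monoʳ-≤ U (+-monoˡ-≤ _ (local F Q? iv)) ⟩
      U * (q * # QN + q * (# Q₁ + # Q₀)) ≡⟨ lem₃ q U (# QN) (# Q₁ + # Q₀) ⟩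
      q * U * (# Q₁ + # Q₀ + # QN) ≡⟨ cong (λ z → q * U * (z + # QN)) (sym (#-split QC Gd)) ⟩
      q * U * (# QC + # QN) ≡⟨ cong (q * U *_) (sym (#-split Q? Constr)) ⟩
      q * U * # Q? ∎
      where
      open ≤-Reasoning
      T U : ℕ
      T = (p + q) ^ s
      U = q ^ s
      Constr : ∀ M → Dec (C (M ! a) (M ! b))
      Constr M = C? (M ! a) (M ! b)
      Gd : ∀ M → Dec (G (M ! a) (M ! b))
      Gd M = G? (M ! a) (M ! b)
      Event = λ M → Q? M ×-dec (All.all? (Cᵖ? M) ((a , b) ∷ L) ×-dec (suc s ≤? goodCount ((a , b) ∷ L) M))
      EventG = λ M → Event M ×-dec Gd M
      EventN = λ M → Event M ×-dec ¬? (Gd M)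
      QC = λ M → Q? M ×-dec Constr M
      QN = λ M → Q? M ×-dec ¬? (Constr M)
      Q₁ = λ M → QC M ×-dec Gd M
      Q₀ = λ M → QC M ×-dec ¬? (Gd M)
      invariant : ∀ (X : Row n → Row n → Set) → All (Invariant (λ M → (Q M × C (M ! a) (M ! b)) × X (M ! a) (M ! b))) L
      invariant X = All.tabulate (λ m → ∧-invariant (∧-invariant (All.lookup inv m) (rows-invariant C F (All.lookup frames m) (All.lookup d m)))
                                                    (rows-invariant X F (All.lookup frames m) (All.lookup d m)))
      first : T * # EventG ≤ U * # Q₁
      first = ≤-trans (*-monoʳ-≤ T (#-mono EventG _ (λ { M ((q , (c ∷ cs) , h) , g) →
                        ((q , c) , g) , cs , s≤s⁻¹ (≤-trans h (≤-reflexive (cong (_+ goodCount L M) ([]-true (Gd M) g)))) })))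
                      (pair-list p q local L frames disj Q₁ (invariant G) s)
      second : (p + q) * T * # EventN ≤ q * U * # Q₀
      second = ≤-trans (*-monoʳ-≤ ((p + q) * T) (#-mono EventN _ (λ { M ((q , (c ∷ cs) , h) , g) →
                        ((q , c) , g) , cs , ≤-trans h (≤-reflexive (cong (_+ goodCount L M) ([]-false (Gd M) g))) })))
                      (pair-list p q local L frames disj Q₀ (invariant (λ r s → ¬ G r s)) (suc s))
      lem₁ : ∀ x T g h → x * T * (g + h) ≡ x * (T * g) + x * T * h
      lem₁ = solve-∀
      lem₂ : ∀ p q U x y → (p + q) * (U * x) + q * U * y ≡ U * (p * x + q * (x + y))
      lem₂ = solve-∀
      lem₃ : ∀ q U x y → U * (q * x + q * y) ≡ q * U * (y + x)
      lem₃ = solve-∀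

-- Anti-concentration of degrees

sum-≤[] : ∀ {n} {P : Fin n → Set} {R : Set} (P? : ∀ i → Dec (P i)) (R? : Dec R) →
          (∀ i j → P i → P j → i ≡ j) → (∀ i → P i → R) → ∑ (λ i → [ P? i ]) ≤ [ R? ]
sum-≤[] P? (yes _) uniq h = sum-≤1 P? uniq
sum-≤[] P? (no ¬r) uniq h = ≤-reflexive (sum-zero (λ i → []-false (P? i) (λ p → ¬r (h i p))))

-- Bernoulli: (1 + 1/h)ⁱ ≤ h/(h - i), and the right-hand side is at most 2 when i ≤ h/2.
bernoulli : ∀ h i → i ≤ h → suc h ^ i * (h ∸ i) ≤ h ^ suc i
bernoulli h zero _ = ≤-reflexive (*-comm 1 h)
bernoulli h (suc i) i<h with m≤n⇒∃[o]m+o≡n i<h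
... | o , refl = begin
  suc h * suc h ^ i * (h ∸ suc i) ≡⟨ cong (suc h * suc h ^ i *_) (m+n∸m≡n (suc i) o) ⟩
  suc h * suc h ^ i * o ≡⟨ lem₁ (suc h) (suc h ^ i) o ⟩
  suc h ^ i * (suc h * o) ≤⟨ *-monoʳ-≤ (suc h ^ i) lem₂ ⟩
  suc h ^ i * (h * suc o) ≡⟨ lem₃ (suc h ^ i) h (suc o) ⟩
  h * (suc h ^ i * suc o) ≡⟨ cong (λ z → h * (suc h ^ i * z)) (sym (trans (cong (_∸ i) (sym (+-suc i o))) (m+n∸m≡n i (suc o)))) ⟩
  h * (suc h ^ i * (h ∸ i)) ≤⟨ *-monoʳ-≤ h (bernoulli h i (<⇒≤ i<h)) ⟩
  h * h ^ suc i ∎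
  where
  open ≤-Reasoning
  lem₁ : ∀ x y z → x * y * z ≡ y * (x * z)
  lem₁ = solve-∀
  lem₃ : ∀ x y z → x * (y * z) ≡ y * (x * z)
  lem₃ = solve-∀
  lem₂ : suc h * o ≤ h * suc o
  lem₂ = ≤-trans (≤-reflexive (+-comm o (h * o))) (≤-trans (+-monoʳ-≤ (h * o) (m≤n+m o (suc i))) (≤-reflexive (trans (+-comm (h * o) h) (sym (*-suc h o)))))

bernoulli₂ : ∀ K i → 1 ≤ K → i ≤ K → suc (2 * K) ^ i ≤ 2 * (2 * K) ^ i
bernoulli₂ (suc K′) i _ i≤K = *-cancelʳ-≤ _ _ (suc K′) (begin
  suc h ^ i * K ≤⟨ *-monoʳ-≤ (suc h ^ i) K≤ ⟩
  suc h ^ i * (h ∸ i) ≤⟨ bernoulli h i (≤-trans i≤K (m≤m+n K _)) ⟩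
  h * h ^ i ≡⟨ lem K (h ^ i) ⟩
  2 * h ^ i * K ∎)
  where
  open ≤-Reasoning
  K h : ℕ
  K = suc K′
  h = 2 * K
  K≤ : K ≤ h ∸ i
  K≤ = ≤-trans (≤-reflexive (sym (trans (cong (λ z → K + z ∸ K) (+-identityʳ K)) (m+n∸n≡m K K)))) (∸-monoʳ-≤ h i≤K)
  lem : ∀ K x → 2 * K * x ≡ 2 * x * K
  lem = solve-∀

-- With all four parameters at least 8hK the product t₁t₄ absorbs the linear error terms.
drift-ratio : ∀ h K t₁ t₂ t₃ t₄ i → 1 ≤ h → i < K → 8 * h * K ≤ t₁ → 8 * h * K ≤ t₂ → 8 * h * K ≤ t₃ → 8 * h * K ≤ t₄ →
              t₂ * t₃ ≤ t₁ * t₄ → h * (suc (t₂ + i) * suc (t₃ + i)) ≤ suc h * ((t₁ ∸ i) * (t₄ ∸ i))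
drift-ratio h K t₁ t₂ t₃ t₄ i 1≤h i<K m₁ m₂ m₃ m₄ dom = +-cancelʳ-≤ (suc h * err) _ _ (begin
  h * (suc (t₂ + i) * suc (t₃ + i)) + suc h * err ≤⟨ +-monoʳ-≤ (h * (suc (t₂ + i) * suc (t₃ + i))) (*-monoʳ-≤ (suc h) err≤) ⟩
  h * (suc (t₂ + i) * suc (t₃ + i)) + suc h * (i * (t₁ + t₄)) ≡⟨ expand h t₂ t₃ i t₁ t₄ ⟩
  h * (t₂ * t₃) + (h * (suc i * (t₂ + t₃)) + h * (suc i * suc i) + suc h * (i * (t₁ + t₄))) ≤⟨ +-mono-≤ (*-monoʳ-≤ h dom) small ⟩
  h * (t₁ * t₄) + t₁ * t₄ ≡⟨ +-comm (h * (t₁ * t₄)) _ ⟩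
  suc h * (t₁ * t₄) ≡⟨ cong (suc h *_) split ⟩
  suc h * ((t₁ ∸ i) * (t₄ ∸ i) + err) ≡⟨ *-distribˡ-+ (suc h) ((t₁ ∸ i) * (t₄ ∸ i)) err ⟩
  suc h * ((t₁ ∸ i) * (t₄ ∸ i)) + suc h * err ∎)
  where
  open ≤-Reasoning
  M W u₁ u₄ err : ℕ
  M = 8 * h * K
  W = t₁ * t₄
  u₁ = t₁ ∸ i
  u₄ = t₄ ∸ i
  err = u₁ * i + i * u₄ + i * i
  1≤K : 1 ≤ K
  1≤K = ≤-trans (s≤s z≤n) i<K
  1≤8h : 1 ≤ 8 * h
  1≤8h = *-mono-≤ {1} {8} {1} {h} (s≤s z≤n) 1≤h
  K≤M : K ≤ M
  K≤M = ≤-trans (≤-reflexive (sym (*-identityˡ K))) (*-monoˡ-≤ K 1≤8h)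
  i≤ : ∀ {t} → M ≤ t → i ≤ t
  i≤ h = ≤-trans (<⇒≤ i<K) (≤-trans K≤M h)
  e₁ : t₁ ≡ u₁ + i
  e₁ = sym (m∸n+n≡m (i≤ m₁))
  e₄ : t₄ ≡ u₄ + i
  e₄ = sym (m∸n+n≡m (i≤ m₄))
  split : W ≡ u₁ * u₄ + err
  split = trans (cong₂ _*_ e₁ e₄) (lem u₁ u₄ i)
    where
    lem : ∀ x y i → (x + i) * (y + i) ≡ x * y + (x * i + i * y + i * i)
    lem = solve-∀
  err≤ : err ≤ i * (t₁ + t₄)
  err≤ = ≤-trans (m≤m+n err (i * i)) (≤-reflexive (sym (trans (cong₂ (λ x y → i * (x + y)) e₁ e₄) (lem u₁ u₄ i))))
    where
    lem : ∀ x y i → i * ((x + i) + (y + i)) ≡ (x * i + i * y + i * i) + i * i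
    lem = solve-∀
  expand : ∀ h t₂ t₃ i t₁ t₄ → h * (suc (t₂ + i) * suc (t₃ + i)) + suc h * (i * (t₁ + t₄)) ≡
           h * (t₂ * t₃) + (h * (suc i * (t₂ + t₃)) + h * (suc i * suc i) + suc h * (i * (t₁ + t₄)))
  expand = solve-∀
  1≤M : 1 ≤ M
  1≤M = ≤-trans 1≤K K≤M
  -- After multiplication by `M`, each of the `M * tᵢ` and `K * M` is at most `W`, for `t₂` and `t₃`
  -- by `dom`. Seven copies of `W` arise, and `M` has eight to offer.
  small : h * (suc i * (t₂ + t₃)) + h * (suc i * suc i) + suc h * (i * (t₁ + t₄)) ≤ W
  small = *-cancelˡ-≤ M {{>-nonZero 1≤M}} (begin
    M * (h * (suc i * (t₂ + t₃)) + h * (suc i * suc i) + suc h * (i * (t₁ + t₄)))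
      ≤⟨ *-monoʳ-≤ M (+-mono-≤ (+-mono-≤ (*-monoʳ-≤ h (*-monoˡ-≤ (t₂ + t₃) i<K)) (*-monoʳ-≤ h (*-mono-≤ i<K i<K)))
                               (*-mono-≤ (+-monoˡ-≤ h 1≤h) (*-monoˡ-≤ (t₁ + t₄) (<⇒≤ i<K)))) ⟩
    M * (h * (K * (t₂ + t₃)) + h * (K * K) + (h + h) * (K * (t₁ + t₄)))
      ≡⟨ regroup M h K t₁ t₂ t₃ t₄ ⟩
    h * K * (M * t₂ + M * t₃ + K * M + 2 * (M * t₁ + M * t₄))
      ≤⟨ *-monoʳ-≤ (h * K) (+-mono-≤ (+-mono-≤ (+-mono-≤ a₂ a₃) aK) (*-monoʳ-≤ 2 (+-mono-≤ a₁ a₄))) ⟩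
    h * K * (W + W + W + 2 * (W + W))
      ≤⟨ *-monoʳ-≤ (h * K) (≤-trans (m≤m+n _ W) (≤-reflexive (eight W))) ⟩
    h * K * (8 * W)
      ≡⟨ final h K W ⟩
    M * W ∎)
    where
    regroup : ∀ M h K t₁ t₂ t₃ t₄ → M * (h * (K * (t₂ + t₃)) + h * (K * K) + (h + h) * (K * (t₁ + t₄))) ≡
              h * K * (M * t₂ + M * t₃ + K * M + 2 * (M * t₁ + M * t₄))
    regroup = solve-∀
    eight : ∀ W → W + W + W + 2 * (W + W) + W ≡ 8 * W
    eight = solve-∀
    final : ∀ h K W → h * K * (8 * W) ≡ 8 * h * K * W
    final = solve-∀
    a₁ : M * t₁ ≤ W
    a₁ = ≤-trans (*-monoˡ-≤ t₁ m₄) (≤-reflexive (*-comm t₄ t₁))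
    a₄ : M * t₄ ≤ W
    a₄ = *-monoˡ-≤ t₄ m₁
    a₂ : M * t₂ ≤ W
    a₂ = ≤-trans (≤-trans (*-monoˡ-≤ t₂ m₃) (≤-reflexive (*-comm t₃ t₂))) dom
    a₃ : M * t₃ ≤ W
    a₃ = ≤-trans (*-monoˡ-≤ t₃ m₂) dom
    aK : K * M ≤ W
    aK = *-mono-≤ (≤-trans K≤M m₁) m₄

AllAbove : ℕ → ℕ → ℕ → ℕ → ℕ → Set
AllAbove m t₁ t₂ t₃ t₄ = (m ≤ t₁ × m ≤ t₂) × (m ≤ t₃ × m ≤ t₄)

AllAbove? : ∀ m t₁ t₂ t₃ t₄ → Dec (AllAbove m t₁ t₂ t₃ t₄)
AllAbove? m t₁ t₂ t₃ t₄ = ((m ≤? t₁) ×-dec (m ≤? t₂)) ×-dec ((m ≤? t₃) ×-dec (m ≤? t₄))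

Small : ℕ → ℕ → ℕ → ℕ → ℕ → Set
Small β t₁ t₂ t₃ t₄ = (t₂ ≤ β × t₃ ≤ β) × (1 ≤ t₁ × 1 ≤ t₄)

Small? : ∀ β t₁ t₂ t₃ t₄ → Dec (Small β t₁ t₂ t₃ t₄)
Small? β t₁ t₂ t₃ t₄ = ((t₂ ≤? β) ×-dec (t₃ ≤? β)) ×-dec ((1 ≤? t₁) ×-dec (1 ≤? t₄))

module LocalBounds {n N : ℕ} (ω : Fin N → VG n) (once : ∀ M → ∑ (λ i → [ ω i ≟G M ]) ≡ 1)
                   (E E′ D : Fin n → Bool) (E⊆D : ∀ j → E j ≡ true → D j ≡ true) (E′∩D : ∀ j → E′ j ≡ true → D j ≡ false) (c : ℕ) where

  open Switches ω once
  open PairLists ω once E E′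

  SameDeg : Row n → Row n → Set
  SameDeg r s = dg D r ≡ c × dg D s ≡ c

  SameDeg? : ∀ r s → Dec (SameDeg r s)
  SameDeg? r s = (dg D r ≟ℕ c) ×-dec (dg D s ≟ℕ c)

  On : (ℕ → ℕ → ℕ → ℕ → Set) → Row n → Row n → Set
  On B r s = B (e E r s) (e E s r) (e E′ r s) (e E′ s r)

  module _ {a b} (F : Frame E E′ a b) {Q : VG n → Set} (Q? : ∀ M → Dec (Q M)) (inv : Invariant Q (a , b)) where

    private
      QC? = λ M → Q? M ×-dec SameDeg? (M ! a) (M ! b)
      QN? = λ M → Q? M ×-dec ¬? (SameDeg? (M ! a) (M ! b))

    -- Because `E` lies in `D` and `E′` outside it, each switch raises the degree of `b` into `D` by
    -- exactly one, while `Q` persists by `inv`. So `m` switches lead from degree `c` to degree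
    -- `c + m`.
    shifted : ∀ p q m {B : ℕ → ℕ → ℕ → ℕ → Set} (B? : ∀ t₁ t₂ t₃ t₄ → Dec (B t₁ t₂ t₃ t₄)) →
              (∀ t₁ t₂ t₃ t₄ → B t₁ t₂ t₃ t₄ → ∀ i → i < m → p * (suc (t₂ + i) * suc (t₃ + i)) ≤ q * ((t₁ ∸ i) * (t₄ ∸ i))) →
              ∀ {X : VG n → Set} (X? : ∀ M → Dec (X M)) → (∀ M → X M → (Q M × SameDeg (M ! a) (M ! b)) × On B (M ! a) (M ! b)) →
              p ^ m * # X? ≤ q ^ m * # (λ M → Q? M ×-dec (dg D (M ! b) ≟ℕ c + m))
    shifted p q m {B} B? ratio X? sub = ≤-trans (*-monoʳ-≤ (p ^ m) (#-mono X? (λ M → Qᵢ? 0 M ×-dec B? (s₁ M) (s₂ M) (s₃ M) (s₄ M)) weaken))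
                                          (chain Qᵢ? closed p q m B? ratio)
      where
      open Pair E E′ a b F
      Qᵢ? = λ i M → Q? M ×-dec (dg D (M ! b) ≟ℕ c + i)
      weaken : ∀ M → _ → (Q M × dg D (M ! b) ≡ c + 0) × B (s₁ M) (s₂ M) (s₃ M) (s₄ M)
      weaken M x with sub M x
      ... | (q , (_ , h)) , b = (q , trans h (sym (+-identityʳ c))) , b
      closed : ∀ i → Closed E E′ a b (λ M → Q M × dg D (M ! b) ≡ c + i) (λ M → Q M × dg D (M ! b) ≡ c + suc i)
      closed i M x y Ex E′y sw (q , h) = proj₁ inv M x y Ex E′y sw q ,
        trans (Sg.Effect.dg-b x y Ex E′y M sw D (E⊆D x Ex) (E′∩D y E′y)) (trans (cong suc h) (sym (+-suc c i)))

    shifted-sum : ∀ K → ∑ {K} (λ j → # (λ M → Q? M ×-dec (dg D (M ! b) ≟ℕ c + suc (toℕ j)))) ≤ # QN?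
    shifted-sum K = begin
      ∑ {K} (λ j → # (λ M → Q? M ×-dec (dg D (M ! b) ≟ℕ c + suc (toℕ j)))) ≡⟨ sum-cong (λ j → #≡total (λ M → Q? M ×-dec (dg D (M ! b) ≟ℕ c + suc (toℕ j)))) ⟩
      ∑ {K} (λ j → total (λ M → [ Q? M ×-dec (dg D (M ! b) ≟ℕ c + suc (toℕ j)) ])) ≡⟨ sym (total-sum (λ j M → [ Q? M ×-dec (dg D (M ! b) ≟ℕ c + suc (toℕ j)) ])) ⟩
      total (λ M → ∑ {K} (λ j → [ Q? M ×-dec (dg D (M ! b) ≟ℕ c + suc (toℕ j)) ])) ≤⟨ total-mono (λ M → sum-≤[] (λ j → Q? M ×-dec (dg D (M ! b) ≟ℕ c + suc (toℕ j))) (QN? M)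
                                                                                            (λ i j p q → toℕ-injective (suc-injective (+-cancelˡ-≡ c _ _ (trans (sym (proj₂ p)) (proj₂ q)))))
                                                                                            (λ i p → proj₁ p , λ sd → m≢1+m+n c (trans (sym (proj₂ sd)) (trans (proj₂ p) (+-suc c (toℕ i)))))) ⟩
      total (λ M → [ QN? M ]) ≡⟨ sym (#≡total QN?) ⟩
      # QN? ∎
      where open ≤-Reasoning

    -- For every `i` from 1 to `K`, chains of `i` switches lead from `X` to an event of at least
    -- half its size in which `b` has degree `c + i`. These `K` events are disjoint and all avoid
    -- degree `c`.
    one-sided : ∀ K → 1 ≤ K → ∀ {X : VG n → Set} (X? : ∀ M → Dec (X M)) →
                (∀ M → X M → (Q M × SameDeg (M ! a) (M ! b)) ×
                   On (λ t₁ t₂ t₃ t₄ → AllAbove (16 * K * K) t₁ t₂ t₃ t₄ × t₂ * t₃ ≤ t₁ * t₄) (M ! a) (M ! b)) →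
                K * # X? ≤ 2 * # QN?
    one-sided K 1≤K X? sub = begin
      K * # X? ≡⟨ sym (sum-const K (# X?)) ⟩
      ∑ {K} (λ _ → # X?) ≤⟨ sum-mono each ⟩
      ∑ {K} (λ j → 2 * # (λ M → Q? M ×-dec (dg D (M ! b) ≟ℕ c + suc (toℕ j)))) ≡⟨ sum-*ˡ 2 _ ⟩
      2 * ∑ {K} (λ j → # (λ M → Q? M ×-dec (dg D (M ! b) ≟ℕ c + suc (toℕ j)))) ≤⟨ *-monoʳ-≤ 2 (shifted-sum K) ⟩
      2 * # QN? ∎
      where
      open ≤-Reasoning
      -- `h = 2 * K` keeps `(1 + 1/h)ⁱ ≤ 2` for all `i ≤ K`. The margin `8 * h * K` demanded by
      -- `drift-ratio` then becomes `16 * K * K`.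
      h : ℕ
      h = 2 * K
      1≤h : 1 ≤ h
      1≤h = ≤-trans 1≤K (m≤m+n K _)
      mk : 16 * K * K ≡ 8 * h * K
      mk = lem K
        where
        lem : ∀ K → 16 * K * K ≡ 8 * (2 * K) * K
        lem = solve-∀
      each : ∀ (j : Fin K) → # X? ≤ 2 * # (λ M → Q? M ×-dec (dg D (M ! b) ≟ℕ c + suc (toℕ j)))
      each j = *-cancelˡ-≤ (h ^ i) {{m^n≢0 h i {{>-nonZero 1≤h}}}} (begin
        h ^ i * # X? ≤⟨ shifted h (suc h) i (λ t₁ t₂ t₃ t₄ → AllAbove? (16 * K * K) t₁ t₂ t₃ t₄ ×-dec (t₂ * t₃ ≤? t₁ * t₄))
                                 (λ { t₁ t₂ t₃ t₄ (((m₁ , m₂) , (m₃ , m₄)) , dom) l l<i →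
                                    drift-ratio h K t₁ t₂ t₃ t₄ l 1≤h (<-≤-trans l<i i≤K) (conv m₁) (conv m₂) (conv m₃) (conv m₄) dom }) X? sub ⟩
        suc h ^ i * Y ≤⟨ *-monoˡ-≤ Y (bernoulli₂ K i 1≤K i≤K) ⟩
        2 * h ^ i * Y ≡⟨ lem (h ^ i) Y ⟩
        h ^ i * (2 * Y) ∎)
        where
        i Y : ℕ
        i = suc (toℕ j)
        Y = # (λ M → Q? M ×-dec (dg D (M ! b) ≟ℕ c + suc (toℕ j)))
        i≤K : i ≤ K
        i≤K = toℕ<n j
        conv : ∀ {t} → 16 * K * K ≤ t → 8 * h * K ≤ t
        conv {t} = subst (_≤ t) mk
        lem : ∀ x y → 2 * x * y ≡ x * (2 * y)
        lem = solve-∀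

    -- One switch is enough: at least one is available by `1 ≤ t₁` and `1 ≤ t₄`, and at most
    -- `(β + 1)²` lead back from its result, where `b` has degree `c + 1`.
    small-switch : ∀ β {X : VG n → Set} (X? : ∀ M → Dec (X M)) →
                   (∀ M → X M → (Q M × SameDeg (M ! a) (M ! b)) × On (Small β) (M ! a) (M ! b)) →
                   1 * # X? ≤ suc β * suc β * # QN?
    small-switch β X? sub = begin
      1 * # X? ≤⟨ shifted 1 (suc β * suc β) 1 (Small? β) ratio X? sub ⟩
      (suc β * suc β) * 1 * # (λ M → Q? M ×-dec (dg D (M ! b) ≟ℕ c + 1)) ≤⟨ *-mono-≤ (≤-reflexive (*-identityʳ (suc β * suc β))) (≤-trans (sum-elem {1} (λ j → # (λ M → Q? M ×-dec (dg D (M ! b) ≟ℕ c + suc (toℕ j)))) zero) (shifted-sum 1)) ⟩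
      suc β * suc β * # QN? ∎
      where
      open ≤-Reasoning
      ratio : ∀ t₁ t₂ t₃ t₄ → Small β t₁ t₂ t₃ t₄ → ∀ i → i < 1 →
              1 * (suc (t₂ + i) * suc (t₃ + i)) ≤ suc β * suc β * ((t₁ ∸ i) * (t₄ ∸ i))
      ratio t₁ t₂ t₃ t₄ ((h₂ , h₃) , (h₁ , h₄)) zero _ = begin
        1 * (suc (t₂ + 0) * suc (t₃ + 0)) ≡⟨ trans (*-identityˡ _) (cong₂ (λ x y → suc x * suc y) (+-identityʳ t₂) (+-identityʳ t₃)) ⟩
        suc t₂ * suc t₃ ≤⟨ *-mono-≤ (s≤s h₂) (s≤s h₃) ⟩
        suc β * suc β ≡⟨ sym (*-identityʳ _) ⟩
        suc β * suc β * (1 * 1) ≤⟨ *-monoʳ-≤ (suc β * suc β) (*-mono-≤ h₁ h₄) ⟩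
        suc β * suc β * (t₁ * t₄) ∎
      ratio t₁ t₂ t₃ t₄ _ (suc i) (s≤s ())

  -- `one-sided` needs at least as many switches forwards as backwards. Where this fails for
  -- `(a , b)` it holds for `(b , a)`, and the two cases together double the constant.
  large-pairs : ∀ K → 1 ≤ K → ∀ {a b} → Frame E E′ a b → ∀ {Q : VG n → Set} (Q? : ∀ M → Dec (Q M)) → Invariant Q (a , b) →
    K * # (λ M → (Q? M ×-dec SameDeg? (M ! a) (M ! b)) ×-dec
                 AllAbove? (16 * K * K) (e E (M ! a) (M ! b)) (e E (M ! b) (M ! a)) (e E′ (M ! a) (M ! b)) (e E′ (M ! b) (M ! a))) ≤
    4 * # (λ M → Q? M ×-dec ¬? (SameDeg? (M ! a) (M ! b)))
  large-pairs K 1≤K {a} {b} F {Q} Q? inv = begin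
    K * # X? ≡⟨ cong (K *_) (#-split X? Dom?) ⟩
    K * (# (λ M → X? M ×-dec Dom? M) + # (λ M → X? M ×-dec ¬? (Dom? M))) ≡⟨ *-distribˡ-+ K _ _ ⟩
    K * # (λ M → X? M ×-dec Dom? M) + K * # (λ M → X? M ×-dec ¬? (Dom? M))
      ≤⟨ +-mono-≤ (one-sided F Q? inv K 1≤K (λ M → X? M ×-dec Dom? M) (λ { M ((qc , m) , dom) → qc , (m , dom) }))
                  (≤-trans (one-sided (Frame-sym F) Q? (proj₂ inv , proj₁ inv) K 1≤K (λ M → X? M ×-dec ¬? (Dom? M))
                             (λ { M (((q , (u , v)) , ((m₁ , m₂) , (m₃ , m₄))) , nd) → (q , (v , u)) , (((m₂ , m₁) , (m₄ , m₃)) , <⇒≤ (≰⇒> nd)) }))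
                           (*-monoʳ-≤ 2 (#-mono (λ M → Q? M ×-dec ¬? (SameDeg? (M ! b) (M ! a))) N? (λ { M (q , ns) → q , λ { (u , v) → ns (v , u) } })))) ⟩
    2 * # N? + 2 * # N? ≡⟨ lem (# N?) ⟩
    4 * # N? ∎
    where
    open ≤-Reasoning
    X? = λ M → (Q? M ×-dec SameDeg? (M ! a) (M ! b)) ×-dec
               AllAbove? (16 * K * K) (e E (M ! a) (M ! b)) (e E (M ! b) (M ! a)) (e E′ (M ! a) (M ! b)) (e E′ (M ! b) (M ! a))
    Dom? = λ M → e E (M ! b) (M ! a) * e E′ (M ! a) (M ! b) ≤? e E (M ! a) (M ! b) * e E′ (M ! b) (M ! a)
    N? = λ M → Q? M ×-dec ¬? (SameDeg? (M ! a) (M ! b))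
    lem : ∀ x → 2 * x + 2 * x ≡ 4 * x
    lem = solve-∀

-- Codegrees

codeg : ∀ {n} → VG n → Fin n → Fin n → ℕ
codeg M x y = ∑ (λ w → ⟦ (M ! x ! w) ∧ (M ! y ! w) ⟧)

module Codegrees {n N : ℕ} (ω : Fin N → VG n) (once : ∀ M → ∑ (λ i → [ ω i ≟G M ]) ≡ 1)
                 {R : ℕ} (ρ : Fin R → Row n) (row-once : ∀ r → ∑ (λ i → [ ρ i ≟R r ]) ≡ 1) (d : ℕ) where

  open Switches ω once

  Unbalanced : (B Δ : ℕ) → Fin n → Fin n → Fin n → VG n → Set
  Unbalanced B Δ x y z M = Reg d M × (codeg M x z ≤ B × B + Δ ≤ codeg M x y)

  Unbalanced? : ∀ B Δ x y z M → Dec (Unbalanced B Δ x y z M)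
  Unbalanced? B Δ x y z M = Reg? d M ×-dec ((codeg M x z ≤? B) ×-dec (B + Δ ≤? codeg M x y))

  module _ (x y z : Fin n) (x≢y : ¬ x ≡ y) (x≢z : ¬ x ≡ z) (y≢z : ¬ y ≡ z) where

    private
      -- Switched columns must avoid `x`, `y` and `z`: this fixes the row of `x` and keeps the four
      -- vertices of a switch distinct.
      ex : Fin n → Bool
      ex w = eq w x ∨ (eq w y ∨ eq w z)

      ex-x : ex x ≡ true
      ex-x rewrite eq-refl x = refl

      ex-y : ex y ≡ true
      ex-y rewrite eq-≢ (x≢y ∘ sym) | eq-refl y = refl

      ex-z : ex z ≡ true
      ex-z rewrite eq-≢ (x≢z ∘ sym) | eq-≢ (y≢z ∘ sym) | eq-refl z = refl

      ex-sum : ∑ (λ w → ⟦ ex w ⟧) ≤ 3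
      ex-sum = begin
        ∑ (λ w → ⟦ ex w ⟧) ≤⟨ sum-mono (λ w → ∨-≤ (eq w x) (eq w y) (eq w z)) ⟩
        ∑ (λ w → [ w ≟F x ] * 1 + ([ w ≟F y ] * 1 + [ w ≟F z ] * 1)) ≡⟨ trans (sum-+ _ _) (cong (∑ (λ w → [ w ≟F x ] * 1) +_) (sum-+ _ _)) ⟩
        ∑ (λ w → [ w ≟F x ] * 1) + (∑ (λ w → [ w ≟F y ] * 1) + ∑ (λ w → [ w ≟F z ] * 1)) ≡⟨ cong₂ _+_ (sum-δ (λ _ → 1) x) (cong₂ _+_ (sum-δ (λ _ → 1) y) (sum-δ (λ _ → 1) z)) ⟩
        3 ∎
        where
        open ≤-Reasoning
        ∨-≤ : ∀ p q r → ⟦ p ∨ (q ∨ r) ⟧ ≤ ⟦ p ⟧ * 1 + (⟦ q ⟧ * 1 + ⟦ r ⟧ * 1)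
        ∨-≤ true q r = s≤s z≤n
        ∨-≤ false true r = s≤s z≤n
        ∨-≤ false false true = s≤s z≤n
        ∨-≤ false false false = z≤n

    module _ (r : Row n) where

      -- Once the row `r` of `x` is fixed, these are its neighbours and its non-neighbours. A switch
      -- between them takes a neighbour of `x` from `y` and gives it to `z`, which lowers the
      -- codegree of `x` and `y` by one.
      In Out : Fin n → Bool
      In w = (r ! w) ∧ not (ex w)
      Out w = not (r ! w) ∧ not (ex w)

      private
        excluded : ∀ p {t} → t ≡ true → p ∧ not t ≡ false
        excluded true refl = refl
        excluded false h = refl

        In-Out : ∀ w → In w ≡ true → Out w ≡ false
        In-Out w h = cong (λ p → not p ∧ not (ex w)) (proj₁ (∧-true h))

        frame : Frame In Out y z
        frame = record { a≢b = y≢z ; disj = In-Out ; Ea = excluded (r ! y) ex-y ; E′a = excluded (not (r ! y)) ex-y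
                       ; Eb = excluded (r ! z) ex-z ; E′b = excluded (not (r ! z)) ex-z }

        open Pair In Out y z frame

        Qᵣ? : ∀ M → Dec (Reg d M × r ≡ M ! x)
        Qᵣ? M = Reg? d M ×-dec (r ≟R (M ! x))

        closed : Closed In Out y z (λ M → Reg d M × r ≡ M ! x) (λ M → Reg d M × r ≡ M ! x)
        closed M u v Iu Ov sw (reg , row) = S.Reg-τ M sw reg , trans row (sym (S.row-other M x x≢y x≢z
          (outside In (excluded (r ! x) ex-x) Iu) (outside Out (excluded (not (r ! x)) ex-x) Ov)))
          where module S = Sg u v Iu Ov

        st₂ : ∀ M → r ≡ M ! x → s₂ M ≤ codeg M x z
        st₂ M refl = sum-mono (λ w → lem (r ! w) (ex w) (M ! z ! w) (M ! y ! w))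
          where
          lem : ∀ p t s q → ⟦ (p ∧ not t) ∧ (s ∧ not q) ⟧ ≤ ⟦ p ∧ s ⟧
          lem false t s q = z≤n
          lem true true s q = z≤n
          lem true false false q = z≤n
          lem true false true true = z≤n
          lem true false true false = s≤s z≤n

        st₁ : ∀ M → r ≡ M ! x → codeg M x y + s₂ M ≤ s₁ M + codeg M x z + 3
        st₁ M refl = begin
          codeg M x y + s₂ M ≡⟨ sym (sum-+ _ _) ⟩
          ∑ (λ w → ⟦ (r ! w) ∧ (M ! y ! w) ⟧ + ⟦ In w ∧ ((M ! z ! w) ∧ not (M ! y ! w)) ⟧) ≤⟨ sum-mono (λ w → lem (r ! w) (M ! y ! w) (M ! z ! w) (ex w)) ⟩
          ∑ (λ w → ⟦ In w ∧ ((M ! y ! w) ∧ not (M ! z ! w)) ⟧ + ⟦ (r ! w) ∧ (M ! z ! w) ⟧ + ⟦ ex w ⟧) ≡⟨ trans (sum-+ _ _) (cong (_+ ∑ (λ w → ⟦ ex w ⟧)) (sum-+ _ _)) ⟩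
          s₁ M + codeg M x z + ∑ (λ w → ⟦ ex w ⟧) ≤⟨ +-monoʳ-≤ (s₁ M + codeg M x z) ex-sum ⟩
          s₁ M + codeg M x z + 3 ∎
          where
          open ≤-Reasoning
          lem : ∀ p q s t → ⟦ p ∧ q ⟧ + ⟦ (p ∧ not t) ∧ (s ∧ not q) ⟧ ≤ ⟦ (p ∧ not t) ∧ (q ∧ not s) ⟧ + ⟦ p ∧ s ⟧ + ⟦ t ⟧
          lem false q s t = z≤n
          lem true true true true = s≤s z≤n
          lem true true true false = s≤s z≤n
          lem true true false true = s≤s z≤n
          lem true true false false = s≤s z≤n
          lem true false true true = z≤n
          lem true false true false = s≤s z≤n
          lem true false false true = z≤n
          lem true false false false = z≤n

        -- `y` and `z` have equal degree, so a surplus of `y` over `z` among the neighbours of `x`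
        -- reappears as a surplus of `z` over `y` among the non-neighbours, up to the three excluded
        -- vertices.
        st₄ : ∀ M → Reg d M → s₁ M + s₃ M ≤ s₂ M + s₄ M + 3
        st₄ M (_ , _ , deg) = +-cancelʳ-≤ d _ _ (begin
          s₁ M + s₃ M + d ≡⟨ cong (s₁ M + s₃ M +_) (sym (deg z)) ⟩
          s₁ M + s₃ M + dg (λ _ → true) (M ! z) ≡⟨ sym (trans (sum-+ _ _) (cong (_+ dg (λ _ → true) (M ! z)) (sum-+ _ _))) ⟩
          ∑ (λ w → ⟦ In w ∧ ((M ! y ! w) ∧ not (M ! z ! w)) ⟧ + ⟦ Out w ∧ ((M ! y ! w) ∧ not (M ! z ! w)) ⟧ + ⟦ M ! z ! w ⟧)
                                                                     ≤⟨ sum-mono (λ w → lem (r ! w) (M ! y ! w) (M ! z ! w) (ex w)) ⟩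
          ∑ (λ w → ⟦ In w ∧ ((M ! z ! w) ∧ not (M ! y ! w)) ⟧ + ⟦ Out w ∧ ((M ! z ! w) ∧ not (M ! y ! w)) ⟧ + ⟦ M ! y ! w ⟧ + ⟦ ex w ⟧)
                                                                     ≡⟨ trans (sum-+ _ _) (cong (_+ ∑ (λ w → ⟦ ex w ⟧)) (trans (sum-+ _ _) (cong (_+ dg (λ _ → true) (M ! y)) (sum-+ _ _)))) ⟩
          s₂ M + s₄ M + dg (λ _ → true) (M ! y) + ∑ (λ w → ⟦ ex w ⟧) ≤⟨ +-mono-≤ (≤-reflexive (cong (s₂ M + s₄ M +_) (deg y))) ex-sum ⟩
          s₂ M + s₄ M + d + 3 ≡⟨ comm (s₂ M + s₄ M) d 3 ⟩
          s₂ M + s₄ M + 3 + d ∎)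
          where
          open ≤-Reasoning
          comm : ∀ p q r → p + q + r ≡ p + r + q
          comm = solve-∀
          lem : ∀ p q s t → ⟦ (p ∧ not t) ∧ (q ∧ not s) ⟧ + ⟦ (not p ∧ not t) ∧ (q ∧ not s) ⟧ + ⟦ s ⟧ ≤
                            ⟦ (p ∧ not t) ∧ (s ∧ not q) ⟧ + ⟦ (not p ∧ not t) ∧ (s ∧ not q) ⟧ + ⟦ q ⟧ + ⟦ t ⟧
          lem true true true true = s≤s z≤n
          lem true true true false = s≤s z≤n
          lem true true false true = z≤n
          lem true true false false = s≤s z≤n
          lem true false true true = s≤s z≤n
          lem true false true false = s≤s z≤n
          lem true false false true = z≤n
          lem true false false false = z≤n
          lem false true true true = s≤s z≤n
          lem false true true false = s≤s z≤n
          lem false true false true = z≤n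
          lem false true false false = s≤s z≤n
          lem false false true true = s≤s z≤n
          lem false false true false = s≤s z≤n
          lem false false false true = z≤n
          lem false false false false = z≤n

      -- In the gap `3 * I + 6`, the 6 allows for the excluded vertices and `2 * I` for the drift of
      -- both counts during `I` switches. A surplus of at least `I + 3` of `s₁` over `s₂` remains,
      -- and `B + I ≤ h * (I + 2)` turns it into a factor `1 + 1/h`; the factor from `s₃` and `s₄`
      -- only has to be at least 1.
      row-bound : ∀ h I B → B + I ≤ h * (I + 2) →
                  suc h ^ I * # (λ M → Unbalanced? B (3 * I + 6) x y z M ×-dec (r ≟R (M ! x))) ≤
                  h ^ I * # (λ M → Reg? d M ×-dec (r ≟R (M ! x)))
      row-bound h I B small = ≤-trans
        (*-monoʳ-≤ (suc h ^ I) (#-mono (λ M → Unbalanced? B Δ x y z M ×-dec (r ≟R (M ! x)))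
                                       (λ M → Qᵣ? M ×-dec Start? (s₁ M) (s₂ M) (s₃ M) (s₄ M)) start))
        (chain (λ _ → Qᵣ?) (λ _ → closed) (suc h) h I Start? ratio)
        where
        Δ : ℕ
        Δ = 3 * I + 6
        Start : ℕ → ℕ → ℕ → ℕ → Set
        Start t₁ t₂ t₃ t₄ = t₂ ≤ B × (t₂ + Δ ≤ t₁ + 3 × t₃ + Δ ≤ t₄ + 6)
        Start? : ∀ t₁ t₂ t₃ t₄ → Dec (Start t₁ t₂ t₃ t₄)
        Start? t₁ t₂ t₃ t₄ = (t₂ ≤? B) ×-dec ((t₂ + Δ ≤? t₁ + 3) ×-dec (t₃ + Δ ≤? t₄ + 6))
        start : ∀ M → Unbalanced B Δ x y z M × r ≡ M ! x → (Reg d M × r ≡ M ! x) × Start (s₁ M) (s₂ M) (s₃ M) (s₄ M)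
        start M ((reg , (xz , xy)) , row) = (reg , row) , (≤-trans (st₂ M row) xz , (one , two))
          where
          open ≤-Reasoning
          one : s₂ M + Δ ≤ s₁ M + 3
          one = +-cancelʳ-≤ (codeg M x z) _ _ (begin
            s₂ M + Δ + codeg M x z ≤⟨ +-monoʳ-≤ (s₂ M + Δ) xz ⟩
            s₂ M + Δ + B ≡⟨ comm₁ (s₂ M) Δ B ⟩
            B + Δ + s₂ M ≤⟨ +-monoˡ-≤ (s₂ M) xy ⟩
            codeg M x y + s₂ M ≤⟨ st₁ M row ⟩
            s₁ M + codeg M x z + 3 ≡⟨ comm₂ (s₁ M) (codeg M x z) 3 ⟩
            s₁ M + 3 + codeg M x z ∎)
            where
            comm₁ : ∀ p q r → p + q + r ≡ r + q + p
            comm₁ = solve-∀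
            comm₂ : ∀ p q r → p + q + r ≡ p + r + q
            comm₂ = solve-∀
          two : s₃ M + Δ ≤ s₄ M + 6
          two = +-cancelʳ-≤ (s₂ M) _ _ (begin
            s₃ M + Δ + s₂ M ≡⟨ comm₁ (s₃ M) Δ (s₂ M) ⟩
            s₃ M + (s₂ M + Δ) ≤⟨ +-monoʳ-≤ (s₃ M) one ⟩
            s₃ M + (s₁ M + 3) ≡⟨ comm₂ (s₃ M) (s₁ M) ⟩
            s₁ M + s₃ M + 3 ≤⟨ +-monoˡ-≤ 3 (st₄ M reg) ⟩
            s₂ M + s₄ M + 3 + 3 ≡⟨ comm₃ (s₂ M) (s₄ M) ⟩
            s₄ M + 6 + s₂ M ∎)
            where
            comm₁ : ∀ p q r → p + q + r ≡ p + (r + q)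
            comm₁ = solve-∀
            comm₂ : ∀ p q → p + (q + 3) ≡ q + p + 3
            comm₂ = solve-∀
            comm₃ : ∀ p q → p + q + 3 + 3 ≡ q + 6 + p
            comm₃ = solve-∀
        ratio : ∀ t₁ t₂ t₃ t₄ → Start t₁ t₂ t₃ t₄ → ∀ i → i < I →
                suc h * (suc (t₂ + i) * suc (t₃ + i)) ≤ h * ((t₁ ∸ i) * (t₄ ∸ i))
        ratio t₁ t₂ t₃ t₄ (t₂≤B , (lo₁ , lo₄)) i i<I = begin
          suc h * (suc (t₂ + i) * suc (t₃ + i)) ≡⟨ sym (*-assoc (suc h) (suc (t₂ + i)) (suc (t₃ + i))) ⟩
          suc h * suc (t₂ + i) * suc (t₃ + i) ≤⟨ *-mono-≤ first second ⟩
          h * (t₁ ∸ i) * (t₄ ∸ i) ≡⟨ *-assoc h (t₁ ∸ i) (t₄ ∸ i) ⟩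
          h * ((t₁ ∸ i) * (t₄ ∸ i)) ∎
          where
          open ≤-Reasoning
          second : suc (t₃ + i) ≤ t₄ ∸ i
          second = m+n≤o⇒m≤o∸n (suc (t₃ + i)) (+-cancelʳ-≤ 6 _ _ (begin
            suc (t₃ + i) + i + 6 ≡⟨ lem₁ t₃ i ⟩
            t₃ + (suc i + i + 6) ≤⟨ +-monoʳ-≤ t₃ (+-monoˡ-≤ 6 (+-mono-≤ i<I (<⇒≤ i<I))) ⟩
            t₃ + (I + I + 6) ≤⟨ +-monoʳ-≤ t₃ (+-monoˡ-≤ 6 (m≤m+n (I + I) I)) ⟩
            t₃ + (I + I + I + 6) ≡⟨ lem₂ t₃ I ⟩
            t₃ + Δ ≤⟨ lo₄ ⟩
            t₄ + 6 ∎))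
            where
            lem₁ : ∀ t i → suc (t + i) + i + 6 ≡ t + (suc i + i + 6)
            lem₁ = solve-∀
            lem₂ : ∀ t I → t + (I + I + I + 6) ≡ t + (3 * I + 6)
            lem₂ = solve-∀
          gap : t₂ + i + (I + 3) ≤ t₁ ∸ i
          gap = m+n≤o⇒m≤o∸n (t₂ + i + (I + 3)) (+-cancelʳ-≤ 3 _ _ (begin
            t₂ + i + (I + 3) + i + 3 ≡⟨ lem₁ t₂ i I ⟩
            t₂ + (i + i) + (I + 6) ≤⟨ +-monoˡ-≤ (I + 6) (+-monoʳ-≤ t₂ (+-mono-≤ (<⇒≤ i<I) (<⇒≤ i<I))) ⟩
            t₂ + (I + I) + (I + 6) ≡⟨ lem₂ t₂ I ⟩
            t₂ + Δ ≤⟨ lo₁ ⟩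
            t₁ + 3 ∎))
            where
            lem₁ : ∀ t i I → t + i + (I + 3) + i + 3 ≡ t + (i + i) + (I + 6)
            lem₁ = solve-∀
            lem₂ : ∀ t I → t + (I + I) + (I + 6) ≡ t + (3 * I + 6)
            lem₂ = solve-∀
          first : suc h * suc (t₂ + i) ≤ h * (t₁ ∸ i)
          first = begin
            suc h * suc (t₂ + i) ≡⟨ lem₁ h t₂ i ⟩
            h * suc (t₂ + i) + (t₂ + suc i) ≤⟨ +-monoʳ-≤ (h * suc (t₂ + i)) (≤-trans (+-mono-≤ t₂≤B i<I) small) ⟩
            h * suc (t₂ + i) + h * (I + 2) ≡⟨ lem₂ h t₂ i I ⟩
            h * (t₂ + i + (I + 3)) ≤⟨ *-monoʳ-≤ h gap ⟩
            h * (t₁ ∸ i) ∎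
            where
            lem₁ : ∀ h t i → suc h * suc (t + i) ≡ h * suc (t + i) + (t + suc i)
            lem₁ = solve-∀
            lem₂ : ∀ h t i I → h * suc (t + i) + h * (I + 2) ≡ h * (t + i + (I + 3))
            lem₂ = solve-∀

    -- No switch used here touches the row of `x`, so one may condition on it; `ρ` lists its
    -- possible values.
    unbalanced-rare : ∀ h I B → B + I ≤ h * (I + 2) →
                      suc h ^ I * # (Unbalanced? B (3 * I + 6) x y z) ≤ h ^ I * # (Reg? d)
    unbalanced-rare h I B small = stratify (Unbalanced? B (3 * I + 6) x y z) (Reg? d) _≟R_ ρ (_! x) (_! x)
      (λ M _ → ≤-reflexive (sym (row-once (M ! x)))) (λ M → ≤-reflexive (row-once (M ! x))) (suc h ^ I) (h ^ I)
      (λ r → row-bound r h I B small)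

-- Second moments

∑₂ : ∀ {n} → (Fin n → Fin n → ℕ) → ℕ
∑₂ f = ∑ (λ a → ∑ (λ b → f a b))

module _ {n : ℕ} where

  ∑₂-mono : ∀ {f g : Fin n → Fin n → ℕ} → (∀ a b → f a b ≤ g a b) → ∑₂ f ≤ ∑₂ g
  ∑₂-mono h = sum-mono (λ a → sum-mono (λ b → h a b))

  ∑₂-+ : ∀ (f g : Fin n → Fin n → ℕ) → ∑₂ (λ a b → f a b + g a b) ≡ ∑₂ f + ∑₂ g
  ∑₂-+ f g = trans (sum-cong (λ a → sum-+ (f a) (g a))) (sum-+ _ _)

  ∑₂-*ˡ : ∀ c (f : Fin n → Fin n → ℕ) → ∑₂ (λ a b → c * f a b) ≡ c * ∑₂ f
  ∑₂-*ˡ c f = trans (sum-cong (λ a → sum-*ˡ c (f a))) (sum-*ˡ c _)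

  ∑₂-const : ∀ c → ∑₂ {n} (λ _ _ → c) ≡ n * n * c
  ∑₂-const c = trans (sum-cong (λ a → sum-const n c)) (trans (sum-const n (n * c)) (sym (*-assoc n n c)))

  ∑₂-sum : ∀ {m} (f : Fin m → Fin n → Fin n → ℕ) → ∑₂ (λ a b → ∑ (λ j → f j a b)) ≡ ∑ (λ j → ∑₂ (f j))
  ∑₂-sum f = trans (sum-cong (λ a → sum-comm (λ b j → f j a b))) (sum-comm (λ a j → ∑ (λ b → f j a b)))

  ∑₂-swap : ∀ (f : Fin n → Fin n → ℕ) → ∑₂ f ≡ ∑₂ (λ a b → f b a)
  ∑₂-swap f = sum-comm f

  -- `A` stands for the sum over all `n²` pairs, so deviating means being below half or above twice
  -- the mean.
  Deviates : ℕ → ℕ → Set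
  Deviates A x = (2 * (n * n * x) < A) ⊎ (2 * A < n * n * x)

  Deviates? : ∀ A x → Dec (Deviates A x)
  Deviates? A x with 2 * (n * n * x) <? A | 2 * A <? n * n * x
  ... | yes p | _ = yes (inj₁ p)
  ... | no _ | yes q = yes (inj₂ q)
  ... | no ¬p | no ¬q = no λ { (inj₁ p) → ¬p p ; (inj₂ q) → ¬q q }

  -- (2u - A)(2u - 3A) ≥ 0 unless u lies between A/2 and 2A.
  deviation-square : ∀ A u → (2 * u < A) ⊎ (2 * A < u) → 8 * (u * A) + A * A ≤ 4 * (u * u) + 4 * (A * A)
  deviation-square A u (inj₁ 2u<A) with m≤n⇒∃[o]m+o≡n (<⇒≤ 2u<A)
  ... | o , refl = ≤-trans (m≤m+n _ (o * (4 * u + 3 * o))) (≤-reflexive (lem u o))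
    where
    lem : ∀ u o → 8 * (u * (2 * u + o)) + (2 * u + o) * (2 * u + o) + o * (4 * u + 3 * o) ≡ 4 * (u * u) + 4 * ((2 * u + o) * (2 * u + o))
    lem = solve-∀
  deviation-square A u (inj₂ 2A<u) with m≤n⇒∃[o]m+o≡n (<⇒≤ 2A<u)
  ... | o , refl = ≤-trans (m≤m+n _ (3 * (A * A) + 8 * (A * o) + 4 * (o * o))) (≤-reflexive (lem A o))
    where
    lem : ∀ A o → 8 * ((2 * A + o) * A) + A * A + (3 * (A * A) + 8 * (A * o) + 4 * (o * o)) ≡ 4 * ((2 * A + o) * (2 * A + o)) + 4 * (A * A)
    lem = solve-∀

  -- The last hypothesis bounds the variance by the squared mean over `G`. Pointwise,
  -- `4 (n² x - A)²` is at least `A²` where `x` deviates and at least 0 elsewhere; this is used in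
  -- expanded form, without subtraction.
  chebyshev : ∀ (X : Fin n → Fin n → ℕ) A G → ∑₂ X ≡ A → 1 ≤ A →
              G * (n * n * ∑₂ (λ a b → X a b * X a b)) ≤ suc G * (A * A) →
              G * ∑₂ (λ a b → [ Deviates? A (X a b) ]) ≤ 4 * (n * n)
  chebyshev X A G ΣX 1≤A second = *-cancelʳ-≤ _ _ (A * A) {{>-nonZero (*-mono-≤ 1≤A 1≤A)}} (+-cancelˡ-≤ (4 * G * (V * (A * A))) _ _ (begin
    4 * G * (V * (A * A)) + G * Z * (A * A) ≡⟨ lem₁ G V A Z ⟩
    G * (4 * V * (A * A) + A * A * Z) ≤⟨ *-monoʳ-≤ G (+-cancelˡ-≤ (4 * (V * (A * A))) _ _ summed) ⟩
    G * (4 * (V * V * S)) ≡⟨ lem₂ G V S ⟩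
    4 * V * (G * (V * S)) ≤⟨ *-monoʳ-≤ (4 * V) second ⟩
    4 * V * (suc G * (A * A)) ≡⟨ lem₃ G V A ⟩
    4 * G * (V * (A * A)) + 4 * V * (A * A) ∎))
    where
    open ≤-Reasoning
    V S Z : ℕ
    V = n * n
    S = ∑₂ (λ a b → X a b * X a b)
    Z = ∑₂ (λ a b → [ Deviates? A (X a b) ])
    lem₁ : ∀ G V A Z → 4 * G * (V * (A * A)) + G * Z * (A * A) ≡ G * (4 * V * (A * A) + A * A * Z)
    lem₁ = solve-∀
    lem₂ : ∀ G V S → G * (4 * (V * V * S)) ≡ 4 * V * (G * (V * S))
    lem₂ = solve-∀
    lem₃ : ∀ G V A → 4 * V * (suc G * (A * A)) ≡ 4 * G * (V * (A * A)) + 4 * V * (A * A)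
    lem₃ = solve-∀
    pointwise : ∀ x → 8 * (V * A) * x + A * A * [ Deviates? A x ] ≤ 4 * (V * V) * (x * x) + 4 * (A * A)
    pointwise x with Deviates? A x
    ... | yes dev = ≤-trans (≤-reflexive (lem₄ V A x)) (≤-trans (deviation-square A (V * x) dev) (≤-reflexive (lem₅ V A x)))
      where
      lem₄ : ∀ V A x → 8 * (V * A) * x + A * A * 1 ≡ 8 * (V * x * A) + A * A
      lem₄ = solve-∀
      lem₅ : ∀ V A x → 4 * (V * x * (V * x)) + 4 * (A * A) ≡ 4 * (V * V) * (x * x) + 4 * (A * A)
      lem₅ = solve-∀
    ... | no _ = ≤-trans (≤-reflexive (lem₄ V A x)) (≤-trans (square (V * x) A) (≤-reflexive (lem₅ V A x)))
      where
      lem₄ : ∀ V A x → 8 * (V * A) * x + A * A * 0 ≡ 8 * (V * x * A)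
      lem₄ = solve-∀
      lem₅ : ∀ V A x → 4 * (V * x * (V * x)) + 4 * (A * A) ≡ 4 * (V * V) * (x * x) + 4 * (A * A)
      lem₅ = solve-∀
      square : ∀ u v → 8 * (u * v) ≤ 4 * (u * u) + 4 * (v * v)
      square u v with ≤-total u v
      ... | inj₁ u≤v with m≤n⇒∃[o]m+o≡n u≤v
      ... | o , refl = ≤-trans (m≤m+n _ (4 * (o * o))) (≤-reflexive (lem u o))
        where
        lem : ∀ u o → 8 * (u * (u + o)) + 4 * (o * o) ≡ 4 * (u * u) + 4 * ((u + o) * (u + o))
        lem = solve-∀
      square u v | inj₂ v≤u with m≤n⇒∃[o]m+o≡n v≤u
      ... | o , refl = ≤-trans (m≤m+n _ (4 * (o * o))) (≤-reflexive (lem v o))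
        where
        lem : ∀ v o → 8 * ((v + o) * v) + 4 * (o * o) ≡ 4 * ((v + o) * (v + o)) + 4 * (v * v)
        lem = solve-∀
    summed : 4 * (V * (A * A)) + (4 * V * (A * A) + A * A * Z) ≤ 4 * (V * (A * A)) + 4 * (V * V * S)
    summed = begin
      4 * (V * (A * A)) + (4 * V * (A * A) + A * A * Z) ≡⟨ lem₆ V A Z ⟩
      8 * (V * A) * A + A * A * Z ≡⟨ cong (λ z → 8 * (V * A) * z + A * A * Z) (sym ΣX) ⟩
      8 * (V * A) * ∑₂ X + A * A * Z ≡⟨ cong₂ _+_ (sym (∑₂-*ˡ (8 * (V * A)) X)) (sym (∑₂-*ˡ (A * A) _)) ⟩
      ∑₂ (λ a b → 8 * (V * A) * X a b) + ∑₂ (λ a b → A * A * [ Deviates? A (X a b) ]) ≡⟨ sym (∑₂-+ _ _) ⟩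
      ∑₂ (λ a b → 8 * (V * A) * X a b + A * A * [ Deviates? A (X a b) ]) ≤⟨ ∑₂-mono (λ a b → pointwise (X a b)) ⟩
      ∑₂ (λ a b → 4 * (V * V) * (X a b * X a b) + 4 * (A * A)) ≡⟨ ∑₂-+ _ _ ⟩
      ∑₂ (λ a b → 4 * (V * V) * (X a b * X a b)) + ∑₂ {n} (λ a b → 4 * (A * A)) ≡⟨ cong₂ _+_ (∑₂-*ˡ (4 * (V * V)) _) (∑₂-const (4 * (A * A))) ⟩
      4 * (V * V) * S + V * (4 * (A * A)) ≡⟨ lem₇ V A S ⟩
      4 * (V * (A * A)) + 4 * (V * V * S) ∎
      where
      lem₆ : ∀ V A Z → 4 * (V * (A * A)) + (4 * V * (A * A) + A * A * Z) ≡ 8 * (V * A) * A + A * A * Z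
      lem₆ = solve-∀
      lem₇ : ∀ V A S → 4 * (V * V) * S + V * (4 * (A * A)) ≡ 4 * (V * (A * A)) + 4 * (V * V * S)
      lem₇ = solve-∀

  module Regular (d m : ℕ) (d+m≡n : d + m ≡ n) (M : VG n) (reg : Reg d M) where

    private
      symm : ∀ i j → M ! i ! j ≡ M ! j ! i
      symm = proj₁ reg
      deg : ∀ i → ∑ (λ j → ⟦ M ! i ! j ⟧) ≡ d
      deg = proj₂ (proj₂ reg)

    codeg-self : ∀ x → codeg M x x ≡ d
    codeg-self x = trans (sum-cong (λ w → cong ⟦_⟧ (idem (M ! x ! w)))) (deg x)
      where
      idem : ∀ p → p ∧ p ≡ p
      idem true = refl
      idem false = refl

    codeg-sum : ∀ x → ∑ (λ z → codeg M x z) ≡ d * d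
    codeg-sum x = begin
      ∑ (λ z → ∑ (λ w → ⟦ (M ! x ! w) ∧ (M ! z ! w) ⟧)) ≡⟨ sum-comm _ ⟩
      ∑ (λ w → ∑ (λ z → ⟦ (M ! x ! w) ∧ (M ! z ! w) ⟧)) ≡⟨ sum-cong (λ w → trans (sum-cong (λ z → trans (⟦⟧-∧ (M ! x ! w) (M ! z ! w)) (cong (λ b → ⟦ M ! x ! w ⟧ * ⟦ b ⟧) (symm z w)))) (sum-*ˡ ⟦ M ! x ! w ⟧ _)) ⟩
      ∑ (λ w → ⟦ M ! x ! w ⟧ * ∑ (λ z → ⟦ M ! w ! z ⟧)) ≡⟨ sum-cong (λ w → cong (⟦ M ! x ! w ⟧ *_) (deg w)) ⟩
      ∑ (λ w → ⟦ M ! x ! w ⟧ * d) ≡⟨ sum-*ʳ d _ ⟩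
      ∑ (λ w → ⟦ M ! x ! w ⟧) * d ≡⟨ cong (_* d) (deg x) ⟩
      d * d ∎
      where open ≡-Reasoning

    -- The codegrees with `x` add up to `d²`, so they cannot all exceed `B`; the extra `2 * suc B`
    -- pays for leaving out `x` and `y`.
    low-codegree : ∀ B x y → d * d + 2 * suc B < n * suc B → ∃[ z ] (¬ z ≡ x × ¬ z ≡ y × codeg M x z ≤ B)
    low-codegree B x y small with any? (λ z → ¬? (z ≟F x) ×-dec (¬? (z ≟F y) ×-dec (codeg M x z ≤? B)))
    ... | yes found = found
    ... | no ¬∃ = ⊥-elim (<⇒≱ small (begin
      n * suc B ≡⟨ sym (sum-const n (suc B)) ⟩
      ∑ {n} (λ z → suc B) ≤⟨ sum-mono each ⟩
      ∑ (λ z → codeg M x z + ([ z ≟F x ] * suc B + [ z ≟F y ] * suc B)) ≡⟨ trans (sum-+ _ _) (cong₂ _+_ (codeg-sum x) (trans (sum-+ _ _) (cong₂ _+_ (sum-δ (λ _ → suc B) x) (sum-δ (λ _ → suc B) y)))) ⟩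
      d * d + (suc B + suc B) ≡⟨ cong (λ z → d * d + (suc B + z)) (sym (+-identityʳ (suc B))) ⟩
      d * d + 2 * suc B ∎))
      where
      open ≤-Reasoning
      each : ∀ z → suc B ≤ codeg M x z + ([ z ≟F x ] * suc B + [ z ≟F y ] * suc B)
      each z = go (z ≟F x) (z ≟F y)
        where
        go : (p : Dec (z ≡ x)) (q : Dec (z ≡ y)) → suc B ≤ codeg M x z + ([ p ] * suc B + [ q ] * suc B)
        go (yes _) q = ≤-trans (≤-reflexive (sym (*-identityˡ (suc B)))) (≤-trans (m≤m+n _ _) (m≤n+m _ (codeg M x z)))
        go (no _) (yes _) = ≤-trans (≤-reflexive (sym (*-identityˡ (suc B)))) (m≤n+m _ (codeg M x z))
        go (no p) (no q) with codeg M x z ≤? B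
        ... | yes le = ⊥-elim (¬∃ (z , p , q , le))
        ... | no nle = ≤-trans (≰⇒> nle) (m≤m+n _ _)

    nondeg : ∀ x → ∑ (λ b → ⟦ not (M ! x ! b) ⟧) ≡ m
    nondeg x = +-cancelˡ-≡ d _ _ (begin
      d + ∑ (λ b → ⟦ not (M ! x ! b) ⟧) ≡⟨ cong (_+ ∑ (λ b → ⟦ not (M ! x ! b) ⟧)) (sym (deg x)) ⟩
      ∑ (λ b → ⟦ M ! x ! b ⟧) + ∑ (λ b → ⟦ not (M ! x ! b) ⟧) ≡⟨ sym (sum-+ _ _) ⟩
      ∑ (λ b → ⟦ M ! x ! b ⟧ + ⟦ not (M ! x ! b) ⟧) ≡⟨ sum-cong (λ b → lem (M ! x ! b)) ⟩
      ∑ {n} (λ b → 1) ≡⟨ trans (sum-const n 1) (*-identityʳ n) ⟩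
      n ≡⟨ sym d+m≡n ⟩
      d + m ∎)
      where
      open ≡-Reasoning
      lem : ∀ p → ⟦ p ⟧ + ⟦ not p ⟧ ≡ 1
      lem true = refl
      lem false = refl

    conon : Fin n → Fin n → ℕ
    conon x y = ∑ (λ b → ⟦ not (M ! x ! b) ⟧ * ⟦ not (M ! y ! b) ⟧)

    -- Inclusion and exclusion. With `m = d + k` it means that common non-neighbours exceed common
    -- neighbours by exactly `k`.
    conon-eq : ∀ x y → conon x y + d ≡ m + codeg M x y
    conon-eq x y = +-cancelʳ-≡ d _ _ (begin
      conon x y + d + d ≡⟨ cong₂ (λ u v → conon x y + u + v) (sym (deg x)) (sym (deg y)) ⟩
      conon x y + ∑ (λ b → ⟦ M ! x ! b ⟧) + ∑ (λ b → ⟦ M ! y ! b ⟧) ≡⟨ sym (trans (sum-+ _ _) (cong (_+ ∑ (λ b → ⟦ M ! y ! b ⟧)) (sum-+ _ _))) ⟩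
      ∑ (λ b → ⟦ not (M ! x ! b) ⟧ * ⟦ not (M ! y ! b) ⟧ + ⟦ M ! x ! b ⟧ + ⟦ M ! y ! b ⟧) ≡⟨ sum-cong (λ b → lem (M ! x ! b) (M ! y ! b)) ⟩
      ∑ (λ b → 1 + ⟦ (M ! x ! b) ∧ (M ! y ! b) ⟧) ≡⟨ sum-+ _ _ ⟩
      ∑ {n} (λ b → 1) + codeg M x y ≡⟨ cong (_+ codeg M x y) (trans (sum-const n 1) (trans (*-identityʳ n) (trans (sym d+m≡n) (+-comm d m)))) ⟩
      m + d + codeg M x y ≡⟨ comm m d (codeg M x y) ⟩
      m + codeg M x y + d ∎)
      where
      open ≡-Reasoning
      comm : ∀ p q r → p + q + r ≡ p + r + q
      comm = solve-∀
      lem : ∀ p q → ⟦ not p ⟧ * ⟦ not q ⟧ + ⟦ p ⟧ + ⟦ q ⟧ ≡ 1 + ⟦ p ∧ q ⟧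
      lem true true = refl
      lem true false = refl
      lem false true = refl
      lem false false = refl

    module _ (E : Fin n → Bool) where

      private
        L : ℕ
        L = ∑ (λ x → ⟦ E x ⟧)
        X : Fin n → Fin n → ℕ
        X a b = e E (M ! a) (M ! b)
        term : Fin n → Fin n → Fin n → ℕ
        term a b x = ⟦ E x ⟧ * (⟦ M ! x ! a ⟧ * ⟦ not (M ! x ! b) ⟧)
        X-term : ∀ a b → X a b ≡ ∑ (λ x → term a b x)
        X-term a b = sum-cong (λ x → trans (⟦⟧-∧ (E x) _) (cong (⟦ E x ⟧ *_)
          (trans (⟦⟧-∧ (M ! a ! x) _) (cong₂ (λ u v → ⟦ u ⟧ * ⟦ not v ⟧) (symm a x) (symm b x)))))

      -- Seen from `x` in `E`, the pairs with `a` adjacent and `b` not adjacent to `x` number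
      -- `d * m` in every regular graph.
      first-moment : ∑₂ X ≡ L * d * m
      first-moment = begin
        ∑₂ X ≡⟨ sum-cong (λ a → sum-cong (λ b → X-term a b)) ⟩
        ∑₂ (λ a b → ∑ (λ x → term a b x)) ≡⟨ ∑₂-sum (λ x a b → term a b x) ⟩
        ∑ (λ x → ∑₂ (λ a b → ⟦ E x ⟧ * (⟦ M ! x ! a ⟧ * ⟦ not (M ! x ! b) ⟧))) ≡⟨ sum-cong (λ x → trans (∑₂-*ˡ ⟦ E x ⟧ _) (cong (⟦ E x ⟧ *_)
                                                                               (trans (sum-product (λ a → ⟦ M ! x ! a ⟧) (λ b → ⟦ not (M ! x ! b) ⟧)) (cong₂ _*_ (deg x) (nondeg x))))) ⟩
        ∑ (λ x → ⟦ E x ⟧ * (d * m)) ≡⟨ sum-*ʳ (d * m) _ ⟩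
        L * (d * m) ≡⟨ sym (*-assoc L d m) ⟩
        L * d * m ∎
        where open ≡-Reasoning

      -- For fixed `x` and `y` the sum over `a` and `b` factors into common neighbours times common
      -- non-neighbours. Off the diagonal the codegree bound controls both; each diagonal term is
      -- `d * m`.
      second-moment : ∀ c k → d + k ≡ m → (∀ x y → ¬ x ≡ y → codeg M x y ≤ c) →
                      ∑₂ (λ a b → X a b * X a b) ≤ L * (d * m) + L * L * (c * (k + c))
      second-moment c k d+k≡m cod = begin
        ∑₂ (λ a b → X a b * X a b) ≡⟨ sum-cong (λ a → sum-cong (λ b → trans (cong₂ _*_ (X-term a b) (X-term a b)) (sym (sum-product (term a b) (term a b))))) ⟩
        ∑₂ (λ a b → ∑ (λ x → ∑ (λ y → term a b x * term a b y))) ≡⟨ trans (∑₂-sum (λ x a b → ∑ (λ y → term a b x * term a b y))) (sum-cong (λ x → ∑₂-sum (λ y a b → term a b x * term a b y))) ⟩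
        ∑ (λ x → ∑ (λ y → ∑₂ (λ a b → term a b x * term a b y))) ≡⟨ sum-cong (λ x → sum-cong (λ y → factor x y)) ⟩
        ∑ (λ x → ∑ (λ y → ⟦ E x ⟧ * ⟦ E y ⟧ * (codeg M x y * conon x y))) ≤⟨ sum-mono (λ x → sum-mono (λ y → *-monoʳ-≤ (⟦ E x ⟧ * ⟦ E y ⟧) (bound x y))) ⟩
        ∑ (λ x → ∑ (λ y → ⟦ E x ⟧ * ⟦ E y ⟧ * ([ y ≟F x ] * (d * m) + c * (k + c)))) ≤⟨ sum-mono (λ x → row x) ⟩
        ∑ (λ x → ⟦ E x ⟧ * (d * m + L * (c * (k + c)))) ≡⟨ sum-*ʳ _ _ ⟩
        L * (d * m + L * (c * (k + c))) ≡⟨ lem L (d * m) (c * (k + c)) ⟩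
        L * (d * m) + L * L * (c * (k + c)) ∎
        where
        open ≤-Reasoning
        lem : ∀ L u v → L * (u + L * v) ≡ L * u + L * L * v
        lem = solve-∀
        factor : ∀ x y → ∑₂ (λ a b → term a b x * term a b y) ≡ ⟦ E x ⟧ * ⟦ E y ⟧ * (codeg M x y * conon x y)
        factor x y = trans (sum-cong (λ a → sum-cong (λ b → regroup ⟦ E x ⟧ ⟦ M ! x ! a ⟧ ⟦ not (M ! x ! b) ⟧ ⟦ E y ⟧ ⟦ M ! y ! a ⟧ ⟦ not (M ! y ! b) ⟧)))
                    (trans (∑₂-*ˡ (⟦ E x ⟧ * ⟦ E y ⟧) _) (cong (⟦ E x ⟧ * ⟦ E y ⟧ *_)
                    (trans (sum-product (λ a → ⟦ M ! x ! a ⟧ * ⟦ M ! y ! a ⟧) (λ b → ⟦ not (M ! x ! b) ⟧ * ⟦ not (M ! y ! b) ⟧))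
                           (cong (_* conon x y) (sum-cong (λ a → sym (⟦⟧-∧ (M ! x ! a) _)))))))
          where
          regroup : ∀ p q r s t u → p * (q * r) * (s * (t * u)) ≡ p * s * (q * t * (r * u))
          regroup = solve-∀
        bound : ∀ x y → codeg M x y * conon x y ≤ [ y ≟F x ] * (d * m) + c * (k + c)
        bound x y = go (y ≟F x)
          where
          go : (p : Dec (y ≡ x)) → codeg M x y * conon x y ≤ [ p ] * (d * m) + c * (k + c)
          go (yes refl) = ≤-trans (≤-reflexive (trans (cong₂ _*_ (codeg-self x) (+-cancelʳ-≡ d _ _ (trans (conon-eq x x) (cong (m +_) (codeg-self x))))) (sym (*-identityˡ (d * m))))) (m≤m+n _ _)
          go (no ne) = *-mono-≤ (cod x y (ne ∘ sym)) (+-cancelʳ-≤ d _ _ (begin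
            conon x y + d ≡⟨ conon-eq x y ⟩
            m + codeg M x y ≤⟨ +-mono-≤ (≤-reflexive (trans (sym d+k≡m) (+-comm d k))) (cod x y (ne ∘ sym)) ⟩
            k + d + c ≡⟨ comm k d c ⟩
            k + c + d ∎))
            where
            comm : ∀ p q r → p + q + r ≡ p + r + q
            comm = solve-∀
        row : ∀ x → ∑ (λ y → ⟦ E x ⟧ * ⟦ E y ⟧ * ([ y ≟F x ] * (d * m) + c * (k + c))) ≤ ⟦ E x ⟧ * (d * m + L * (c * (k + c)))
        row x = begin
          ∑ (λ y → ⟦ E x ⟧ * ⟦ E y ⟧ * ([ y ≟F x ] * (d * m) + c * (k + c))) ≤⟨ sum-mono (λ y → ≤-trans (≤-reflexive (reg′ ⟦ E x ⟧ ⟦ E y ⟧ [ y ≟F x ] (d * m) (c * (k + c))))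
                                                                                 (*-monoʳ-≤ ⟦ E x ⟧ (+-monoˡ-≤ _ (≤-trans (*-monoˡ-≤ ([ y ≟F x ] * (d * m)) (⟦⟧≤1 (E y))) (≤-reflexive (*-identityˡ _)))))) ⟩
          ∑ (λ y → ⟦ E x ⟧ * ([ y ≟F x ] * (d * m) + ⟦ E y ⟧ * (c * (k + c)))) ≡⟨ sum-*ˡ ⟦ E x ⟧ _ ⟩
          ⟦ E x ⟧ * ∑ (λ y → [ y ≟F x ] * (d * m) + ⟦ E y ⟧ * (c * (k + c))) ≡⟨ cong (⟦ E x ⟧ *_) (trans (sum-+ _ _) (cong₂ _+_ (sum-δ (λ _ → d * m) x) (sum-*ʳ (c * (k + c)) _))) ⟩
          ⟦ E x ⟧ * (d * m + L * (c * (k + c))) ∎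
          where
          reg′ : ∀ p q r s t → p * q * (r * s + t) ≡ p * (q * (r * s) + q * t)
          reg′ = solve-∀

      deviations : ∀ G c k → d + k ≡ m → (∀ x y → ¬ x ≡ y → codeg M x y ≤ c) → 1 ≤ L * d * m →
                   G * (n * n * (L * (d * m) + L * L * (c * (k + c)))) ≤ suc G * (L * d * m * (L * d * m)) →
                   G * ∑₂ (λ a b → [ Deviates? (L * d * m) (X a b) ]) ≤ 4 * (n * n)
      deviations G c k d+k≡m cod pos h = chebyshev X (L * d * m) G first-moment pos
        (≤-trans (*-monoʳ-≤ G (*-monoʳ-≤ (n * n) (second-moment c k d+k≡m cod))) h)

-- The hypothesis of Chebyshev's inequality, with codegree bound c ≤ (1 + 1/6G)d²/n and Ld ≥ 4Gn.
second-moment-ratio : ∀ n d k c L G → d + (d + k) ≡ n → 1 ≤ G → 4 * G * n ≤ L * d →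
  6 * G * (n * c) ≤ suc (6 * G) * (d * d) →
  G * (n * n * (L * (d * (d + k)) + L * L * (c * (k + c)))) ≤ suc G * (L * d * (d + k) * (L * d * (d + k)))
second-moment-ratio n d k c L G refl 1≤G large cod = *-cancelˡ-≤ 2 (begin
  2 * (G * (n * n * (L * (d * m) + L * L * (c * (k + c))))) ≡⟨ lem₁ G n (L * (d * m)) (L * L) (c * (k + c)) ⟩
  2 * G * (n * n) * (L * (d * m)) + L * L * (2 * G * (n * n * (c * (k + c)))) ≤⟨ +-mono-≤ first (*-monoʳ-≤ (L * L) second) ⟩
  L * d * m * (L * d * m) + L * L * (suc (2 * G) * (d * d * (m * m))) ≡⟨ lem₂ L d m G ⟩
  2 * (suc G * (L * d * m * (L * d * m))) ∎)
  where
  open ≤-Reasoning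
  m H : ℕ
  m = d + k
  H = 6 * G
  lem₁ : ∀ G n u v w → 2 * (G * (n * n * (u + v * w))) ≡ 2 * G * (n * n) * u + v * (2 * G * (n * n * w))
  lem₁ = solve-∀
  lem₂ : ∀ L d m G → L * d * m * (L * d * m) + L * L * (suc (2 * G) * (d * d * (m * m))) ≡ 2 * (suc G * (L * d * m * (L * d * m)))
  lem₂ = solve-∀
  n≤2m : n ≤ 2 * m
  n≤2m = ≤-trans (+-monoˡ-≤ m (m≤m+n d k)) (≤-reflexive (cong (m +_) (sym (+-identityʳ m))))
  -- With `A = L * d * m`, the allowed excess over `G * A²` is `A²`. The diagonal takes one half of
  -- it here, the codegrees take the other half in `second`.
  first : 2 * G * (n * n) * (L * (d * m)) ≤ L * d * m * (L * d * m)
  first = begin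
    2 * G * (n * n) * (L * (d * m)) ≤⟨ *-monoˡ-≤ (L * (d * m)) (*-monoʳ-≤ (2 * G) (*-monoʳ-≤ n n≤2m)) ⟩
    2 * G * (n * (2 * m)) * (L * (d * m)) ≡⟨ lem₃ G n m L d ⟩
    4 * G * n * m * (L * d * m) ≤⟨ *-monoˡ-≤ (L * d * m) (*-monoˡ-≤ m large) ⟩
    L * d * m * (L * d * m) ∎
    where
    lem₃ : ∀ G n m L d → 2 * G * (n * (2 * m)) * (L * (d * m)) ≡ 4 * G * n * m * (L * d * m)
    lem₃ = solve-∀
  -- As `n * k + d * d` equals `m * m`, the bound on `n * c` passes to common non-neighbours with no
  -- larger relative error.
  cocod : H * (n * (k + c)) ≤ suc H * (m * m)
  cocod = begin
    H * (n * (k + c)) ≡⟨ lem₄ H n k c ⟩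
    H * (n * k) + H * (n * c) ≤⟨ +-monoʳ-≤ (H * (n * k)) cod ⟩
    H * (n * k) + suc H * (d * d) ≡⟨ lem₅ H d k ⟩
    H * (m * m) + d * d ≤⟨ +-monoʳ-≤ (H * (m * m)) (*-mono-≤ (m≤m+n d k) (m≤m+n d k)) ⟩
    H * (m * m) + m * m ≡⟨ +-comm (H * (m * m)) (m * m) ⟩
    suc H * (m * m) ∎
    where
    lem₄ : ∀ H n k c → H * (n * (k + c)) ≡ H * (n * k) + H * (n * c)
    lem₄ = solve-∀
    lem₅ : ∀ H d k → H * ((d + (d + k)) * k) + suc H * (d * d) ≡ H * ((d + k) * (d + k)) + d * d
    lem₅ = solve-∀
  second : 2 * G * (n * n * (c * (k + c))) ≤ suc (2 * G) * (d * d * (m * m))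
  second = *-cancelˡ-≤ (H * H) {{>-nonZero (*-mono-≤ 1≤H 1≤H)}} (begin
    H * H * (2 * G * (n * n * (c * (k + c)))) ≡⟨ lem₆ H G n c (k + c) ⟩
    2 * G * (H * (n * c) * (H * (n * (k + c)))) ≤⟨ *-monoʳ-≤ (2 * G) (*-mono-≤ cod cocod) ⟩
    2 * G * (suc H * (d * d) * (suc H * (m * m))) ≡⟨ lem₇ G H (d * d) (m * m) ⟩
    2 * G * (suc H * suc H) * (d * d * (m * m)) ≤⟨ *-monoˡ-≤ (d * d * (m * m)) poly ⟩
    H * H * suc (2 * G) * (d * d * (m * m)) ≡⟨ *-assoc (H * H) (suc (2 * G)) (d * d * (m * m)) ⟩
    H * H * (suc (2 * G) * (d * d * (m * m))) ∎)
    where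
    1≤H : 1 ≤ H
    1≤H = ≤-trans 1≤G (m≤m+n G _)
    lem₆ : ∀ H G n c z → H * H * (2 * G * (n * n * (c * z))) ≡ 2 * G * (H * (n * c) * (H * (n * z)))
    lem₆ = solve-∀
    lem₇ : ∀ G H u v → 2 * G * (suc H * u * (suc H * v)) ≡ 2 * G * (suc H * suc H) * (u * v)
    lem₇ = solve-∀
    -- This is `(1 + 1/H)² ≤ 1 + 1/(2G)`, the origin of `H = 6 * G`.
    poly : 2 * G * (suc H * suc H) ≤ H * H * suc (2 * G)
    poly = begin
      2 * G * (suc (6 * G) * suc (6 * G)) ≡⟨ lem₈ G ⟩
      72 * (G * G * G) + 24 * (G * G) + 2 * (G * 1) ≤⟨ +-monoʳ-≤ (72 * (G * G * G) + 24 * (G * G)) (*-monoʳ-≤ 2 (*-monoʳ-≤ G 1≤G)) ⟩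
      72 * (G * G * G) + 24 * (G * G) + 2 * (G * G) ≤⟨ m≤m+n _ (10 * (G * G)) ⟩
      72 * (G * G * G) + 24 * (G * G) + 2 * (G * G) + 10 * (G * G) ≡⟨ lem₉ G ⟩
      6 * G * (6 * G) * suc (2 * G) ∎
      where
      lem₈ : ∀ G → 2 * G * (suc (6 * G) * suc (6 * G)) ≡ 72 * (G * G * G) + 24 * (G * G) + 2 * (G * 1)
      lem₈ = solve-∀
      lem₉ : ∀ G → 72 * (G * G * G) + 24 * (G * G) + 2 * (G * G) + 10 * (G * G) ≡ 6 * G * (6 * G) * suc (2 * G)
      lem₉ = solve-∀

-- Matchings and rigid sets

listSum : ∀ {X : Set} → (X → ℕ) → List X → ℕ
listSum g [] = 0
listSum g (x ∷ L) = g x + listSum g L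

listSum-++ : ∀ {X : Set} (g : X → ℕ) L L′ → listSum g (L ++ L′) ≡ listSum g L + listSum g L′
listSum-++ g [] L′ = refl
listSum-++ g (x ∷ L) L′ = trans (cong (g x +_) (listSum-++ g L L′)) (sym (+-assoc (g x) _ _))

listSum-map : ∀ {X Y : Set} (g : Y → ℕ) (f : X → Y) L → listSum g (map f L) ≡ listSum (g ∘ f) L
listSum-map g f [] = refl
listSum-map g f (x ∷ L) = cong (g (f x) +_) (listSum-map g f L)

listSum-tabulate : ∀ {X : Set} {m} (g : X → ℕ) (f : Fin m → X) → listSum g (Data.List.tabulate f) ≡ ∑ (λ i → g (f i))
listSum-tabulate {m = zero} g f = sym (sum-zero {f = λ i → g (f i)} λ ())
listSum-tabulate {m = suc m} g f = trans (cong (g (f zero) +_) (listSum-tabulate g (f ∘ suc))) (sym (sum-suc (λ i → g (f i))))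

listSum-product : ∀ {X Y : Set} (g : X × Y → ℕ) (xs : List X) (ys : List Y) →
                  listSum g (cartesianProduct xs ys) ≡ listSum (λ x → listSum (λ y → g (x , y)) ys) xs
listSum-product g [] ys = refl
listSum-product g (x ∷ xs) ys = trans (listSum-++ g (map (x ,_) ys) _)
                                      (cong₂ _+_ (listSum-map g (x ,_) ys) (listSum-product g xs ys))

listSum-filter : ∀ {X : Set} {P : X → Set} (P? : ∀ x → Dec (P x)) (g : X → ℕ) L →
                 listSum g (filter P? L) ≡ listSum (λ x → [ P? x ] * g x) L
listSum-filter P? g [] = refl
listSum-filter P? g (x ∷ L) with P? x
... | yes _ = cong₂ _+_ (sym (+-identityʳ (g x))) (listSum-filter P? g L)
... | no _ = listSum-filter P? g L

module Matchings {n : ℕ} where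

  -- Two different pairs with the same sum `r` are disjoint, so fixing `r` produces a matching
  -- without any choice, and the sums below `2 * n` cover all pairs.
  Matched : ℕ → (Fin n → Bool) → Fin n × Fin n → Set
  Matched r A (a , b) = (A a ≡ true × A b ≡ true) × (toℕ a < toℕ b × toℕ a + toℕ b ≡ r)

  Matched? : ∀ r A ab → Dec (Matched r A ab)
  Matched? r A (a , b) = ((A a ≟B true) ×-dec (A b ≟B true)) ×-dec ((toℕ a <? toℕ b) ×-dec (toℕ a + toℕ b ≟ℕ r))

  pairs : List (Fin n × Fin n)
  pairs = cartesianProduct (allFin n) (allFin n)

  matching : ℕ → (Fin n → Bool) → List (Fin n × Fin n)
  matching r A = filter (Matched? r A) pairs

  matched-disjoint : ∀ {r A ab ab′} → Matched r A ab → Matched r A ab′ → ¬ ab ≡ ab′ → Disjoint ab ab′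
  matched-disjoint {r} {A} {a , b} {a′ , b′} (_ , (a<b , e)) (_ , (a′<b′ , e′)) ne =
    ((λ { refl → ne (cong (a ,_) (toℕ-injective (+-cancelˡ-≡ (toℕ a) _ _ (trans e (sym e′))))) }) , crossʳ) ,
    (crossˡ , (λ { refl → ne (cong (_, b) (toℕ-injective (+-cancelʳ-≡ (toℕ b) _ _ (trans e (sym e′))))) }))
    where
    crossʳ : ¬ a ≡ b′
    crossʳ refl = <-asym a<b (subst (_< toℕ a) (sym (+-cancelˡ-≡ (toℕ a) _ _ (trans e (trans (sym e′) (+-comm (toℕ a′) (toℕ a)))))) a′<b′)
    crossˡ : ¬ b ≡ a′
    crossˡ refl = <-asym a<b (subst (toℕ b <_) (sym (+-cancelʳ-≡ (toℕ b) _ _ (trans e (trans (sym e′) (+-comm (toℕ b) (toℕ b′)))))) a′<b′)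

  matching-ok : ∀ r A → All (Matched r A) (matching r A)
  matching-ok r A = all-filter (Matched? r A) pairs

  matching-disjoint : ∀ r A → AllPairs Disjoint (matching r A)
  matching-disjoint r A = go (matching-ok r A) (filter⁺ (Matched? r A) (cartesianProduct⁺ (allFin⁺ n) (allFin⁺ n)))
    where
    go : ∀ {L} → All (Matched r A) L → Unique L → AllPairs Disjoint L
    go [] [] = []
    go (o ∷ os) (u ∷ us) = All.zipWith (λ { (ne , o′) → matched-disjoint {r} {A} o o′ ne }) (u , os) ∷ go os us

  listSum-pairs : ∀ g → listSum g pairs ≡ ∑₂ (λ a b → g (a , b))
  listSum-pairs g = trans (listSum-product g (allFin n) (allFin n))
    (trans (listSum-tabulate _ id) (sum-cong (λ a → listSum-tabulate (λ b → g (a , b)) id)))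

module Events {n N : ℕ} (ω : Fin N → VG n) (once : ∀ M → ∑ (λ i → [ ω i ≟G M ]) ≡ 1) (d : ℕ) where

  open Switches ω once
  open Matchings {n}

  module _ {B : ℕ → ℕ → ℕ → ℕ → Set} (B? : ∀ t₁ t₂ t₃ t₄ → Dec (B t₁ t₂ t₃ t₄)) (E E′ D S : Row n) (c r s : ℕ) where

    open PairLists ω once (E !_) (E′ !_)

    allowed : Fin n → Bool
    allowed j = (S ! j) ∧ (not (E ! j) ∧ not (E′ ! j))

    -- Part of the event itself, so that the union bound can run over all rows `E`, `E′`, `D`
    -- without a side condition; where it fails the event is empty.
    Pre : Set
    Pre = (∀ j → E ! j ≡ true → D ! j ≡ true) × (∀ j → E′ ! j ≡ true → D ! j ≡ false)

    private
      implies? : ∀ a b → Dec (a ≡ true → b ≡ true)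
      implies? a true = yes (λ _ → refl)
      implies? true false = no (λ h → true≢false (h refl) refl)
      implies? false false = yes (λ ())

      implies-not? : ∀ a b → Dec (a ≡ true → b ≡ false)
      implies-not? a false = yes (λ _ → refl)
      implies-not? true true = no (λ h → true≢false refl (h refl))
      implies-not? false true = yes (λ ())

      Pre? : Dec Pre
      Pre? = all? (λ j → implies? (E ! j) (D ! j)) ×-dec all? (λ j → implies-not? (E′ ! j) (D ! j))

      C : Row n → Row n → Set
      C p q = dg (D !_) p ≡ c × dg (D !_) q ≡ c

      C? : ∀ p q → Dec (C p q)
      C? p q = (dg (D !_) p ≟ℕ c) ×-dec (dg (D !_) q ≟ℕ c)

    OnRows : Row n → Row n → Set
    OnRows p q = B (e (E !_) p q) (e (E !_) q p) (e (E′ !_) p q) (e (E′ !_) q p)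

    OnRows? : ∀ p q → Dec (OnRows p q)
    OnRows? p q = B? (e (E !_) p q) (e (E !_) q p) (e (E′ !_) p q) (e (E′ !_) q p)

    -- The degree into D is constantly c on the matching of S, although s of its pairs can be switched.
    Rigid : VG n → Set
    Rigid M = Pre × (Reg d M × (All (Cᵖ C? OnRows? M) (matching r allowed) × s ≤ goodCount C? OnRows? (matching r allowed) M))

    Rigid? : ∀ M → Dec (Rigid M)
    Rigid? M = Pre? ×-dec (Reg? d M ×-dec (All.all? (Cᵖ? C? OnRows? M) (matching r allowed) ×-dec (s ≤? goodCount C? OnRows? (matching r allowed) M)))

    Rigid-intro : Pre → ∀ M → Reg d M → (∀ j → S ! j ≡ true → dg (D !_) (M ! j) ≡ c) →
                  s ≤ ∑₂ (λ a b → [ Matched? r allowed (a , b) ×-dec OnRows? (M ! a) (M ! b) ]) → Rigid M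
    Rigid-intro pre M reg const many = pre , reg ,
      All.map (λ { ((Aa , Ab) , _) → const _ (proj₁ (∧-true Aa)) , const _ (proj₁ (∧-true Ab)) }) (matching-ok r allowed) ,
      ≤-trans many (≤-reflexive (sym (trans (count (matching r allowed)) (trans (listSum-filter (Matched? r allowed) _ pairs)
        (trans (listSum-pairs _) (sum-cong (λ a → sum-cong (λ b → sym ([]-× (Matched? r allowed (a , b)) (OnRows? (M ! a) (M ! b)))))))))))
      where
      count : ∀ L → goodCount C? OnRows? L M ≡ listSum (λ { (a , b) → [ OnRows? (M ! a) (M ! b) ] }) L
      count [] = refl
      count ((a , b) ∷ L) = cong ([ OnRows? (M ! a) (M ! b) ] +_) (count L)

    rigid-rare : ∀ p q →
      (Pre → ∀ {a b} → Frame (E !_) (E′ !_) a b → ∀ {Q : VG n → Set} (Q? : ∀ M → Dec (Q M)) → Invariant Q (a , b) →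
         p * # (λ M → (Q? M ×-dec C? (M ! a) (M ! b)) ×-dec OnRows? (M ! a) (M ! b)) ≤
         q * # (λ M → Q? M ×-dec ¬? (C? (M ! a) (M ! b)))) →
      (p + q) ^ s * # Rigid? ≤ q ^ s * # (Reg? d)
    rigid-rare p q local with Pre?
    ... | no ¬pre = ≤-trans (≤-reflexive (trans (cong ((p + q) ^ s *_) (#-empty _ (λ { M (pre , _) → ¬pre pre }))) (*-zeroʳ ((p + q) ^ s)))) z≤n
    ... | yes pre = ≤-trans (*-monoʳ-≤ ((p + q) ^ s) (#-mono _ (λ M → Reg? d M ×-dec (All.all? (Cᵖ? C? OnRows? M) L ×-dec (s ≤? goodCount C? OnRows? L M))) (λ M → proj₂)))
                            (pair-list C? OnRows? p q (local pre) L (All.map frame (matching-ok r allowed)) (matching-disjoint r allowed) (Reg? d) (All.map invariant (matching-ok r allowed)) s)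
      where
      L : List (Fin n × Fin n)
      L = matching r allowed
      outE : ∀ {j} → allowed j ≡ true → E ! j ≡ false
      outE {j} h = not-true (proj₁ (∧-true (proj₂ (∧-true {S ! j} h))))
      outE′ : ∀ {j} → allowed j ≡ true → E′ ! j ≡ false
      outE′ {j} h = not-true (proj₂ (∧-true {not (E ! j)} (proj₂ (∧-true {S ! j} h))))
      disj : ∀ j → E ! j ≡ true → E′ ! j ≡ false
      disj j Ej with E′ ! j in eqn
      ... | true = ⊥-elim (true≢false (proj₁ pre j Ej) (proj₂ pre j eqn))
      ... | false = refl
      frame : ∀ {ab} → Matched r allowed ab → Frameᵖ ab
      frame ((Aa , Ab) , (a<b , _)) = record
        { a≢b = λ { refl → <-irrefl refl a<b } ; disj = disj
        ; Ea = outE Aa ; E′a = outE′ Aa ; Eb = outE Ab ; E′b = outE′ Ab }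
      closed : ∀ {a b} → Frame (E !_) (E′ !_) a b → Closed (E !_) (E′ !_) a b (Reg d) (Reg d)
      closed F M x y Ex E′y sw reg = Pair.Sg.Reg-τ (E !_) (E′ !_) _ _ F x y Ex E′y M sw reg
      invariant : ∀ {ab} → Matched r allowed ab → Invariant (Reg d) ab
      invariant o = closed (frame o) , closed (Frame-sym (frame o))

module _ {n : ℕ} where

  open Matchings {n}

  -- Each a < b lies in the matching with r = a + b < 2n, so some r carries the average number of pairs.
  good-matching : ∀ {W : Fin n → Fin n → Set} (W? : ∀ a b → Dec (W a b)) (A : Fin n → Bool) s →
                  2 * n * s < ∑₂ (λ a b → [ ((A a ≟B true) ×-dec (A b ≟B true)) ×-dec ((toℕ a <? toℕ b) ×-dec W? a b) ]) →
                  ∃[ r ] (r < 2 * n × s ≤ ∑₂ (λ a b → [ Matched? r A (a , b) ×-dec W? a b ]))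
  good-matching W? A s many with sum-large {2 * n} (λ r → ∑₂ (λ a b → [ Matched? (toℕ r) A (a , b) ×-dec W? a b ])) s
      (<-≤-trans many (≤-trans (∑₂-mono each) (≤-reflexive (∑₂-sum (λ r a b → [ Matched? (toℕ r) A (a , b) ×-dec W? a b ])))))
    where
    each : ∀ a b → [ ((A a ≟B true) ×-dec (A b ≟B true)) ×-dec ((toℕ a <? toℕ b) ×-dec W? a b) ] ≤
                   ∑ {2 * n} (λ r → [ Matched? (toℕ r) A (a , b) ×-dec W? a b ])
    each a b = ≤-trans ([]-mono (((A a ≟B true) ×-dec (A b ≟B true)) ×-dec ((toℕ a <? toℕ b) ×-dec W? a b))
                                (Matched? (toℕ r) A (a , b) ×-dec W? a b)
                                (λ { (aa , (lt , w)) → (aa , (lt , sym (toℕ-fromℕ< r<))) , w }))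
                       (sum-elem {2 * n} (λ r → [ Matched? (toℕ r) A (a , b) ×-dec W? a b ]) r)
      where
      r< : toℕ a + toℕ b < 2 * n
      r< = <-≤-trans (+-mono-< (toℕ<n a) (toℕ<n b)) (≤-reflexive (cong (n +_) (sym (+-identityʳ n))))
      r : Fin (2 * n)
      r = fromℕ< r<
  ... | r , h = toℕ r , toℕ<n r , <⇒≤ h

  halve : ∀ {W : Fin n → Fin n → Set} (W? : ∀ a b → Dec (W a b)) → (∀ a b → W a b → W b a) →
          ∑₂ (λ a b → [ W? a b ]) ≤ 2 * ∑₂ (λ a b → [ (toℕ a <? toℕ b) ×-dec W? a b ]) + n
  halve W? W-sym = begin
    ∑₂ (λ a b → [ W? a b ]) ≤⟨ ∑₂-mono each ⟩
    ∑₂ (λ a b → [ L? a b ] + [ L? b a ] + [ b ≟F a ] * 1) ≡⟨ trans (∑₂-+ _ _) (cong₂ _+_ (∑₂-+ _ _) (sum-cong (λ a → sum-δ (λ _ → 1) a))) ⟩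
    ∑₂ (λ a b → [ L? a b ]) + ∑₂ (λ a b → [ L? b a ]) + ∑ {n} (λ _ → 1) ≡⟨ cong₂ _+_ (cong (∑₂ (λ a b → [ L? a b ]) +_) (∑₂-swap (λ a b → [ L? b a ]))) (trans (sum-const n 1) (*-identityʳ n)) ⟩
    Y + Y + n ≡⟨ cong (λ z → Y + z + n) (sym (+-identityʳ Y)) ⟩
    2 * Y + n ∎
    where
    open ≤-Reasoning
    L? = λ a b → (toℕ a <? toℕ b) ×-dec W? a b
    Y : ℕ
    Y = ∑₂ (λ a b → [ L? a b ])
    each : ∀ a b → [ W? a b ] ≤ [ L? a b ] + [ L? b a ] + [ b ≟F a ] * 1
    each a b with <-cmp (toℕ a) (toℕ b)
    ... | tri< lt _ _ = ≤-trans ([]-mono (W? a b) (L? a b) (λ w → lt , w)) (≤-trans (m≤m+n _ _) (m≤m+n _ _))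
    ... | tri> _ _ gt = ≤-trans ([]-mono (W? a b) (L? b a) (λ w → gt , W-sym a b w)) (≤-trans (m≤n+m _ [ L? a b ]) (m≤m+n _ _))
    ... | tri≈ _ eqn _ = ≤-trans ([]≤1 (W? a b)) (≤-trans (≤-reflexive (sym (trans (*-identityʳ _) ([]-true (b ≟F a) (sym (toℕ-injective eqn)))))) (m≤n+m _ _))

-- Abundance of switchable pairs

AllBelow : ℕ → ℕ → ℕ → ℕ → ℕ → Set
AllBelow β t₁ t₂ t₃ t₄ = (t₁ ≤ β × t₂ ≤ β) × (t₃ ≤ β × t₄ ≤ β)

Moderate : ℕ → ℕ → ℕ → ℕ → ℕ → Set
Moderate β t₁ t₂ t₃ t₄ = AllAbove 1 t₁ t₂ t₃ t₄ × AllBelow β t₁ t₂ t₃ t₄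

Moderate? : ∀ β t₁ t₂ t₃ t₄ → Dec (Moderate β t₁ t₂ t₃ t₄)
Moderate? β t₁ t₂ t₃ t₄ = AllAbove? 1 t₁ t₂ t₃ t₄ ×-dec (((t₁ ≤? β) ×-dec (t₂ ≤? β)) ×-dec ((t₃ ≤? β) ×-dec (t₄ ≤? β)))

size : ∀ {n} → (Fin n → Bool) → ℕ
size A = ∑ (λ j → ⟦ A j ⟧)

module _ {n : ℕ} where

  common : (Fin n → Bool) → Row n → Row n → ℕ
  common A r s = ∑ (λ j → ⟦ A j ∧ ((r ! j) ∧ (s ! j)) ⟧)

  e+common : ∀ A (r s : Row n) → e A r s + common A r s ≡ dg A r
  e+common A r s = trans (sym (sum-+ _ _)) (sum-cong (λ j → lem (A j) (r ! j) (s ! j)))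
    where
    lem : ∀ p q t → ⟦ p ∧ (q ∧ not t) ⟧ + ⟦ p ∧ (q ∧ t) ⟧ ≡ ⟦ p ∧ q ⟧
    lem false q t = refl
    lem true false t = refl
    lem true true true = refl
    lem true true false = refl

  common-sym : ∀ A (r s : Row n) → common A r s ≡ common A s r
  common-sym A r s = sum-cong (λ j → lem (A j) (r ! j) (s ! j))
    where
    lem : ∀ p q t → ⟦ p ∧ (q ∧ t) ⟧ ≡ ⟦ p ∧ (t ∧ q) ⟧
    lem false q t = refl
    lem true false false = refl
    lem true false true = refl
    lem true true false = refl
    lem true true true = refl

  e-balanced : ∀ A (r s : Row n) → dg A r ≡ dg A s → e A r s ≡ e A s r
  e-balanced A r s h = +-cancelʳ-≡ (common A r s) _ _
    (trans (e+common A r s) (trans h (trans (sym (e+common A s r)) (cong (e A s r +_) (common-sym A s r)))))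

  e≤dg : ∀ A (r s : Row n) → e A r s ≤ dg A r
  e≤dg A r s = ≤-trans (m≤m+n _ _) (≤-reflexive (e+common A r s))

  remaining : (E E′ S : Row n) → Fin n → Bool
  remaining E E′ S j = (S ! j) ∧ (not (E ! j) ∧ not (E′ ! j))

  remaining-size : ∀ E E′ S → size (S !_) ≤ size (remaining E E′ S) + (size (E !_) + size (E′ !_))
  remaining-size E E′ S = ≤-trans (sum-mono (λ j → lem (S ! j) (E ! j) (E′ ! j)))
                                  (≤-reflexive (trans (sum-+ _ _) (cong (size (remaining E E′ S) +_) (sum-+ _ _))))
    where
    lem : ∀ p q t → ⟦ p ⟧ ≤ ⟦ p ∧ (not q ∧ not t) ⟧ + (⟦ q ⟧ + ⟦ t ⟧)
    lem false q t = z≤n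
    lem true true t = s≤s z≤n
    lem true false true = s≤s z≤n
    lem true false false = s≤s z≤n

  cover₄ : ∀ {W P₁ P₂ P₃ P₄ : Set} (w : Dec W) (p₁ : Dec P₁) (p₂ : Dec P₂) (p₃ : Dec P₃) (p₄ : Dec P₄) →
           (¬ P₁ → ¬ P₂ → ¬ P₃ → ¬ P₄ → W) → 1 ≤ [ w ] + ([ p₁ ] + [ p₂ ]) + ([ p₃ ] + [ p₄ ])
  cover₄ (yes _) _ _ _ _ h = s≤s z≤n
  cover₄ (no _) (yes _) _ _ _ h = s≤s z≤n
  cover₄ (no _) (no _) (yes _) _ _ h = s≤s z≤n
  cover₄ (no _) (no _) (no _) (yes _) _ h = s≤s z≤n
  cover₄ (no _) (no _) (no _) (no _) (yes _) h = s≤s z≤n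
  cover₄ (no ¬w) (no p) (no q) (no r) (no s) h = contradiction (h p q r s) ¬w

  -- Here `k = n - 2d` and `m = n - d ≥ n/2`. With `T n ≤ L d ≤ (T + 1) n` the mean of `e` on a set
  -- of size `L` lies between `T/2` and `T + 1`, so pairs that do not deviate have values between
  -- `T/4` and `2 (T + 1)`.
  module Dense (d k : ℕ) (d+m≡n : d + (d + k) ≡ n) (M : VG n) (reg : Reg d M) (1≤n : 1 ≤ n)
               (cod G T L : ℕ) (1≤G : 1 ≤ G) (4G≤T : 4 * G ≤ T) (lowL : T * n ≤ L * d) (highL : L * d ≤ suc T * n)
               (small : 6 * G * (n * cod) ≤ suc (6 * G) * (d * d))
               (codegrees : ∀ x y → ¬ x ≡ y → codeg M x y ≤ cod) where

    open Regular d (d + k) d+m≡n M reg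

    m A : ℕ
    m = d + k
    A = L * d * m

    n≤2m : n ≤ 2 * m
    n≤2m = subst (_≤ 2 * m) d+m≡n (≤-trans (+-monoˡ-≤ m (m≤m+n d k)) (≤-reflexive (cong (m +_) (sym (+-identityʳ m)))))

    1≤A : 1 ≤ A
    1≤A = *-mono-≤ (≤-trans (*-mono-≤ (≤-trans (≤-trans 1≤G (m≤m+n G _)) 4G≤T) 1≤n) lowL) 1≤m
      where
      1≤m : 1 ≤ m
      1≤m = *-cancelˡ-< 2 0 m (≤-trans 1≤n n≤2m)

    Dev : Row n → Fin n → Fin n → Set
    Dev E a b = Deviates {n} A (e (E !_) (M ! a) (M ! b))

    Dev? : ∀ E a b → Dec (Dev E a b)
    Dev? E a b = Deviates? {n} A (e (E !_) (M ! a) (M ! b))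

    few-deviations : ∀ E → size (E !_) ≡ L → G * ∑₂ (λ a b → [ Dev? E a b ]) ≤ 4 * (n * n)
    few-deviations E refl = deviations (E !_) G cod k refl codegrees 1≤A
      (second-moment-ratio n d k cod L G d+m≡n 1≤G (≤-trans (*-monoˡ-≤ n 4G≤T) lowL) small)

    typical-low : ∀ x → ¬ Deviates {n} A x → T ≤ 4 * x
    typical-low x ¬dev = *-cancelʳ-≤ T (4 * x) (n * n) {{>-nonZero (*-mono-≤ 1≤n 1≤n)}} (begin
      T * (n * n) ≡⟨ sym (*-assoc T n n) ⟩
      T * n * n ≤⟨ *-mono-≤ lowL n≤2m ⟩
      L * d * (2 * m) ≡⟨ lem₁ (L * d) m ⟩
      2 * A ≤⟨ *-monoʳ-≤ 2 (≮⇒≥ (¬dev ∘ inj₁)) ⟩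
      2 * (2 * (n * n * x)) ≡⟨ lem₂ (n * n) x ⟩
      4 * x * (n * n) ∎)
      where
      open ≤-Reasoning
      lem₁ : ∀ u m → u * (2 * m) ≡ 2 * (u * m)
      lem₁ = solve-∀
      lem₂ : ∀ u x → 2 * (2 * (u * x)) ≡ 4 * x * u
      lem₂ = solve-∀

    typical-high : ∀ x → ¬ Deviates {n} A x → x ≤ 2 * suc T
    typical-high x ¬dev = *-cancelʳ-≤ x (2 * suc T) (n * n) {{>-nonZero (*-mono-≤ 1≤n 1≤n)}} (begin
      x * (n * n) ≡⟨ *-comm x (n * n) ⟩
      n * n * x ≤⟨ ≮⇒≥ (¬dev ∘ inj₂) ⟩
      2 * (L * d * m) ≤⟨ *-monoʳ-≤ 2 (*-mono-≤ highL (subst (m ≤_) d+m≡n (m≤n+m m d))) ⟩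
      2 * (suc T * n * n) ≡⟨ lem (suc T) n ⟩
      2 * suc T * (n * n) ∎)
      where
      open ≤-Reasoning
      lem : ∀ t n → 2 * (t * n * n) ≡ 2 * t * (n * n)
      lem = solve-∀

    module _ (E E′ S : Row n) where

      private
        R : Fin n → Bool
        R = remaining E E′ S
        σ : ℕ
        σ = size R
        both? : ∀ a b → Dec (R a ≡ true × R b ≡ true)
        both? a b = (R a ≟B true) ×-dec (R b ≟B true)

      Switchable : {B : ℕ → ℕ → ℕ → ℕ → Set} (B? : ∀ t₁ t₂ t₃ t₄ → Dec (B t₁ t₂ t₃ t₄)) (a b : Fin n) →
                   Dec (B (e (E !_) (M ! a) (M ! b)) (e (E !_) (M ! b) (M ! a)) (e (E′ !_) (M ! a) (M ! b)) (e (E′ !_) (M ! b) (M ! a)))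
      Switchable B? a b = B? (e (E !_) (M ! a) (M ! b)) (e (E !_) (M ! b) (M ! a)) (e (E′ !_) (M ! a) (M ! b)) (e (E′ !_) (M ! b) (M ! a))

      pair-count : {B : ℕ → ℕ → ℕ → ℕ → Set} (B? : ∀ t₁ t₂ t₃ t₄ → Dec (B t₁ t₂ t₃ t₄)) → ℕ
      pair-count B? = ∑₂ (λ a b → [ ((R a ≟B true) ×-dec (R b ≟B true)) ×-dec ((toℕ a <? toℕ b) ×-dec Switchable B? a b) ])

      private
        ordered : {B : ℕ → ℕ → ℕ → ℕ → Set} (B? : ∀ t₁ t₂ t₃ t₄ → Dec (B t₁ t₂ t₃ t₄)) →
                  (∀ t₁ t₂ t₃ t₄ → B t₁ t₂ t₃ t₄ → B t₂ t₁ t₄ t₃) →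
                  ∑₂ (λ a b → [ both? a b ×-dec Switchable B? a b ]) ≤ 2 * pair-count B? + n
        ordered B? B-sym = ≤-trans (halve (λ a b → both? a b ×-dec Switchable B? a b) (λ { a b ((p , q) , w) → (q , p) , B-sym _ _ _ _ w }))
          (+-monoˡ-≤ n (*-monoʳ-≤ 2 (∑₂-mono (λ a b → []-mono ((toℕ a <? toℕ b) ×-dec (both? a b ×-dec Switchable B? a b))
                                                             (both? a b ×-dec ((toℕ a <? toℕ b) ×-dec Switchable B? a b))
                                                             (λ { (lt , (ab , w)) → ab , (lt , w) })))))

        square : σ * σ ≡ ∑₂ (λ a b → ⟦ R a ⟧ * ⟦ R b ⟧)
        square = sym (sum-product (λ a → ⟦ R a ⟧) (λ b → ⟦ R b ⟧))

      -- Removing `E` and `E′` leaves `σ ≥ n/(4κ)` vertices, hence `σ² ≥ n²/(16κ²)` ordered pairs.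
      -- Each of the four deviations (two sets, two orders) spoils at most `4n²/G = n²/(256κ²)` of
      -- them, which fixes `G`; the diagonal costs `n`, and passing to `a < b` halves the rest.
      large-pair-count : ∀ κ θ → size (E !_) ≡ L → size (E′ !_) ≡ L → 4 * θ ≤ T →
                         n ≤ 2 * κ * size (S !_) → 8 * κ * L ≤ n → G ≡ 1024 * (κ * κ) → 64 * (κ * κ) ≤ n →
                         n * n ≤ 64 * (κ * κ) * pair-count (AllAbove? θ)
      large-pair-count κ θ |E| |E′| 4θ≤T |S| 8κL≤n refl κ²≤n = *-cancelˡ-≤ 2 (+-cancelʳ-≤ (2 * (n * n)) _ _ (begin
        2 * (n * n) + 2 * (n * n) ≡⟨ lem₁ (n * n) ⟩
        4 * (n * n) ≤⟨ *-monoʳ-≤ 4 (*-mono-≤ n≤4κσ n≤4κσ) ⟩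
        4 * (4 * κ * σ * (4 * κ * σ)) ≡⟨ lem₂ κ σ ⟩
        64 * (κ * κ) * (σ * σ) ≤⟨ *-monoʳ-≤ (64 * (κ * κ)) most ⟩
        64 * (κ * κ) * (2 * Y + n + (Z + Z) + (Z′ + Z′)) ≡⟨ lem₃ (κ * κ) Y n Z Z′ ⟩
        2 * (64 * (κ * κ) * Y) + 64 * (κ * κ) * n + 128 * (κ * κ) * (Z + Z′) ≤⟨ +-mono-≤ (+-monoʳ-≤ (2 * (64 * (κ * κ) * Y)) (*-monoˡ-≤ n κ²≤n)) dev ⟩
        2 * (64 * (κ * κ) * Y) + n * n + n * n ≡⟨ lem₄ (2 * (64 * (κ * κ) * Y)) (n * n) ⟩
        2 * (64 * (κ * κ) * Y) + 2 * (n * n) ∎))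
        where
        open ≤-Reasoning
        Y Z Z′ : ℕ
        Y = pair-count (AllAbove? θ)
        Z = ∑₂ (λ a b → [ Dev? E a b ])
        Z′ = ∑₂ (λ a b → [ Dev? E′ a b ])
        lem₁ : ∀ u → 2 * u + 2 * u ≡ 4 * u
        lem₁ = solve-∀
        lem₂ : ∀ κ σ → 4 * (4 * κ * σ * (4 * κ * σ)) ≡ 64 * (κ * κ) * (σ * σ)
        lem₂ = solve-∀
        lem₃ : ∀ q Y n Z Z′ → 64 * q * (2 * Y + n + (Z + Z) + (Z′ + Z′)) ≡ 2 * (64 * q * Y) + 64 * q * n + 128 * q * (Z + Z′)
        lem₃ = solve-∀
        lem₄ : ∀ u v → u + v + v ≡ u + 2 * v
        lem₄ = solve-∀
        n≤4κσ : n ≤ 4 * κ * σ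
        n≤4κσ = +-cancelʳ-≤ n _ _ (begin
          n + n ≡⟨ cong (n +_) (sym (+-identityʳ n)) ⟩
          2 * n ≤⟨ *-monoʳ-≤ 2 |S| ⟩
          2 * (2 * κ * size (S !_)) ≤⟨ *-monoʳ-≤ 2 (*-monoʳ-≤ (2 * κ) (≤-trans (remaining-size E E′ S) (≤-reflexive (cong (σ +_) (cong₂ _+_ |E| |E′|))))) ⟩
          2 * (2 * κ * (σ + (L + L))) ≡⟨ lem κ σ L ⟩
          4 * κ * σ + 8 * κ * L ≤⟨ +-monoʳ-≤ (4 * κ * σ) 8κL≤n ⟩
          4 * κ * σ + n ∎)
          where
          lem : ∀ κ σ L → 2 * (2 * κ * (σ + (L + L))) ≡ 4 * κ * σ + 8 * κ * L
          lem = solve-∀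
        dev : 128 * (κ * κ) * (Z + Z′) ≤ n * n
        dev = *-cancelˡ-≤ 8 (begin
          8 * (128 * (κ * κ) * (Z + Z′)) ≡⟨ lem (κ * κ) Z Z′ ⟩
          G * Z + G * Z′ ≤⟨ +-mono-≤ (few-deviations E |E|) (few-deviations E′ |E′|) ⟩
          4 * (n * n) + 4 * (n * n) ≡⟨ lem′ (n * n) ⟩
          8 * (n * n) ∎)
          where
          lem : ∀ q Z Z′ → 8 * (128 * q * (Z + Z′)) ≡ 1024 * q * Z + 1024 * q * Z′
          lem = solve-∀
          lem′ : ∀ u → 4 * u + 4 * u ≡ 8 * u
          lem′ = solve-∀
        most : σ * σ ≤ 2 * Y + n + (Z + Z) + (Z′ + Z′)
        most = begin
          σ * σ ≡⟨ square ⟩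
          ∑₂ (λ a b → ⟦ R a ⟧ * ⟦ R b ⟧) ≤⟨ ∑₂-mono each ⟩
          ∑₂ (λ a b → [ W? a b ] + ([ Dev? E a b ] + [ Dev? E b a ]) + ([ Dev? E′ a b ] + [ Dev? E′ b a ]))
                                                    ≡⟨ trans (∑₂-+ _ _) (cong₂ _+_ (trans (∑₂-+ _ _) (cong (∑₂ (λ a b → [ W? a b ]) +_) (dup E))) (dup E′)) ⟩
          ∑₂ (λ a b → [ W? a b ]) + (Z + Z) + (Z′ + Z′) ≤⟨ +-monoˡ-≤ (Z′ + Z′) (+-monoˡ-≤ (Z + Z) (ordered (AllAbove? θ) (λ { _ _ _ _ ((p , q) , (r , s)) → (q , p) , (s , r) }))) ⟩
          2 * Y + n + (Z + Z) + (Z′ + Z′) ∎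
          where
          W? = λ a b → both? a b ×-dec Switchable (AllAbove? θ) a b
          dup : ∀ F → ∑₂ (λ a b → [ Dev? F a b ] + [ Dev? F b a ]) ≡ ∑₂ (λ a b → [ Dev? F a b ]) + ∑₂ (λ a b → [ Dev? F a b ])
          dup F = trans (∑₂-+ _ _) (cong (∑₂ (λ a b → [ Dev? F a b ]) +_) (∑₂-swap (λ a b → [ Dev? F b a ])))
          low : ∀ F a b → ¬ Dev F a b → θ ≤ e (F !_) (M ! a) (M ! b)
          low F a b nd = *-cancelˡ-≤ 4 (≤-trans 4θ≤T (typical-low _ nd))
          each : ∀ a b → ⟦ R a ⟧ * ⟦ R b ⟧ ≤ [ W? a b ] + ([ Dev? E a b ] + [ Dev? E b a ]) + ([ Dev? E′ a b ] + [ Dev? E′ b a ])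
          each a b = go (R a) (R b)
            where
            go : ∀ p q → ⟦ p ⟧ * ⟦ q ⟧ ≤ [ ((p ≟B true) ×-dec (q ≟B true)) ×-dec Switchable (AllAbove? θ) a b ] +
                                         ([ Dev? E a b ] + [ Dev? E b a ]) + ([ Dev? E′ a b ] + [ Dev? E′ b a ])
            go false q = z≤n
            go true false = z≤n
            go true true = cover₄ (((true ≟B true) ×-dec (true ≟B true)) ×-dec Switchable (AllAbove? θ) a b)
                                    (Dev? E a b) (Dev? E b a) (Dev? E′ a b) (Dev? E′ b a)
                                    (λ n₁ n₂ n₃ n₄ → (refl , refl) , ((low E a b n₁ , low E b a n₂) , (low E′ a b n₃ , low E′ b a n₄)))

      -- A vertex u ∈ E adjacent to a is non-adjacent to all but d of the vertices b.
      moderate-pair-count : ∀ c → 1 ≤ c → size (E !_) ≤ L → size (E′ !_) ≡ L → 4 ≤ T →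
                            (∀ j → S ! j ≡ true → dg (E !_) (M ! j) ≡ c) → n ≤ size (S !_) + 2 * L →
                            32 * L ≤ n → 2 * d ≤ n → 1024 ≤ G → 64 ≤ n →
                            n * n ≤ 16 * pair-count (Moderate? (2 * suc T))
      moderate-pair-count c 1≤c |E| |E′| 4≤T const |S| 32L≤n 2d≤n 1024≤G 64≤n =
        -- At least `7n/8` vertices remain, and after the `d` neighbours of the chosen `u` still at
        -- least `3n/8` candidates for `b`. The deviating pairs and the diagonal are then small.
        *-cancelˡ-≤ 16 (+-cancelʳ-≤ (26 * (n * n)) _ _ (begin
          16 * (n * n) + 26 * (n * n) ≡⟨ lem₁ n ⟩
          2 * (7 * n * (3 * n)) ≤⟨ *-monoʳ-≤ 2 (*-mono-≤ 7n≤8σ 3n≤8δ) ⟩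
          2 * (8 * σ * (8 * δ)) ≡⟨ lem₂ σ δ ⟩
          128 * (σ * δ) ≤⟨ *-monoʳ-≤ 128 (≤-trans (≤-reflexive (*-distribˡ-∸ σ σ d)) (m≤n+o⇒m∸n≤o (σ * σ) (σ * d) most)) ⟩
          128 * (2 * Y + n + (Z′ + Z′)) ≡⟨ lem₃ Y n Z′ ⟩
          16 * (16 * Y) + (2 * (64 * n) + 256 * Z′) ≤⟨ +-monoʳ-≤ (16 * (16 * Y)) (+-mono-≤ (*-monoʳ-≤ 2 (*-monoˡ-≤ n 64≤n)) dev) ⟩
          16 * (16 * Y) + (2 * (n * n) + n * n) ≤⟨ +-monoʳ-≤ (16 * (16 * Y)) (≤-trans (m≤m+n _ (23 * (n * n))) (≤-reflexive (lem₄ (n * n)))) ⟩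
          16 * (16 * Y) + 26 * (n * n) ∎))
        where
        open ≤-Reasoning
        β δ Y Z′ : ℕ
        β = 2 * suc T
        δ = σ ∸ d
        Y = pair-count (Moderate? β)
        Z′ = ∑₂ (λ a b → [ Dev? E′ a b ])
        lem₁ : ∀ n → 16 * (n * n) + 26 * (n * n) ≡ 2 * (7 * n * (3 * n))
        lem₁ = solve-∀
        lem₂ : ∀ σ δ → 2 * (8 * σ * (8 * δ)) ≡ 128 * (σ * δ)
        lem₂ = solve-∀
        lem₃ : ∀ Y n Z′ → 128 * (2 * Y + n + (Z′ + Z′)) ≡ 16 * (16 * Y) + (2 * (64 * n) + 256 * Z′)
        lem₃ = solve-∀
        lem₄ : ∀ u → 2 * u + u + 23 * u ≡ 26 * u
        lem₄ = solve-∀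
        7n≤8σ : 7 * n ≤ 8 * σ
        7n≤8σ = +-cancelʳ-≤ n _ _ (begin
          7 * n + n ≡⟨ +-comm (7 * n) n ⟩
          8 * n ≤⟨ *-monoʳ-≤ 8 (≤-trans |S| (+-monoˡ-≤ (2 * L) (≤-trans (remaining-size E E′ S) (+-monoʳ-≤ σ (+-mono-≤ |E| (≤-reflexive |E′|)))))) ⟩
          8 * (σ + (L + L) + 2 * L) ≡⟨ lem σ L ⟩
          8 * σ + 32 * L ≤⟨ +-monoʳ-≤ (8 * σ) 32L≤n ⟩
          8 * σ + n ∎)
          where
          lem : ∀ σ L → 8 * (σ + (L + L) + 2 * L) ≡ 8 * σ + 32 * L
          lem = solve-∀
        3n≤8δ : 3 * n ≤ 8 * δ
        3n≤8δ = +-cancelʳ-≤ (4 * n) _ _ (begin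
          3 * n + 4 * n ≡⟨ sym (*-distribʳ-+ n 3 4) ⟩
          7 * n ≤⟨ 7n≤8σ ⟩
          8 * σ ≤⟨ *-monoʳ-≤ 8 (≤-trans (m≤n+m∸n σ d) (≤-reflexive (+-comm d δ))) ⟩
          8 * (δ + d) ≡⟨ lem δ d ⟩
          8 * δ + 4 * (2 * d) ≤⟨ +-monoʳ-≤ (8 * δ) (*-monoʳ-≤ 4 2d≤n) ⟩
          8 * δ + 4 * n ∎)
          where
          lem : ∀ δ d → 8 * (δ + d) ≡ 8 * δ + 4 * (2 * d)
          lem = solve-∀
        dev : 256 * Z′ ≤ n * n
        dev = *-cancelˡ-≤ 4 (begin
          4 * (256 * Z′) ≡⟨ sym (*-assoc 4 256 Z′) ⟩
          1024 * Z′ ≤⟨ *-monoˡ-≤ Z′ 1024≤G ⟩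
          G * Z′ ≤⟨ few-deviations E′ |E′| ⟩
          4 * (n * n) ∎)
        -- Edges between `S` and `E` are counted twice: `c |S| ≤ |E| d ≤ (T + 1) n`, and `S`
        -- contains at least half of the vertices.
        c≤β : c ≤ β
        c≤β = *-cancelˡ-≤ n {{>-nonZero 1≤n}} (begin
          n * c ≤⟨ *-monoˡ-≤ c n≤2S ⟩
          2 * size (S !_) * c ≡⟨ trans (*-assoc 2 (size (S !_)) c) (cong (2 *_) (sym (sum-*ʳ c (λ j → ⟦ S ! j ⟧)))) ⟩
          2 * ∑ (λ j → ⟦ S ! j ⟧ * c) ≤⟨ *-monoʳ-≤ 2 (sum-mono each) ⟩
          2 * ∑ (λ j → dg (E !_) (M ! j)) ≡⟨ cong (2 *_) degree-sum ⟩
          2 * (size (E !_) * d) ≤⟨ *-monoʳ-≤ 2 (≤-trans (*-monoˡ-≤ d |E|) highL) ⟩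
          2 * (suc T * n) ≡⟨ trans (sym (*-assoc 2 (suc T) n)) (*-comm β n) ⟩
          n * β ∎)
          where
          n≤2S : n ≤ 2 * size (S !_)
          n≤2S = +-cancelʳ-≤ n _ _ (begin
            n + n ≡⟨ cong (n +_) (sym (+-identityʳ n)) ⟩
            2 * n ≤⟨ *-monoʳ-≤ 2 |S| ⟩
            2 * (size (S !_) + 2 * L) ≡⟨ lem (size (S !_)) L ⟩
            2 * size (S !_) + 4 * L ≤⟨ +-monoʳ-≤ (2 * size (S !_)) (≤-trans (*-monoˡ-≤ L {4} {32} (m≤m+n 4 28)) 32L≤n) ⟩
            2 * size (S !_) + n ∎)
            where
            lem : ∀ s L → 2 * (s + 2 * L) ≡ 2 * s + 4 * L
            lem = solve-∀
          each : ∀ j → ⟦ S ! j ⟧ * c ≤ dg (E !_) (M ! j)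
          each j with S ! j in eqn
          ... | false = z≤n
          ... | true = ≤-reflexive (trans (+-identityʳ c) (sym (const j eqn)))
          degree-sum : ∑ (λ j → dg (E !_) (M ! j)) ≡ size (E !_) * d
          degree-sum = trans (sum-comm (λ j x → ⟦ (E ! x) ∧ (M ! j ! x) ⟧))
            (trans (sum-cong (λ x → trans (sum-cong (λ j → trans (⟦⟧-∧ (E ! x) (M ! j ! x)) (cong (λ b → ⟦ E ! x ⟧ * ⟦ b ⟧) (proj₁ reg j x))))
                                   (trans (sum-*ˡ ⟦ E ! x ⟧ (λ j → ⟦ M ! x ! j ⟧)) (cong (⟦ E ! x ⟧ *_) (proj₂ (proj₂ reg) x)))))
                   (sum-*ʳ d (λ x → ⟦ E ! x ⟧)))
        W? = λ a b → both? a b ×-dec Switchable (Moderate? β) a b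
        most : σ * σ ≤ σ * d + (2 * Y + n + (Z′ + Z′))
        most = begin
          σ * σ ≡⟨ square ⟩
          ∑₂ (λ a b → ⟦ R a ⟧ * ⟦ R b ⟧) ≤⟨ sum-mono row ⟩
          ∑ (λ a → ⟦ R a ⟧ * d + ∑ (λ b → [ W? a b ] + ([ Dev? E′ a b ] + [ Dev? E′ b a ])))
                                                                          ≡⟨ trans (sum-+ _ _) (cong₂ _+_ (sum-*ʳ d _) (trans (∑₂-+ _ _) (cong (∑₂ (λ a b → [ W? a b ]) +_)
                                                                               (trans (∑₂-+ _ _) (cong (Z′ +_) (∑₂-swap (λ a b → [ Dev? E′ b a ]))))))) ⟩
          σ * d + (∑₂ (λ a b → [ W? a b ]) + (Z′ + Z′)) ≤⟨ +-monoʳ-≤ (σ * d) (+-monoˡ-≤ (Z′ + Z′) (ordered (Moderate? β) swap)) ⟩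
          σ * d + (2 * Y + n + (Z′ + Z′)) ∎
          where
          swap : ∀ t₁ t₂ t₃ t₄ → Moderate β t₁ t₂ t₃ t₄ → Moderate β t₂ t₁ t₄ t₃
          swap _ _ _ _ (((p , q) , (r , s)) , ((p′ , q′) , (r′ , s′))) = ((q , p) , (s , r)) , ((q′ , p′) , (s′ , r′))
          R→S : ∀ {a} → R a ≡ true → S ! a ≡ true
          R→S h = proj₁ (∧-true h)
          moderate : ∀ a b u → R a ≡ true → R b ≡ true → E ! u ≡ true → M ! a ! u ≡ true → M ! b ! u ≡ false →
                     ¬ Dev E′ a b → ¬ Dev E′ b a →
                     Moderate β (e (E !_) (M ! a) (M ! b)) (e (E !_) (M ! b) (M ! a)) (e (E′ !_) (M ! a) (M ! b)) (e (E′ !_) (M ! b) (M ! a))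
          moderate a b u Ra Rb Eu au bu nd nd′ =
            ((one , ≤-trans one (≤-reflexive same)) , (low _ nd , low _ nd′)) ,
            ((upper a b Ra , upper b a Rb) , (typical-high _ nd , typical-high _ nd′))
            where
            -- Equal degrees `c` make the two differences on `E` equal, so the single witness `u`
            -- bounds both from below.
            same : e (E !_) (M ! a) (M ! b) ≡ e (E !_) (M ! b) (M ! a)
            same = e-balanced (E !_) (M ! a) (M ! b) (trans (const a (R→S Ra)) (sym (const b (R→S Rb))))
            one : 1 ≤ e (E !_) (M ! a) (M ! b)
            one = ≤-trans (≤-reflexive (sym (cong ⟦_⟧ (∧-intro Eu (∧-intro au (not-false bu)))))) (sum-elem (λ j → ⟦ (E ! j) ∧ ((M ! a ! j) ∧ not (M ! b ! j)) ⟧) u)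
            low : ∀ x → ¬ Deviates {n} A x → 1 ≤ x
            low x nd = *-cancelˡ-≤ 4 (≤-trans 4≤T (typical-low x nd))
            upper : ∀ a b → R a ≡ true → e (E !_) (M ! a) (M ! b) ≤ β
            upper a b Ra = ≤-trans (e≤dg (E !_) (M ! a) (M ! b)) (≤-trans (≤-reflexive (const a (R→S Ra))) c≤β)
          row : ∀ a → ∑ (λ b → ⟦ R a ⟧ * ⟦ R b ⟧) ≤ ⟦ R a ⟧ * d + ∑ (λ b → [ W? a b ] + ([ Dev? E′ a b ] + [ Dev? E′ b a ]))
          row a = go (R a) refl
            where
            go : ∀ p → R a ≡ p → ∑ (λ b → ⟦ p ⟧ * ⟦ R b ⟧) ≤ ⟦ p ⟧ * d + ∑ (λ b → [ W? a b ] + ([ Dev? E′ a b ] + [ Dev? E′ b a ]))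
            go false _ = ≤-trans (≤-reflexive (sum-zero (λ b → refl))) z≤n
            go true Ra with sum-pos (λ u → ⟦ (E ! u) ∧ (M ! a ! u) ⟧) (≤-trans 1≤c (≤-reflexive (sym (const a (R→S Ra)))))
            ... | u , pos = begin
              ∑ (λ b → 1 * ⟦ R b ⟧) ≤⟨ sum-mono each ⟩
              ∑ (λ b → ⟦ M ! u ! b ⟧ + ([ W? a b ] + ([ Dev? E′ a b ] + [ Dev? E′ b a ]))) ≡⟨ trans (sum-+ _ _) (cong (_+ ∑ (λ b → [ W? a b ] + ([ Dev? E′ a b ] + [ Dev? E′ b a ]))) (proj₂ (proj₂ reg) u)) ⟩
              d + ∑ (λ b → [ W? a b ] + ([ Dev? E′ a b ] + [ Dev? E′ b a ])) ≡⟨ cong (_+ ∑ (λ b → [ W? a b ] + ([ Dev? E′ a b ] + [ Dev? E′ b a ]))) (sym (*-identityˡ d)) ⟩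
              1 * d + ∑ (λ b → [ W? a b ] + ([ Dev? E′ a b ] + [ Dev? E′ b a ])) ∎
              where
              Eu : E ! u ≡ true
              Eu = proj₁ (∧-true (⟦⟧-elim pos))
              au : M ! a ! u ≡ true
              au = proj₂ (∧-true {E ! u} (⟦⟧-elim pos))
              each : ∀ b → 1 * ⟦ R b ⟧ ≤ ⟦ M ! u ! b ⟧ + ([ W? a b ] + ([ Dev? E′ a b ] + [ Dev? E′ b a ]))
              each b = case′ (R b) (M ! u ! b) refl refl (Dev? E′ a b) (Dev? E′ b a)
                where
                case′ : ∀ p q → R b ≡ p → M ! u ! b ≡ q → (d₁ : Dec (Dev E′ a b)) (d₂ : Dec (Dev E′ b a)) →
                        1 * ⟦ p ⟧ ≤ ⟦ q ⟧ + ([ W? a b ] + ([ d₁ ] + [ d₂ ]))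
                case′ false q _ _ _ _ = z≤n
                case′ true true _ _ _ _ = s≤s z≤n
                case′ true false Rb ub (yes _) d₂ = ≤-trans (m≤m+n 1 [ d₂ ]) (m≤n+m (1 + [ d₂ ]) [ W? a b ])
                case′ true false Rb ub (no _) (yes _) = m≤n+m 1 [ W? a b ]
                case′ true false Rb ub (no nd) (no nd′) = ≤-trans (≤-reflexive (sym ([]-true (W? a b)
                  ((Ra , Rb) , moderate a b u Ra Rb Eu au (trans (proj₁ reg b u) ub) nd nd′)))) (m≤m+n [ W? a b ] 0)

-- Colour refinement

allB-elim : ∀ {n} (f : Fin n → Bool) → allB f ≡ true → ∀ i → f i ≡ true
allB-elim f h zero = proj₁ (∧-true h)
allB-elim f h (suc i) = allB-elim (f ∘ suc) (proj₂ (∧-true {f zero} h)) i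

allB-intro : ∀ {n} (f : Fin n → Bool) → (∀ i → f i ≡ true) → allB f ≡ true
allB-intro {zero} f h = refl
allB-intro {suc n} f h = ∧-intro (h zero) (allB-intro (f ∘ suc) (h ∘ suc))

≡ᵇ-elim : ∀ m n → (m ≡ᵇ n) ≡ true → m ≡ n
≡ᵇ-elim m n h = ≡ᵇ⇒≡ m n (subst Data.Bool.T (sym h) tt)

≡ᵇ-intro : ∀ m n → m ≡ n → (m ≡ᵇ n) ≡ true
≡ᵇ-intro zero .zero refl = refl
≡ᵇ-intro (suc m) .(suc m) refl = ≡ᵇ-intro m m refl

==B-elim : ∀ a b → (a ==B b) ≡ true → a ≡ b
==B-elim true true _ = refl
==B-elim false false _ = refl

==B-refl : ∀ a → (a ==B a) ≡ true
==B-refl true = refl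
==B-refl false = refl

module Refinement {n : ℕ} (G : Graph n) (part : Fin n → Bool) where

  same : ℕ → Fin n → Fin n → Bool
  same = sameColour G part

  into : ℕ → Fin n → Fin n → ℕ
  into t v u = countTrue (λ x → G v x ∧ same t x u)

  same-elim : ∀ {t v w} → same (suc t) v w ≡ true → (same t v w ≡ true) × (∀ u → into t v u ≡ into t w u)
  same-elim {t} {v} {w} h = proj₁ (∧-true h) , λ u → ≡ᵇ-elim _ _ (allB-elim _ (proj₂ (∧-true {same t v w} h)) u)

  same-intro : ∀ {t v w} → same t v w ≡ true → (∀ u → into t v u ≡ into t w u) → same (suc t) v w ≡ true
  same-intro h k = ∧-intro h (allB-intro _ (λ u → ≡ᵇ-intro _ _ (k u)))

  same-refl : ∀ t v → same t v v ≡ true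
  same-refl zero v = ==B-refl (part v)
  same-refl (suc t) v = same-intro {t} (same-refl t v) (λ u → refl)

  same-sym : ∀ t {v w} → same t v w ≡ true → same t w v ≡ true
  same-sym zero {v} {w} h = subst (λ z → (part w ==B z) ≡ true) (sym (==B-elim (part v) (part w) h)) (==B-refl (part w))
  same-sym (suc t) h with same-elim {t} h
  ... | s , k = same-intro {t} (same-sym t s) (λ u → sym (k u))

  same-trans : ∀ t {u v w} → same t u v ≡ true → same t v w ≡ true → same t u w ≡ true
  same-trans zero {u} {v} {w} h k = subst (λ z → (part u ==B z) ≡ true) (==B-elim (part v) (part w) k) h
  same-trans (suc t) h k with same-elim {t} h | same-elim {t} k
  ... | s , p | s′ , p′ = same-intro {t} (same-trans t s s′) (λ u → trans (p u) (p′ u))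

  same-cong : ∀ t {x y} u → same t x y ≡ true → same t x u ≡ same t y u
  same-cong t {x} {y} u h with same t x u in p | same t y u in q
  ... | true | true = refl
  ... | false | false = refl
  ... | true | false = ⊥-elim (true≢false (same-trans t (same-sym t h) p) q)
  ... | false | true = ⊥-elim (true≢false (same-trans t h q) p)

first : ∀ {n} → (Fin n → Bool) → ℕ
first {zero} f = 0
first {suc n} f = if f zero then 0 else suc (first (f ∘ suc))

first-cong : ∀ {n} {f g : Fin n → Bool} → (∀ i → f i ≡ g i) → first f ≡ first g
first-cong {zero} h = refl
first-cong {suc n} {f} {g} h rewrite h zero | first-cong {n} {f ∘ suc} {g ∘ suc} (h ∘ suc) = refl

first-true : ∀ {n} (f : Fin n → Bool) i → f i ≡ true → ∃[ j ] (f j ≡ true × toℕ j ≡ first f)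
first-true {suc n} f i h with f zero in eqn
... | true = zero , eqn , refl
first-true {suc n} f zero h | false = ⊥-elim (true≢false h eqn)
first-true {suc n} f (suc i) h | false with first-true (f ∘ suc) i h
... | j , fj , e = suc j , fj , cong suc e

module _ {n : ℕ} (G : Graph n) (part : Fin n → Bool) where

  open Refinement G part

  -- The least vertex of a class serves as its name, because colours are available only as an
  -- equivalence relation.
  leader : ℕ → Fin n → ℕ
  leader t x = first (same t x)

  leader-cong : ∀ t {x y} → same t x y ≡ true → leader t x ≡ leader t y
  leader-cong t h = first-cong (λ u → same-cong t u h)

  leader-vertex : ∀ t x → ∃[ j ] (same t x j ≡ true × toℕ j ≡ leader t x)
  leader-vertex t x = first-true (same t x) x (same-refl t x)

  Respects : ℕ → (Fin n → Bool) → Set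
  Respects t D = ∀ x y → same t x y ≡ true → D x ≡ D y

  -- Summing over one representative u of each class turns degrees into D into sums of degrees into classes.
  degree-refined : ∀ t D → Respects t D → ∀ v w → same (suc t) v w ≡ true →
                   ∑ (λ x → ⟦ D x ∧ G v x ⟧) ≡ ∑ (λ x → ⟦ D x ∧ G w x ⟧)
  degree-refined t D resp v w h = trans (expand v) (trans (sum-cong (λ u → cong (weight u *_) (count-eq u))) (sym (expand w)))
    where
    rep? : ∀ u → Dec (leader t u ≡ toℕ u)
    rep? u = leader t u ≟ℕ toℕ u
    weight : Fin n → ℕ
    weight u = ⟦ D u ⟧ * [ rep? u ]
    count-eq : ∀ u → ∑ (λ x → ⟦ G v x ∧ same t x u ⟧) ≡ ∑ (λ x → ⟦ G w x ∧ same t x u ⟧)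
    count-eq u = trans (sym (countTrue≡∑ (λ x → G v x ∧ same t x u)))
                (trans (proj₂ (same-elim {t} h) u) (countTrue≡∑ (λ x → G w x ∧ same t x u)))
    expand : ∀ v → ∑ (λ x → ⟦ D x ∧ G v x ⟧) ≡ ∑ (λ u → weight u * ∑ (λ x → ⟦ G v x ∧ same t x u ⟧))
    expand v = begin
      ∑ (λ x → ⟦ D x ∧ G v x ⟧) ≡⟨ sum-cong (λ x → trans (⟦⟧-∧ (D x) (G v x)) (pick x)) ⟩
      ∑ (λ x → ∑ (λ u → weight u * ⟦ G v x ∧ same t x u ⟧)) ≡⟨ sum-comm _ ⟩
      ∑ (λ u → ∑ (λ x → weight u * ⟦ G v x ∧ same t x u ⟧)) ≡⟨ sum-cong (λ u → sum-*ˡ (weight u) _) ⟩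
      ∑ (λ u → weight u * ∑ (λ x → ⟦ G v x ∧ same t x u ⟧)) ∎
      where
      open ≡-Reasoning
      pick : ∀ x → ⟦ D x ⟧ * ⟦ G v x ⟧ ≡ ∑ (λ u → weight u * ⟦ G v x ∧ same t x u ⟧)
      pick x with leader-vertex t x
      ... | l , xl , e = sym (trans (sum-cong only) (sum-δ (λ u → ⟦ D x ⟧ * ⟦ G v x ⟧) l))
        where
        lrep : leader t l ≡ toℕ l
        lrep = trans (sym (leader-cong t xl)) (sym e)
        only : ∀ u → weight u * ⟦ G v x ∧ same t x u ⟧ ≡ [ u ≟F l ] * (⟦ D x ⟧ * ⟦ G v x ⟧)
        only u with u ≟F l
        ... | yes refl = trans (cong₂ _*_ (cong₂ _*_ (cong ⟦_⟧ (sym (resp x u xl))) ([]-true (rep? u) lrep))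
                                          (trans (⟦⟧-∧ (G v x) (same t x u)) (cong (λ b → ⟦ G v x ⟧ * ⟦ b ⟧) xl)))
                               (lem ⟦ D x ⟧ ⟦ G v x ⟧)
          where
          lem : ∀ p q → p * 1 * (q * 1) ≡ p * q + 0
          lem = solve-∀
        ... | no u≢l = go (rep? u) (same t x u) refl
          where
          go : (r : Dec (leader t u ≡ toℕ u)) (b : Bool) → same t x u ≡ b → ⟦ D u ⟧ * [ r ] * ⟦ G v x ∧ b ⟧ ≡ 0
          go (no _) b _ = cong (_* ⟦ G v x ∧ b ⟧) (*-zeroʳ ⟦ D u ⟧)
          go (yes _) false _ = trans (cong (⟦ D u ⟧ * 1 *_) (trans (⟦⟧-∧ (G v x) false) (*-zeroʳ ⟦ G v x ⟧))) (*-zeroʳ (⟦ D u ⟧ * 1))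
          go (yes rep) true xu = ⊥-elim (u≢l (toℕ-injective (trans (sym rep) (trans (sym (leader-cong t xu)) (sym e)))))

size-suc : ∀ {n} (f : Fin (suc n) → Bool) → size f ≡ ⟦ f zero ⟧ + size (f ∘ suc)
size-suc f = sum-suc (λ j → ⟦ f j ⟧)

subset : ∀ {n} (f : Fin n → Bool) L → L ≤ size f → ∃[ g ] ((∀ j → g j ≡ true → f j ≡ true) × size g ≡ L)
subset {n} f zero h = (λ _ → false) , (λ j ()) , sum-zero {n} (λ _ → refl)
subset {zero} f (suc L) h = ⊥-elim (<⇒≱ h (≤-trans (≤-reflexive (sum-zero {f = λ j → ⟦ f j ⟧} (λ ()))) z≤n))
subset {suc n} f (suc L) h with f zero in eqn
... | true with subset (f ∘ suc) L (s≤s⁻¹ (≤-trans h (≤-reflexive (trans (size-suc f) (cong (λ b → ⟦ b ⟧ + size (f ∘ suc)) eqn)))))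
... | g , sub , sz = (λ { zero → true ; (suc j) → g j }) , (λ { zero _ → eqn ; (suc j) gj → sub j gj }) , trans (size-suc _) (cong suc sz)
subset {suc n} f (suc L) h | false with subset (f ∘ suc) (suc L) (≤-trans h (≤-reflexive (trans (size-suc f) (cong (λ b → ⟦ b ⟧ + size (f ∘ suc)) eqn))))
... | g , sub , sz = (λ { zero → false ; (suc j) → g j }) , (λ { zero () ; (suc j) gj → sub j gj }) , trans (size-suc _) sz

size-not : ∀ {n} (f : Fin n → Bool) → size f + size (not ∘ f) ≡ n
size-not {n} f = trans (sym (sum-+ _ _)) (trans (sum-cong (λ j → lem (f j))) (trans (sum-const n 1) (*-identityʳ n)))
  where
  lem : ∀ b → ⟦ b ⟧ + ⟦ not b ⟧ ≡ 1
  lem true = refl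
  lem false = refl

size≤n : ∀ {n} (f : Fin n → Bool) → size f ≤ n
size≤n f = ≤-trans (m≤m+n _ _) (≤-reflexive (size-not f))

-- Sizes of colour classes

crossing : (f : ℕ → ℕ) (θ b : ℕ) → θ < f 0 → f b ≤ θ → ∃[ j ] (j < b × θ < f j × f (suc j) ≤ θ)
crossing f θ zero h k = ⊥-elim (<⇒≱ h k)
crossing f θ (suc b) h k with f b ≤? θ
... | no ¬p = b , ≤-refl , ≰⇒> ¬p , k
... | yes p with crossing f θ b h p
... | j , j<b , q , r = j , m<n⇒m<1+n j<b , q , r

tabulate-at : ∀ {n} (f : Fin n → Bool) j → tabulate f ! j ≡ f j
tabulate-at f j = lookup∘tabulate f j

size-tabulate : ∀ {n} (f : Fin n → Bool) → size (tabulate f !_) ≡ size f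
size-tabulate f = sum-cong (λ j → cong ⟦_⟧ (tabulate-at f j))

dg-tabulate : ∀ {n} (f : Fin n → Bool) (r : Row n) → dg (tabulate f !_) r ≡ dg f r
dg-tabulate f r = sum-cong (λ j → cong (λ b → ⟦ b ∧ r ! j ⟧) (tabulate-at f j))

dg≤n : ∀ {n} (D : Fin n → Bool) (r : Row n) → dg D r ≤ n
dg≤n D r = size≤n (λ j → D j ∧ r ! j)

graph : ∀ {n} → VG n → Graph n
graph M i j = M ! i ! j

-- From here on `M` is fixed and the argument is deterministic. Randomness enters only through
-- `codegrees` and the exclusion of rigid configurations in `not-rigid` and `not-rigid′`.
module Refined {n N : ℕ} (ω : Fin N → VG n) (once : ∀ M → ∑ (λ i → [ ω i ≟G M ]) ≡ 1)
  (d k : ℕ) (d+m≡n : d + (d + k) ≡ n) (M : VG n) (reg : Reg d M) (1≤n : 1 ≤ n)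
  (cod G T L : ℕ) (1≤G : 1 ≤ G) (4G≤T : 4 * G ≤ T) (lowL : T * n ≤ L * d) (highL : L * d ≤ suc T * n)
  (small : 6 * G * (n * cod) ≤ suc (6 * G) * (d * d))
  (codegrees : ∀ x y → ¬ x ≡ y → codeg M x y ≤ cod)
  (κ θ s : ℕ) (1≤κ : 1 ≤ κ) (G-def : G ≡ 1024 * (κ * κ)) (4θ≤T : 4 * θ ≤ T) (32κL≤n : 32 * κ * L ≤ n) (κ²≤n : 64 * (κ * κ) ≤ n)
  (s-small : 256 * (κ * κ) * s ≤ n) (L≤d : L ≤ d) (1≤L : 1 ≤ L)
  (not-rigid : ∀ E E′ D S c r → c < suc n → r < 2 * n → ¬ Events.Rigid ω once d (AllAbove? θ) E E′ D S c r s M)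
  (not-rigid′ : ∀ E E′ S c r → size (E !_) ≤ L → size (E′ !_) ≤ L → size (not ∘ (S !_)) ≤ 2 * L → c < suc n → r < 2 * n →
                ¬ Events.Rigid ω once d (Moderate? (2 * suc T)) E E′ E S c r s M) where

  open Dense d k d+m≡n M reg 1≤n cod G T L 1≤G 4G≤T lowL highL small codegrees
  open Events ω once d

  -- The pairs are shared among `2 * n` matchings, so more than `2 * n * s` of them guarantee `s` in
  -- a single matching.
  enough-pairs : ∀ Y → n * n ≤ 64 * (κ * κ) * Y → 2 * n * s < Y
  enough-pairs Y h = *-cancelˡ-< (128 * (κ * κ)) _ _ (begin-strict
    128 * (κ * κ) * (2 * n * s) ≡⟨ lem₁ (κ * κ) n s ⟩
    256 * (κ * κ) * s * n ≤⟨ *-monoˡ-≤ n s-small ⟩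
    n * n <⟨ m<m+n (n * n) (*-mono-≤ 1≤n 1≤n) ⟩
    n * n + n * n ≤⟨ +-mono-≤ h h ⟩
    64 * (κ * κ) * Y + 64 * (κ * κ) * Y ≡⟨ lem₂ (κ * κ) Y ⟩
    128 * (κ * κ) * Y ∎)
    where
    open ≤-Reasoning
    lem₁ : ∀ q n s → 128 * q * (2 * n * s) ≡ 256 * q * s * n
    lem₁ = solve-∀
    lem₂ : ∀ q Y → 64 * q * Y + 64 * q * Y ≡ 128 * q * Y
    lem₂ = solve-∀

  1≤κ² : 1 ≤ κ * κ
  1≤κ² = *-mono-≤ 1≤κ 1≤κ

  32L≤n : 32 * L ≤ n
  32L≤n = ≤-trans (*-monoˡ-≤ L (*-monoʳ-≤ 32 1≤κ)) 32κL≤n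

  -- If `S` were large, sets of size `L` inside and outside `D` would still leave most of it. Many
  -- pairs there differ in at least `θ` places on both sets, in both directions, and one matching of
  -- them contradicts `not-rigid`. The value `c` is read off at any vertex of `S`.
  constant-small : ∀ (D S : Fin n → Bool) → L ≤ size D → L ≤ size (not ∘ D) →
                   (∀ u v → S u ≡ true → S v ≡ true → dg D (M ! u) ≡ dg D (M ! v)) → 2 * κ * size S < n
  constant-small D S LD LD′ const with n ≤? 2 * κ * size S
  ... | no ¬p = ≰⇒> ¬p
  ... | yes large with subset D L LD | subset (not ∘ D) L LD′
  ... | g , g⊆D , |g| | g′ , g′⊆D′ , |g′| = ⊥-elim contra
    where
    E E′ D̂ Ŝ : Row n
    E = tabulate g
    E′ = tabulate g′
    D̂ = tabulate D
    Ŝ = tabulate S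
    pairs-count : n * n ≤ 64 * (κ * κ) * pair-count E E′ Ŝ (AllAbove? θ)
    pairs-count = large-pair-count E E′ Ŝ κ θ (trans (size-tabulate g) |g|) (trans (size-tabulate g′) |g′|) 4θ≤T
      (≤-trans large (≤-reflexive (cong (2 * κ *_) (sym (size-tabulate S)))))
      (≤-trans (*-monoˡ-≤ L (*-monoˡ-≤ κ {8} {32} (m≤m+n 8 24))) 32κL≤n) G-def κ²≤n
    nonempty : ∃[ v ] (1 ≤ ⟦ S v ⟧)
    nonempty = sum-pos (λ v → ⟦ S v ⟧) (pos (size S) large)
      where
      pos : ∀ z → n ≤ 2 * κ * z → 1 ≤ z
      pos zero h = ≤-trans 1≤n (≤-trans h (≤-reflexive (*-zeroʳ (2 * κ))))
      pos (suc z) h = s≤s z≤n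
    v : Fin n
    v = proj₁ nonempty
    contra : ⊥
    contra = go (good-matching (Switchable E E′ Ŝ (AllAbove? θ)) (remaining E E′ Ŝ) s (enough-pairs (pair-count E E′ Ŝ (AllAbove? θ)) pairs-count))
      where
      go : ∃[ r ] (r < 2 * n × s ≤ ∑₂ (λ a b → [ Matchings.Matched? r (remaining E E′ Ŝ) (a , b) ×-dec Switchable E E′ Ŝ (AllAbove? θ) a b ])) → ⊥
      go (r , r< , many) = not-rigid E E′ D̂ Ŝ (dg D (M ! v)) r (s≤s (dg≤n D (M ! v))) r<
            (Rigid-intro (AllAbove? θ) E E′ D̂ Ŝ (dg D (M ! v)) r s pre M reg
              (λ j Sj → trans (dg-tabulate D (M ! j)) (const j v (trans (sym (tabulate-at S j)) Sj) (⟦⟧-elim (proj₂ nonempty)))) many)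
        where
        pre : Pre (AllAbove? θ) E E′ D̂ Ŝ (dg D (M ! v)) r s
        pre = (λ j Ej → trans (tabulate-at D j) (g⊆D j (trans (sym (tabulate-at g j)) Ej))) ,
            (λ j E′j → trans (tabulate-at D j) (not-true (g′⊆D′ j (trans (sym (tabulate-at g′ j)) E′j))))

  -- A set `U` with fewer than `L` vertices has to serve as `E` in full, and two rows may differ on
  -- it very little. So `Moderate?` takes the place of `AllAbove? θ`, and `D` is `E` itself.
  not-almost-constant : ∀ (U : Fin n → Bool) c → 1 ≤ c → c ≤ n → size U < L →
                        n ≤ size (λ v → does (dg U (M ! v) ≟ℕ c)) + 2 * L → ⊥
  not-almost-constant U c 1≤c c≤n |U| |S| = contra (subset (not ∘ U) L rest)
    where
    rest : L ≤ size (not ∘ U)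
    rest = +-cancelˡ-≤ (size U) _ _ (begin
      size U + L ≤⟨ +-monoˡ-≤ L (<⇒≤ |U|) ⟩
      L + L ≤⟨ ≤-trans (m≤m+n (L + L) (30 * L)) (≤-trans (≤-reflexive (lem L)) 32L≤n) ⟩
      n ≡⟨ sym (size-not U) ⟩
      size U + size (not ∘ U) ∎)
      where
      open ≤-Reasoning
      lem : ∀ L → L + L + 30 * L ≡ 32 * L
      lem = solve-∀
    finish : ∀ g → (∀ j → g j ≡ true → not (U j) ≡ true) → size g ≡ L → ⊥
    finish g g⊆ |g| = contra
      where
      S : Fin n → Bool
      S v = does (dg U (M ! v) ≟ℕ c)
      E E′ Ŝ : Row n
      E = tabulate U
      E′ = tabulate g
      Ŝ = tabulate S
      Ŝ-elim : ∀ j → Ŝ ! j ≡ true → dg (E !_) (M ! j) ≡ c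
      Ŝ-elim j h = trans (dg-tabulate U (M ! j)) (does-true (dg U (M ! j) ≟ℕ c) (trans (sym (tabulate-at S j)) h))
      |E| : size (E !_) ≤ L
      |E| = ≤-trans (≤-reflexive (size-tabulate U)) (<⇒≤ |U|)
      |E′| : size (E′ !_) ≡ L
      |E′| = trans (size-tabulate g) |g|
      |Ŝ| : n ≤ size (Ŝ !_) + 2 * L
      |Ŝ| = ≤-trans |S| (≤-reflexive (cong (_+ 2 * L) (sym (size-tabulate S))))
      1024≤G : 1024 ≤ G
      1024≤G = ≤-trans (*-monoʳ-≤ 1024 1≤κ²) (≤-reflexive (sym G-def))
      4≤T : 4 ≤ T
      4≤T = ≤-trans (*-monoʳ-≤ 4 1≤G) 4G≤T
      2d≤n : 2 * d ≤ n
      2d≤n = subst (2 * d ≤_) d+m≡n (≤-trans (m≤m+n (2 * d) k) (≤-reflexive (lem d k)))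
        where
        lem : ∀ d k → 2 * d + k ≡ d + (d + k)
        lem = solve-∀
      64≤n : 64 ≤ n
      64≤n = ≤-trans (*-monoʳ-≤ 64 1≤κ²) κ²≤n
      pairs-count : n * n ≤ 64 * (κ * κ) * pair-count E E′ Ŝ (Moderate? (2 * suc T))
      pairs-count = ≤-trans (moderate-pair-count E E′ Ŝ c 1≤c |E| |E′| 4≤T Ŝ-elim |Ŝ| 32L≤n 2d≤n 1024≤G 64≤n)
        (*-monoˡ-≤ (pair-count E E′ Ŝ (Moderate? (2 * suc T))) (≤-trans {16} {64} (m≤m+n 16 48) (*-monoʳ-≤ 64 1≤κ²)))
      contra : ⊥
      contra = go (good-matching (Switchable E E′ Ŝ (Moderate? (2 * suc T))) (remaining E E′ Ŝ) s (enough-pairs (pair-count E E′ Ŝ (Moderate? (2 * suc T))) pairs-count))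
        where
        go : ∃[ r ] (r < 2 * n × s ≤ ∑₂ (λ a b → [ Matchings.Matched? r (remaining E E′ Ŝ) (a , b) ×-dec Switchable E E′ Ŝ (Moderate? (2 * suc T)) a b ])) → ⊥
        go (r , r< , many) = not-rigid′ E E′ Ŝ c r |E| (≤-reflexive |E′|)
              (+-cancelˡ-≤ (size (Ŝ !_)) _ _ (≤-trans (≤-reflexive (size-not (Ŝ !_))) |Ŝ|)) (s≤s c≤n) r<
              (Rigid-intro (Moderate? (2 * suc T)) E E′ E Ŝ c r s pre M reg Ŝ-elim many)
          where
          pre : Pre (Moderate? (2 * suc T)) E E′ E Ŝ c r s
          pre = (λ j Ej → Ej) , (λ j E′j → trans (tabulate-at U j) (not-true (g⊆ j (trans (sym (tabulate-at g j)) E′j))))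
    contra : ∃[ g ] ((∀ j → g j ≡ true → not (U j) ≡ true) × size g ≡ L) → ⊥
    contra (g , g⊆ , |g|) = finish g g⊆ |g|

  above : (Fin n → Bool) → ℕ → Fin n → Bool
  above U j v = does (j ≤? dg U (M ! v))

  -- The level sizes fall from `n` to 0, so some level exceeds `n - L` while the next does not.
  -- Either the next level is balanced, or the degree is exactly `j` outside fewer than `2 * L`
  -- vertices, against `not-almost-constant`. The case `j = 0` is separate: level 1 contains the
  -- `d ≥ L` neighbours of `u`.
  balanced-level : ∀ U u → U u ≡ true → size U < L → ∃[ j ] (L ≤ size (above U j) × L ≤ size (not ∘ above U j))
  balanced-level U u Uu |U| = decide (crossing (λ j → size (above U j) + L) n (suc n) start end)
    where
    start : n < size (above U 0) + L
    start = ≤-trans (≤-trans (≤-reflexive (+-comm 1 n)) (+-monoʳ-≤ n 1≤L)) (+-monoˡ-≤ L (≤-reflexive (sym full)))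
      where
      full : size (above U 0) ≡ n
      full = trans (sum-cong (λ v → cong ⟦_⟧ (true-does (0 ≤? dg U (M ! v)) z≤n))) (trans (sum-const n 1) (*-identityʳ n))
    end : size (above U (suc n)) + L ≤ n
    end = ≤-trans (≤-reflexive (cong (_+ L) empty)) (≤-trans (m≤m+n L (31 * L)) 32L≤n)
      where
      empty : size (above U (suc n)) ≡ 0
      empty = sum-zero {n} (λ v → []-false (suc n ≤? dg U (M ! v)) (λ h → <⇒≱ h (dg≤n U (M ! v))))
    impossible : ∀ j → j ≤ n → n < size (above U j) + L → ¬ L ≤ size (above U (suc j)) → ⊥
    impossible j j≤n more ¬p = not-almost-constant U j (positive j refl) j≤n |U| level
      where
      positive : ∀ i → i ≡ j → 1 ≤ i
      positive (suc i) _ = s≤s z≤n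
      positive zero refl = ⊥-elim (¬p (≤-trans L≤d (begin
        d ≡⟨ sym (proj₂ (proj₂ reg) u) ⟩
        ∑ (λ v → ⟦ M ! u ! v ⟧) ≤⟨ sum-mono (λ v → ⟦⟧-mono (neighbour v)) ⟩
        size (above U 1) ∎)))
        where
        open ≤-Reasoning
        neighbour : ∀ v → M ! u ! v ≡ true → above U 1 v ≡ true
        neighbour v h = true-does (1 ≤? dg U (M ! v)) (≤-trans (≤-reflexive (sym (cong ⟦_⟧ (∧-intro Uu (trans (proj₁ reg v u) h)))))
                                                               (sum-elem (λ x → ⟦ U x ∧ M ! v ! x ⟧) u))
      level : n ≤ size (λ v → does (dg U (M ! v) ≟ℕ j)) + 2 * L
      level = begin
        n ≤⟨ <⇒≤ more ⟩
        size (above U j) + L ≤⟨ +-monoˡ-≤ L (≤-trans (sum-mono split) (≤-reflexive (sum-+ _ _))) ⟩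
        size (λ v → does (dg U (M ! v) ≟ℕ j)) + size (above U (suc j)) + L ≤⟨ +-monoˡ-≤ L (+-monoʳ-≤ (size (λ v → does (dg U (M ! v) ≟ℕ j))) (<⇒≤ (≰⇒> ¬p))) ⟩
        size (λ v → does (dg U (M ! v) ≟ℕ j)) + L + L ≡⟨ lem (size (λ v → does (dg U (M ! v) ≟ℕ j))) L ⟩
        size (λ v → does (dg U (M ! v) ≟ℕ j)) + 2 * L ∎
        where
        open ≤-Reasoning
        lem : ∀ p q → p + q + q ≡ p + 2 * q
        lem = solve-∀
        split : ∀ v → [ j ≤? dg U (M ! v) ] ≤ [ dg U (M ! v) ≟ℕ j ] + [ suc j ≤? dg U (M ! v) ]
        split v = go (dg U (M ! v))
          where
          go : ∀ x → [ j ≤? x ] ≤ [ x ≟ℕ j ] + [ suc j ≤? x ]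
          go x = cases (x ≟ℕ j)
            where
            cases : (q : Dec (x ≡ j)) → [ j ≤? x ] ≤ [ q ] + [ suc j ≤? x ]
            cases (yes _) = ≤-trans ([]≤1 (j ≤? x)) (m≤m+n 1 [ suc j ≤? x ])
            cases (no ne) = []-mono (j ≤? x) (suc j ≤? x) (λ h → ≤∧≢⇒< h (ne ∘ sym))
    decide : ∃[ j ] (j < suc n × n < size (above U j) + L × size (above U (suc j)) + L ≤ n) →
             ∃[ j ] (L ≤ size (above U j) × L ≤ size (not ∘ above U j))
    decide (j , j< , more , less) = choose (L ≤? size (above U (suc j)))
      where
      choose : Dec (L ≤ size (above U (suc j))) → ∃[ j ] (L ≤ size (above U j) × L ≤ size (not ∘ above U j))
      choose (yes p) = suc j , p , +-cancelˡ-≤ (size (above U (suc j))) _ _ (≤-trans less (≤-reflexive (sym (size-not (above U (suc j))))))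
      choose (no ¬p) = ⊥-elim (impossible j (s≤s⁻¹ j<) more ¬p)

  module _ (part : Fin n → Bool) (v₀ w₀ : Fin n) (pv : part v₀ ≡ true) (pw : part w₀ ≡ false) where

    open Refinement (graph M) part

    private
      side : Fin n → Fin n → Bool
      side u x = same 0 x u

      side-not : ∀ x → not (side v₀ x) ≡ side w₀ x
      side-not x rewrite pv | pw with part x
      ... | true = refl
      ... | false = refl

      side-respected : ∀ u → Respects (graph M) part 1 (side u)
      side-respected u x y h = same-cong 0 u (proj₁ (same-elim {0} h))

      -- Degrees into a side of the partition are what the first round compares.
      above-respected : ∀ u j → Respects (graph M) part 1 (above (side u) j)
      above-respected u j x y h = cong (λ z → does (j ≤? z)) (begin
        dg (side u) (M ! x) ≡⟨ commuted x ⟩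
        into 0 x u ≡⟨ proj₂ (same-elim {0} h) u ⟩
        into 0 y u ≡⟨ sym (commuted y) ⟩
        dg (side u) (M ! y) ∎)
        where
        open ≡-Reasoning
        commuted : ∀ x → dg (side u) (M ! x) ≡ into 0 x u
        commuted x = trans (sum-cong (λ z → cong ⟦_⟧ (∧-comm (side u z) (M ! x ! z)))) (sym (countTrue≡∑ (λ z → (M ! x ! z) ∧ same 0 z u)))

      balanced : ∃[ D ] (Respects (graph M) part 1 D × (L ≤ size D × L ≤ size (not ∘ D)))
      balanced = choose (L ≤? size (side v₀)) (L ≤? size (side w₀))
        where
        level : ∀ u → ∃[ j ] (L ≤ size (above (side u) j) × L ≤ size (not ∘ above (side u) j)) → ∃[ D ] (Respects (graph M) part 1 D × (L ≤ size D × L ≤ size (not ∘ D)))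
        level u (j , lo , hi) = above (side u) j , above-respected u j , lo , hi
        choose : Dec (L ≤ size (side v₀)) → Dec (L ≤ size (side w₀)) → ∃[ D ] (Respects (graph M) part 1 D × (L ≤ size D × L ≤ size (not ∘ D)))
        choose (yes p) (yes q) = side v₀ , side-respected v₀ , p , ≤-trans q (≤-reflexive (sum-cong (λ x → cong ⟦_⟧ (sym (side-not x)))))
        choose (no ¬p) _ = level v₀ (balanced-level (side v₀) v₀ (same-refl 0 v₀) (≰⇒> ¬p))
        choose (yes _) (no ¬q) = level w₀ (balanced-level (side w₀) w₀ (same-refl 0 w₀) (≰⇒> ¬q))

    classes-small : ∀ v → 2 * κ * size (same 2 v) < n
    classes-small v = go balanced
      where
      go : ∃[ D ] (Respects (graph M) part 1 D × (L ≤ size D × L ≤ size (not ∘ D))) → 2 * κ * size (same 2 v) < n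
      go (D , resp , lo , hi) = constant-small D (same 2 v) lo hi
        (λ x y vx vy → degree-refined (graph M) part 1 D resp x y (same-trans 2 (same-sym 2 vx) vy))

-- Grouping the classes

-- Classes, ordered by their leaders, are cut into k consecutive groups of about n / k vertices:
-- group i collects the classes starting at a position in [i n / k, (i + 1) n / k).
module Packing {n : ℕ} (k : ℕ) (1≤k : 1 ≤ k) (1≤n : 1 ≤ n) (ℓ : Fin n → ℕ) (ℓ<n : ∀ v → ℓ v < n)
               (class-small : ∀ j → 2 * k * ∑ (λ v → [ ℓ v ≟ℕ j ]) ≤ n) where

  private
    instance
      n≢0 : NonZero n
      n≢0 = >-nonZero 1≤n

    before : ℕ → ℕ
    before J = ∑ (λ v → [ ℓ v <? J ])

    class : ℕ → ℕ
    class j = ∑ (λ v → [ ℓ v ≟ℕ j ])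

    <-suc : ∀ x J → [ x <? suc J ] ≡ [ x <? J ] + [ x ≟ℕ J ]
    <-suc x J with <-cmp x J
    ... | tri< lt ne _ = trans ([]-true (x <? suc J) (m<n⇒m<1+n lt)) (sym (cong₂ _+_ ([]-true (x <? J) lt) ([]-false (x ≟ℕ J) ne)))
    ... | tri≈ nlt e _ = trans ([]-true (x <? suc J) (s≤s (≤-reflexive e))) (sym (cong₂ _+_ ([]-false (x <? J) nlt) ([]-true (x ≟ℕ J) e)))
    ... | tri> nlt ne gt = trans ([]-false (x <? suc J) (λ h → <⇒≱ gt (s≤s⁻¹ h))) (sym (cong₂ _+_ ([]-false (x <? J) nlt) ([]-false (x ≟ℕ J) ne)))

    before-suc : ∀ J → before (suc J) ≡ before J + class J
    before-suc J = trans (sum-cong (λ v → <-suc (ℓ v) J)) (sum-+ _ _)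

    before-n : before n ≡ n
    before-n = trans (sum-cong (λ v → []-true (ℓ v <? n) (ℓ<n v))) (trans (sum-const n 1) (*-identityʳ n))

    before-ℓ : ∀ v → before (ℓ v) < n
    before-ℓ v = <-≤-trans (≤-trans (m<m+n (before (ℓ v)) member) (≤-reflexive (sym (before-suc (ℓ v)))))
                           (≤-trans (sum-mono (λ u → []≤1 (ℓ u <? suc (ℓ v)))) (≤-reflexive (trans (sum-const n 1) (*-identityʳ n))))
      where
      member : 1 ≤ class (ℓ v)
      member = ≤-trans (≤-reflexive (sym ([]-true (ℓ v ≟ℕ ℓ v) refl))) (sum-elem (λ u → [ ℓ u ≟ℕ ℓ v ]) v)

    module _ (x : ℕ) where
      started : ℕ → ℕ
      started J = ∑ (λ v → [ (ℓ v <? J) ×-dec (k * before (ℓ v) <? x) ])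

      started-suc : ∀ J → (s : Dec (k * before J < x)) → started (suc J) ≡ started J + [ s ] * class J
      started-suc J s = trans (sum-cong each) (trans (sum-+ _ _) (cong (started J +_) (sum-*ˡ [ s ] _)))
        where
        each : ∀ v → [ (ℓ v <? suc J) ×-dec (k * before (ℓ v) <? x) ] ≡ [ (ℓ v <? J) ×-dec (k * before (ℓ v) <? x) ] + [ s ] * [ ℓ v ≟ℕ J ]
        each v = begin
          [ (ℓ v <? suc J) ×-dec t ] ≡⟨ []-× (ℓ v <? suc J) t ⟩
          [ ℓ v <? suc J ] * [ t ] ≡⟨ cong (_* [ t ]) (<-suc (ℓ v) J) ⟩
          ([ ℓ v <? J ] + [ ℓ v ≟ℕ J ]) * [ t ] ≡⟨ *-distribʳ-+ [ t ] [ ℓ v <? J ] _ ⟩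
          [ ℓ v <? J ] * [ t ] + [ ℓ v ≟ℕ J ] * [ t ] ≡⟨ cong₂ _+_ (sym ([]-× (ℓ v <? J) t)) at-J ⟩
          [ (ℓ v <? J) ×-dec t ] + [ s ] * [ ℓ v ≟ℕ J ] ∎
          where
          open ≡-Reasoning
          t : Dec (k * before (ℓ v) < x)
          t = k * before (ℓ v) <? x
          at-J : [ ℓ v ≟ℕ J ] * [ t ] ≡ [ s ] * [ ℓ v ≟ℕ J ]
          at-J = trans (*-comm [ ℓ v ≟ℕ J ] [ t ]) (go (ℓ v ≟ℕ J))
            where
            go : (q : Dec (ℓ v ≡ J)) → [ t ] * [ q ] ≡ [ s ] * [ q ]
            go (yes e) = cong (_* 1) ([]-cong t s (subst (λ z → k * before z < x) e) (subst (λ z → k * before z < x) (sym e)))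
            go (no _) = trans (*-zeroʳ [ t ]) (sym (*-zeroʳ [ s ]))

      -- `started J` counts the vertices in the first `J` classes that begin before position
      -- `x / k`. It equals `before J` while all classes begin there, and stops growing afterwards.
      -- It overshoots `x / k` by at most one class, that is, by at most `n / (2k)`.
      started-bounds : ∀ J → ((k * before J ≤ k * started J) ⊎ (x ≤ k * started J)) ×
                             (started J ≤ before J × 2 * k * started J ≤ 2 * x + n)
      started-bounds zero = inj₁ (≤-reflexive (cong (k *_) (trans b0 (sym s0)))) , ≤-trans (≤-reflexive s0) z≤n ,
                            ≤-trans (≤-reflexive (trans (cong (2 * k *_) s0) (*-zeroʳ (2 * k)))) z≤n
        where
        b0 : before 0 ≡ 0
        b0 = sum-zero {n} (λ v → []-false (ℓ v <? 0) (λ ()))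
        s0 : started 0 ≡ 0
        s0 = sum-zero {n} (λ v → []-false ((ℓ v <? 0) ×-dec (k * before (ℓ v) <? x)) (λ { (() , _) }))
      started-bounds (suc J) with started-bounds J | k * before J <? x
      ... | h , below , up | no ¬s = inj₂ (≤-trans (enough h) (≤-reflexive (cong (k *_) (sym eqn)))) ,
            ≤-trans (≤-reflexive eqn) (≤-trans below (≤-trans (m≤m+n _ _) (≤-reflexive (sym (before-suc J))))) ,
            ≤-trans (≤-reflexive (cong (2 * k *_) eqn)) up
        where
        eqn : started (suc J) ≡ started J
        eqn = trans (started-suc J (no ¬s)) (+-identityʳ _)
        enough : (k * before J ≤ k * started J) ⊎ (x ≤ k * started J) → x ≤ k * started J
        enough (inj₁ p) = ≤-trans (≮⇒≥ ¬s) p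
        enough (inj₂ p) = p
      ... | h , below , up | yes s = inj₁ (≤-reflexive (cong (k *_) all)) , ≤-reflexive (sym all) , (begin
            2 * k * started (suc J) ≡⟨ cong (2 * k *_) (trans (sym all) (before-suc J)) ⟩
            2 * k * (before J + class J) ≡⟨ lem k (before J) (class J) ⟩
            2 * (k * before J) + 2 * k * class J ≤⟨ +-mono-≤ (*-monoʳ-≤ 2 (<⇒≤ s)) (class-small J) ⟩
            2 * x + n ∎)
        where
        open ≤-Reasoning
        lem : ∀ k p q → 2 * k * (p + q) ≡ 2 * (k * p) + 2 * k * q
        lem = solve-∀
        tight : (k * before J ≤ k * started J) ⊎ (x ≤ k * started J) → before J ≤ started J
        tight (inj₁ p) = *-cancelˡ-≤ k {{>-nonZero 1≤k}} p
        tight (inj₂ p) = ⊥-elim (<⇒≱ s (≤-trans p (*-monoʳ-≤ k below)))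
        all : before (suc J) ≡ started (suc J)
        all = trans (before-suc J) (trans (cong₂ _+_ (≤-antisym (tight h) below) (sym (*-identityˡ (class J)))) (sym (started-suc J (yes s))))

    position : Fin n → ℕ
    position v = k * before (ℓ v)

    started-n : ∀ x → started x n ≡ ∑ (λ v → [ position v <? x ])
    started-n x = sum-cong (λ v → []-cong ((ℓ v <? n) ×-dec (position v <? x)) (position v <? x) proj₂ (λ h → ℓ<n v , h))

    slot< : ∀ v → position v / n < k
    slot< v = m<n*o⇒m/o<n (*-monoʳ-< k {{>-nonZero 1≤k}} (before-ℓ v))

  slot : Fin n → Fin k
  slot v = fromℕ< (slot< v)

  slot-cong : ∀ {v w} → ℓ v ≡ ℓ w → slot v ≡ slot w
  slot-cong {v} {w} h = toℕ-injective (trans (toℕ-fromℕ< (slot< v)) (trans (cong (λ z → k * before z / n) h) (sym (toℕ-fromℕ< (slot< w)))))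

  private
    quotient-split : ∀ a i → [ a / n ≟ℕ i ] + [ a <? i * n ] ≡ [ a <? suc i * n ]
    quotient-split a i with <-cmp (a / n) i
    ... | tri< lt ne _ = trans (cong₂ _+_ ([]-false (a / n ≟ℕ i) ne) ([]-true (a <? i * n) a<)) (sym ([]-true (a <? suc i * n) (<-≤-trans a< (m≤n+m (i * n) n))))
      where
      a< : a < i * n
      a< = <-≤-trans (≤-trans (s≤s (≤-reflexive (m≡m%n+[m/n]*n a n))) (+-monoˡ-< (a / n * n) (m%n<n a n))) (*-monoˡ-≤ n lt)
    ... | tri≈ _ e _ = trans (cong₂ _+_ ([]-true (a / n ≟ℕ i) e) ([]-false (a <? i * n) (≤⇒≯ (≤-trans (≤-reflexive (cong (_* n) (sym e))) (m/n*n≤m a n)))))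
                             (sym ([]-true (a <? suc i * n) (<-≤-trans (≤-trans (s≤s (≤-reflexive (m≡m%n+[m/n]*n a n))) (+-monoˡ-< (a / n * n) (m%n<n a n))) (≤-reflexive (cong (λ z → n + z * n) e)))))
    ... | tri> _ ne gt = trans (cong₂ _+_ ([]-false (a / n ≟ℕ i) ne) ([]-false (a <? i * n) (≤⇒≯ (≤-trans (m≤n+m (i * n) n) a≥))))
                               (sym ([]-false (a <? suc i * n) (≤⇒≯ a≥)))
      where
      a≥ : suc i * n ≤ a
      a≥ = ≤-trans (*-monoˡ-≤ n gt) (m/n*n≤m a n)

  module _ (i : Fin k) where
    private
      j lo hi cnt : ℕ
      j = toℕ i
      cnt = countTrue (λ v → does (slot v ≟F i))
      lo = started (j * n) n
      hi = started (suc j * n) n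

      cnt+lo : cnt + lo ≡ hi
      cnt+lo = begin
        cnt + lo ≡⟨ cong₂ _+_ (countTrue≡∑ (λ v → does (slot v ≟F i))) (started-n (j * n)) ⟩
        ∑ (λ v → [ slot v ≟F i ]) + ∑ (λ v → [ position v <? j * n ]) ≡⟨ sym (sum-+ _ _) ⟩
        ∑ (λ v → [ slot v ≟F i ] + [ position v <? j * n ]) ≡⟨ sum-cong (λ v → trans (cong (_+ [ position v <? j * n ])
                                                                                          ([]-cong (slot v ≟F i) (position v / n ≟ℕ j) (λ e → trans (sym (toℕ-fromℕ< (slot< v))) (cong toℕ e))
                                                                                            (λ e → toℕ-injective (trans (toℕ-fromℕ< (slot< v)) e))))
                                                                                          (quotient-split (position v) j)) ⟩
        ∑ (λ v → [ position v <? suc j * n ]) ≡⟨ sym (started-n (suc j * n)) ⟩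
        hi ∎
        where open ≡-Reasoning

      reach : ∀ x → x ≤ k * n → x ≤ k * started x n
      reach x h with started-bounds x n
      ... | inj₁ p , _ = ≤-trans h (≤-trans (≤-reflexive (cong (k *_) (sym before-n))) p)
      ... | inj₂ p , _ = p

      lo≥ : j * n ≤ k * lo
      lo≥ = reach (j * n) (*-monoˡ-≤ n (<⇒≤ (toℕ<n i)))
      hi≥ : suc j * n ≤ k * hi
      hi≥ = reach (suc j * n) (*-monoˡ-≤ n (toℕ<n i))
      lo≤ : 2 * k * lo ≤ 2 * (j * n) + n
      lo≤ = proj₂ (proj₂ (started-bounds (j * n) n))
      hi≤ : 2 * k * hi ≤ 2 * (suc j * n) + n
      hi≤ = proj₂ (proj₂ (started-bounds (suc j * n) n))

    -- Both cut points err only upwards and by at most `n / (2k)`, so a group has between `n / (2k)`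
    -- and `3n / (2k)` vertices.
    slot-lower : n ≤ 3 * k * cnt
    slot-lower = ≤-trans (+-cancelʳ-≤ (2 * k * lo) _ _ (begin
      n + 2 * k * lo ≤⟨ +-monoʳ-≤ n lo≤ ⟩
      n + (2 * (j * n) + n) ≡⟨ lem₁ n j ⟩
      2 * (suc j * n) ≤⟨ *-monoʳ-≤ 2 hi≥ ⟩
      2 * (k * hi) ≡⟨ cong (λ z → 2 * (k * z)) (sym cnt+lo) ⟩
      2 * (k * (cnt + lo)) ≡⟨ lem₂ k cnt lo ⟩
      2 * k * cnt + 2 * k * lo ∎)) (*-monoˡ-≤ cnt (*-monoˡ-≤ k {2} {3} (s≤s (s≤s z≤n))))
      where
      open ≤-Reasoning
      lem₁ : ∀ n j → n + (2 * (j * n) + n) ≡ 2 * (suc j * n)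
      lem₁ = solve-∀
      lem₂ : ∀ k c l → 2 * (k * (c + l)) ≡ 2 * k * c + 2 * k * l
      lem₂ = solve-∀

    slot-upper : k * cnt ≤ 3 * n
    slot-upper = ≤-trans (*-monoˡ-≤ cnt (m≤m+n k (k + 0))) (+-cancelʳ-≤ (2 * (j * n)) _ _ (begin
      2 * k * cnt + 2 * (j * n) ≤⟨ +-monoʳ-≤ (2 * k * cnt) (*-monoʳ-≤ 2 lo≥) ⟩
      2 * k * cnt + 2 * (k * lo) ≡⟨ lem₁ k cnt lo ⟩
      2 * k * (cnt + lo) ≡⟨ cong (2 * k *_) cnt+lo ⟩
      2 * k * hi ≤⟨ hi≤ ⟩
      2 * (suc j * n) + n ≡⟨ lem₂ n j ⟩
      3 * n + 2 * (j * n) ∎))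
      where
      open ≤-Reasoning
      lem₁ : ∀ k c l → 2 * k * c + 2 * (k * l) ≡ 2 * k * (c + l)
      lem₁ = solve-∀
      lem₂ : ∀ n j → 2 * (suc j * n) + n ≡ 3 * n + 2 * (j * n)
      lem₂ = solve-∀

pack : ∀ {n} k → 1 ≤ k → 1 ≤ n → (G : Graph n) (part : Fin n → Bool) →
       (∀ v → 2 * k * size (sameColour G part 2 v) ≤ n) →
       Σ (Fin n → Fin k) λ W → ((i : Fin k) →
            n ≤ 3 * k * countTrue (λ v → does (W v ≟F i)) × k * countTrue (λ v → does (W v ≟F i)) ≤ 3 * n)
       × ((v w : Fin n) → sameColour G part 2 v w ≡ true → W v ≡ W w)
pack {n} k 1≤k 1≤n G part small = slot , (λ i → slot-lower i , slot-upper i) , (λ v w h → slot-cong (leader-cong G part 2 h))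
  where
  open Refinement G part
  ℓ : Fin n → ℕ
  ℓ = leader G part 2
  ℓ<n : ∀ v → ℓ v < n
  ℓ<n v with leader-vertex G part 2 v
  ... | j , _ , e = subst (_< n) e (toℕ<n j)
  same-leader : ∀ {u v} → ℓ u ≡ ℓ v → same 2 u v ≡ true
  same-leader {u} {v} h with leader-vertex G part 2 u | leader-vertex G part 2 v
  ... | j , uj , e | j′ , vj′ , e′ with toℕ-injective {i = j} {j′} (trans e (trans h (sym e′)))
  ... | refl = same-trans 2 uj (same-sym 2 vj′)
  class-small : ∀ j → 2 * k * ∑ (λ v → [ ℓ v ≟ℕ j ]) ≤ n
  class-small j with any? (λ v → ℓ v ≟ℕ j)
  ... | no ¬∃ = ≤-trans (≤-reflexive (trans (cong (2 * k *_) (sum-zero {n} (λ v → []-false (ℓ v ≟ℕ j) (λ e → ¬∃ (v , e))))) (*-zeroʳ (2 * k)))) z≤n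
  ... | yes (v , refl) = ≤-trans (*-monoʳ-≤ (2 * k) (sum-mono (λ u → ⟦⟧-mono (λ h → same-leader {v} {u} (sym (does-true (ℓ u ≟ℕ ℓ v) h)))))) (small v)
  open Packing k 1≤k 1≤n ℓ ℓ<n class-small

-- Union bounds

length-product : ∀ {X Y : Set} (xs : List X) (ys : List Y) → length (cartesianProduct xs ys) ≡ length xs * length ys
length-product [] ys = refl
length-product (x ∷ xs) ys = trans (length-++ (map (x ,_) ys)) (cong₂ _+_ (length-map (x ,_) ys) (length-product xs ys))

length-product-≤ : ∀ {X Y : Set} (xs : List X) (ys : List Y) {a b} → length xs ≤ a → length ys ≤ b → length (cartesianProduct xs ys) ≤ a * b
length-product-≤ xs ys h k = ≤-trans (≤-reflexive (length-product xs ys)) (*-mono-≤ h k)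

rows : ∀ n → List (Row n)
rows zero = [] ∷ []
rows (suc n) = map (true ∷_) (rows n) ++ map (false ∷_) (rows n)

∈-rows : ∀ {n} (r : Row n) → r ∈ rows n
∈-rows [] = here refl
∈-rows {suc n} (true ∷ r) = ∈-++⁺ˡ (∈-map⁺ (true ∷_) (∈-rows r))
∈-rows {suc n} (false ∷ r) = ∈-++⁺ʳ (map (true ∷_) (rows n)) (∈-map⁺ (false ∷_) (∈-rows r))

length-rows : ∀ n → length (rows n) ≡ 2 ^ n
length-rows zero = refl
length-rows (suc n) = trans (length-++ (map (true ∷_) (rows n)))
  (trans (cong₂ _+_ (length-map (true ∷_) (rows n)) (length-map (false ∷_) (rows n)))
  (trans (cong₂ _+_ (length-rows n) (length-rows n)) (cong (2 ^ n +_) (sym (+-identityʳ (2 ^ n))))))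

sparse-rows : ∀ n → ℕ → List (Row n)
sparse-rows zero l = [] ∷ []
sparse-rows (suc n) zero = map (false ∷_) (sparse-rows n zero)
sparse-rows (suc n) (suc l) = map (true ∷_) (sparse-rows n l) ++ map (false ∷_) (sparse-rows n (suc l))

∈-sparse-rows : ∀ {n} l (r : Row n) → size (r !_) ≤ l → r ∈ sparse-rows n l
∈-sparse-rows l [] h = here refl
∈-sparse-rows zero (true ∷ r) h = ⊥-elim (<⇒≱ (s≤s z≤n) (≤-trans (≤-reflexive (sym (size-suc ((true ∷ r) !_)))) h))
∈-sparse-rows zero (false ∷ r) h = ∈-map⁺ (false ∷_) (∈-sparse-rows zero r (≤-trans (≤-reflexive (sym (size-suc ((false ∷ r) !_)))) h))
∈-sparse-rows (suc l) (true ∷ r) h = ∈-++⁺ˡ (∈-map⁺ (true ∷_) (∈-sparse-rows l r (s≤s⁻¹ (≤-trans (≤-reflexive (sym (size-suc ((true ∷ r) !_)))) h))))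
∈-sparse-rows {suc n} (suc l) (false ∷ r) h = ∈-++⁺ʳ (map (true ∷_) (sparse-rows n l))
  (∈-map⁺ (false ∷_) (∈-sparse-rows (suc l) r (≤-trans (≤-reflexive (sym (size-suc ((false ∷ r) !_)))) h)))

length-sparse-rows : ∀ n l → length (sparse-rows n l) ≤ suc n ^ l
length-sparse-rows zero l = ≤-reflexive (sym (^-zeroˡ l))
length-sparse-rows (suc n) zero = ≤-trans (≤-reflexive (length-map (false ∷_) (sparse-rows n zero))) (length-sparse-rows n zero)
length-sparse-rows (suc n) (suc l) = begin
  length (sparse-rows (suc n) (suc l)) ≡⟨ length-++ (map (true ∷_) (sparse-rows n l)) ⟩
  length (map (true ∷_) (sparse-rows n l)) + length (map (false ∷_) (sparse-rows n (suc l)))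
                                                                ≡⟨ cong₂ _+_ (length-map (true ∷_) (sparse-rows n l)) (length-map (false ∷_) (sparse-rows n (suc l))) ⟩
  length (sparse-rows n l) + length (sparse-rows n (suc l)) ≤⟨ +-mono-≤ (length-sparse-rows n l) (length-sparse-rows n (suc l)) ⟩
  suc (suc n) * suc n ^ l ≤⟨ *-monoʳ-≤ (suc (suc n)) (^-monoˡ-≤ l (n≤1+n (suc n))) ⟩
  suc (suc n) * suc (suc n) ^ l ∎
  where open ≤-Reasoning

negate : ∀ {n} → Row n → Row n
negate r = tabulate (λ j → not (r ! j))

negate-involutive : ∀ {n} (r : Row n) → negate (negate r) ≡ r
negate-involutive r = Vec-ext (λ j → trans (lookup∘tabulate _ j) (trans (cong not (lookup∘tabulate _ j)) (not-not (r ! j))))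
  where
  not-not : ∀ b → not (not b) ≡ b
  not-not true = refl
  not-not false = refl

module Rare {n N : ℕ} (ω : Fin N → VG n) (once : ∀ M → ∑ (λ i → [ ω i ≟G M ]) ≡ 1)
            {R : ℕ} (ρ : Fin R → Row n) (row-once : ∀ r → ∑ (λ i → [ ρ i ≟R r ]) ≡ 1) (d : ℕ) where

  open Switches ω once
  open Codegrees ω once ρ row-once d
  open Events ω once d

  union-rare : ∀ {X : Set} {P : X → VG n → Set} (P? : ∀ x M → Dec (P x M)) (L : List X) c W a b → length L ≤ W → 1 ≤ W → 1 ≤ b →
               (∀ x → a * # (P? x) ≤ b * # (Reg? d)) → c * W * b ≤ a → c * # (λ M → Any.any? (λ x → P? x M) L) ≤ # (Reg? d)
  union-rare P? L c W a b len 1≤W 1≤b each small = *-cancelˡ-≤ W {{>-nonZero 1≤W}} (begin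
    W * (c * U) ≡⟨ lem W c U ⟩
    c * W * U ≤⟨ union-bound P? L (c * W) (# (Reg? d)) one ⟩
    length L * # (Reg? d) ≤⟨ *-monoˡ-≤ (# (Reg? d)) len ⟩
    W * # (Reg? d) ∎)
    where
    open ≤-Reasoning
    U : ℕ
    U = # (λ M → Any.any? (λ x → P? x M) L)
    lem : ∀ W c U → W * (c * U) ≡ c * W * U
    lem = solve-∀
    one : ∀ x → c * W * # (P? x) ≤ # (Reg? d)
    one x = *-cancelˡ-≤ b {{>-nonZero 1≤b}} (begin
      b * (c * W * # (P? x)) ≡⟨ trans (sym (*-assoc b (c * W) _)) (cong (_* # (P? x)) (*-comm b (c * W))) ⟩
      c * W * b * # (P? x) ≤⟨ *-monoˡ-≤ (# (P? x)) small ⟩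
      a * # (P? x) ≤⟨ each x ⟩
      b * # (Reg? d) ∎)

  Distinct : Fin n × (Fin n × Fin n) → Set
  Distinct (x , (y , z)) = ¬ x ≡ y × (¬ x ≡ z × ¬ y ≡ z)

  Distinct? : ∀ t → Dec (Distinct t)
  Distinct? (x , (y , z)) = ¬? (x ≟F y) ×-dec (¬? (x ≟F z) ×-dec ¬? (y ≟F z))

  triples : List (Fin n × (Fin n × Fin n))
  triples = cartesianProduct (allFin n) (cartesianProduct (allFin n) (allFin n))

  module _ (B Δ : ℕ) where

    BadTriple : Fin n × (Fin n × Fin n) → VG n → Set
    BadTriple (x , (y , z)) M = Distinct (x , (y , z)) × Unbalanced B Δ x y z M

    BadTriple? : ∀ t M → Dec (BadTriple t M)
    BadTriple? (x , (y , z)) M = Distinct? (x , (y , z)) ×-dec Unbalanced? B Δ x y z M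

    BadCodegrees? : ∀ M → Dec (Any (λ t → BadTriple t M) triples)
    BadCodegrees? M = Any.any? (λ t → BadTriple? t M) triples

    balanced-codegrees : ∀ {M} → ¬ Any (λ t → BadTriple t M) triples → ∀ x y z → ¬ x ≡ y → ¬ x ≡ z → ¬ y ≡ z → ¬ Unbalanced B Δ x y z M
    balanced-codegrees ok x y z p q r u =
      ok (lose (∈-cartesianProduct⁺ (∈-allFin x) (∈-cartesianProduct⁺ (∈-allFin y) (∈-allFin z))) ((p , (q , r)) , u))

  codegrees-rare : ∀ c h I B → 1 ≤ n → 1 ≤ h → B + I ≤ h * (I + 2) → c * (n * (n * n)) * h ^ I ≤ suc h ^ I →
                   c * # (BadCodegrees? B (3 * I + 6)) ≤ # (Reg? d)
  codegrees-rare c h I B 1≤n 1≤h small numeric = union-rare (BadTriple? B (3 * I + 6)) triples c (n * (n * n)) (suc h ^ I) (h ^ I)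
    (length-product-≤ (allFin n) _ len (length-product-≤ (allFin n) (allFin n) len len))
    (*-mono-≤ 1≤n (*-mono-≤ 1≤n 1≤n)) (m^n>0 h {{>-nonZero 1≤h}} I) each numeric
    where
    len : length (allFin n) ≤ n
    len = ≤-reflexive (length-tabulate {n = n} id)
    each : ∀ t → suc h ^ I * # (BadTriple? B (3 * I + 6) t) ≤ h ^ I * # (Reg? d)
    each (x , (y , z)) with Distinct? (x , (y , z))
    ... | yes (p , (q , r)) = ≤-trans (*-monoʳ-≤ (suc h ^ I) (#-mono _ (Unbalanced? B (3 * I + 6) x y z) (λ M → proj₂))) (unbalanced-rare x y z p q r h I B small)
    ... | no ¬p = ≤-trans (≤-reflexive (trans (cong (suc h ^ I *_) (#-empty _ (λ M b → ¬p (proj₁ b)))) (*-zeroʳ (suc h ^ I)))) z≤n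

  Params : Set
  Params = Row n × (Row n × (Row n × (Row n × (ℕ × ℕ))))

  module _ (θ s : ℕ) where

    params : List Params
    params = cartesianProduct (rows n) (cartesianProduct (rows n) (cartesianProduct (rows n) (cartesianProduct (rows n)
             (cartesianProduct (upTo (suc n)) (upTo (2 * n))))))

    LargeRigid : Params → VG n → Set
    LargeRigid (E , (E′ , (D , (S , (c , r))))) M = Rigid (AllAbove? θ) E E′ D S c r s M

    LargeRigid? : ∀ p M → Dec (LargeRigid p M)
    LargeRigid? (E , (E′ , (D , (S , (c , r))))) M = Rigid? (AllAbove? θ) E E′ D S c r s M

    SomeLargeRigid? : ∀ M → Dec (Any (λ p → LargeRigid p M) params)
    SomeLargeRigid? M = Any.any? (λ p → LargeRigid? p M) params

    no-large-rigid : ∀ {M} → ¬ Any (λ p → LargeRigid p M) params →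
                     ∀ E E′ D S c r → c < suc n → r < 2 * n → ¬ Rigid (AllAbove? θ) E E′ D S c r s M
    no-large-rigid ok E E′ D S c r c< r< rigid = ok (lose (∈-cartesianProduct⁺ (∈-rows E) (∈-cartesianProduct⁺ (∈-rows E′)
      (∈-cartesianProduct⁺ (∈-rows D) (∈-cartesianProduct⁺ (∈-rows S) (∈-cartesianProduct⁺ (∈-upTo⁺ c<) (∈-upTo⁺ r<)))))) rigid)

  -- `K` and 4 come from `large-pairs`. The product counts four arbitrary rows, the degrees from 0
  -- to `n`, and the sums below `2 * n`.
  large-rigid-rare : ∀ x K s → 1 ≤ n → 1 ≤ K →
                     x * (2 ^ n * (2 ^ n * (2 ^ n * (2 ^ n * (suc n * (2 * n)))))) * 4 ^ s ≤ (K + 4) ^ s →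
                     x * # (SomeLargeRigid? (16 * K * K) s) ≤ # (Reg? d)
  large-rigid-rare x K s 1≤n 1≤K numeric = union-rare (LargeRigid? θ s) (params θ s) x _ ((K + 4) ^ s) (4 ^ s)
    (length-product-≤ (rows n) _ len (length-product-≤ (rows n) _ len (length-product-≤ (rows n) _ len (length-product-≤ (rows n) _ len
      (length-product-≤ (upTo (suc n)) (upTo (2 * n)) (≤-reflexive (length-upTo (suc n))) (≤-reflexive (length-upTo (2 * n))))))))
    (*-mono-≤ 1≤2ⁿ (*-mono-≤ 1≤2ⁿ (*-mono-≤ 1≤2ⁿ (*-mono-≤ 1≤2ⁿ (*-mono-≤ {1} {suc n} (s≤s z≤n) (≤-trans 1≤n (m≤m+n n (n + 0))))))))
    (m^n>0 4 s) each numeric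
    where
    θ : ℕ
    θ = 16 * K * K
    1≤2ⁿ : 1 ≤ 2 ^ n
    1≤2ⁿ = m^n>0 2 n
    len : length (rows n) ≤ 2 ^ n
    len = ≤-reflexive (length-rows n)
    each : ∀ p → (K + 4) ^ s * # (LargeRigid? θ s p) ≤ 4 ^ s * # (Reg? d)
    each (E , (E′ , (D , (S , (c , r))))) = rigid-rare (AllAbove? θ) E E′ D S c r s K 4
      (λ pre F Q? inv → LocalBounds.large-pairs ω once (E !_) (E′ !_) (D !_) (proj₁ pre) (proj₂ pre) c K 1≤K F Q? inv)

  SparseParams : Set
  SparseParams = Row n × (Row n × (Row n × (ℕ × ℕ)))

  module _ (β L s : ℕ) where

    sparse-params : List SparseParams
    sparse-params = cartesianProduct (sparse-rows n L) (cartesianProduct (sparse-rows n L) (cartesianProduct (sparse-rows n (2 * L))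
                    (cartesianProduct (upTo (suc n)) (upTo (2 * n)))))

    -- The third parameter is the complement of S.
    SparseRigid : SparseParams → VG n → Set
    SparseRigid (E , (E′ , (S′ , (c , r)))) M = Rigid (Moderate? β) E E′ E (negate S′) c r s M

    SparseRigid? : ∀ p M → Dec (SparseRigid p M)
    SparseRigid? (E , (E′ , (S′ , (c , r)))) M = Rigid? (Moderate? β) E E′ E (negate S′) c r s M

    SomeSparseRigid? : ∀ M → Dec (Any (λ p → SparseRigid p M) sparse-params)
    SomeSparseRigid? M = Any.any? (λ p → SparseRigid? p M) sparse-params

    no-sparse-rigid : ∀ {M} → ¬ Any (λ p → SparseRigid p M) sparse-params →
      ∀ E E′ S c r → size (E !_) ≤ L → size (E′ !_) ≤ L → size (not ∘ (S !_)) ≤ 2 * L → c < suc n → r < 2 * n →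
      ¬ Rigid (Moderate? β) E E′ E S c r s M
    no-sparse-rigid {M} ok E E′ S c r |E| |E′| |S′| c< r< rigid = ok (lose
      (∈-cartesianProduct⁺ (∈-sparse-rows L E |E|) (∈-cartesianProduct⁺ (∈-sparse-rows L E′ |E′|)
        (∈-cartesianProduct⁺ (∈-sparse-rows (2 * L) (negate S) (≤-trans (≤-reflexive (sum-cong (λ j → cong ⟦_⟧ (lookup∘tabulate (λ i → not (S ! i)) j)))) |S′|))
          (∈-cartesianProduct⁺ (∈-upTo⁺ c<) (∈-upTo⁺ r<)))))
      (subst (λ z → Rigid (Moderate? β) E E′ E z c r s M) (sym (negate-involutive S)) rigid))

  -- Each pair gains only the factor `1 + 1/(β + 1)²`, so the list must be short: `D` is `E`, and
  -- the three listed rows have at most `L`, `L` and `2 * L` true entries.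
  sparse-rigid-rare : ∀ x β L s → 1 ≤ n →
    x * (suc n ^ L * (suc n ^ L * (suc n ^ (2 * L) * (suc n * (2 * n))))) * (suc β * suc β) ^ s ≤ (1 + suc β * suc β) ^ s →
    x * # (SomeSparseRigid? β L s) ≤ # (Reg? d)
  sparse-rigid-rare x β L s 1≤n numeric = union-rare (SparseRigid? β L s) (sparse-params β L s) x _ ((1 + suc β * suc β) ^ s) ((suc β * suc β) ^ s)
    (length-product-≤ (sparse-rows n L) _ (length-sparse-rows n L) (length-product-≤ (sparse-rows n L) _ (length-sparse-rows n L)
      (length-product-≤ (sparse-rows n (2 * L)) _ (length-sparse-rows n (2 * L))
        (length-product-≤ (upTo (suc n)) (upTo (2 * n)) (≤-reflexive (length-upTo (suc n))) (≤-reflexive (length-upTo (2 * n)))))))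
    (*-mono-≤ (m^n>0 (suc n) L) (*-mono-≤ (m^n>0 (suc n) L) (*-mono-≤ (m^n>0 (suc n) (2 * L)) (*-mono-≤ {1} {suc n} (s≤s z≤n) (≤-trans 1≤n (m≤m+n n (n + 0)))))))
    (m^n>0 (suc β * suc β) s) each numeric
    where
    each : ∀ p → (1 + suc β * suc β) ^ s * # (SparseRigid? β L s p) ≤ (suc β * suc β) ^ s * # (Reg? d)
    each (E , (E′ , (S′ , (c , r)))) = rigid-rare (Moderate? β) E E′ E (negate S′) c r s 1 (suc β * suc β)
      (λ pre F Q? inv → LocalBounds.small-switch ω once (E !_) (E′ !_) (E !_) (proj₁ pre) (proj₂ pre) c F Q? inv β _
         (λ { M (qc , (((h₁ , _) , (_ , h₄)) , ((_ , b₂) , (b₃ , _)))) → qc , ((b₂ , b₃) , (h₁ , h₄)) }))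

-- Growth of the parameters

suc≤2^ : ∀ m → suc m ≤ 2 ^ m
suc≤2^ zero = ≤-refl
suc≤2^ (suc m) = ≤-trans (≤-reflexive (+-comm 1 (suc m))) (≤-trans (+-mono-≤ (suc≤2^ m) (m^n>0 2 m)) (≤-reflexive (cong (2 ^ m +_) (sym (+-identityʳ (2 ^ m))))))

binary-length : ∀ n → ∃[ l ] (suc n ≤ 2 ^ l × 2 ^ l ≤ 2 * suc n)
binary-length zero = 0 , ≤-refl , s≤s z≤n
binary-length (suc n) with binary-length n
... | l , lo , hi with suc (suc n) ≤? 2 ^ l
... | yes p = l , p , ≤-trans hi (*-monoʳ-≤ 2 (n≤1+n (suc n)))
... | no ¬p = suc l , ≤-trans (s≤s (s≤s (m≤m+n n (n + 0)))) (≤-trans (≤-reflexive (cong suc (sym (+-suc n (n + 0))))) (*-monoʳ-≤ 2 lo)) ,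
                *-monoʳ-≤ 2 (<⇒≤ (≰⇒> ¬p))

*-^ : ∀ a b q → (a * b) ^ q ≡ a ^ q * b ^ q
*-^ a b zero = refl
*-^ a b (suc q) = trans (cong (a * b *_) (*-^ a b q)) (lem a b (a ^ q) (b ^ q))
  where
  lem : ∀ a b x y → a * b * (x * y) ≡ a * x * (b * y)
  lem = solve-∀

-- With `m = l / q` rounded down, the left side is at most the `q`-th power of
-- `16 * C * q * (m + 1)`. This is below `(m + 1)²` since `16 * C * q ≤ m`, and `(m + 1)² ≤ 4 ^ m`.
polynomial<exponential : ∀ C q .{{_ : NonZero q}} l → 1 ≤ C → 16 * C * q * q ≤ l → 16 * (C * l) ^ q < 4 ^ l
polynomial<exponential C q l 1≤C large = begin-strict
  16 * (C * l) ^ q ≤⟨ *-monoˡ-≤ ((C * l) ^ q) (16≤ q) ⟩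
  16 ^ q * (C * l) ^ q ≡⟨ sym (*-^ 16 (C * l) q) ⟩
  (16 * (C * l)) ^ q ≤⟨ ^-monoˡ-≤ q (*-monoʳ-≤ 16 (*-monoʳ-≤ C (<⇒≤ l<))) ⟩
  (16 * (C * (suc m * q))) ^ q ≡⟨ cong (_^ q) (lem C m q) ⟩
  (16 * C * q * suc m) ^ q <⟨ ^-monoˡ-< q (*-monoˡ-< (suc m) (s≤s m≥)) ⟩
  (suc m * suc m) ^ q ≤⟨ ^-monoˡ-≤ q (*-mono-≤ (suc≤2^ m) (suc≤2^ m)) ⟩
  (2 ^ m * 2 ^ m) ^ q ≡⟨ cong (_^ q) (sym (*-^ 2 2 m)) ⟩
  (4 ^ m) ^ q ≡⟨ ^-*-assoc 4 m q ⟩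
  4 ^ (m * q) ≤⟨ ^-monoʳ-≤ 4 (m/n*n≤m l q) ⟩
  4 ^ l ∎
  where
  open ≤-Reasoning
  m : ℕ
  m = l / q
  16≤ : ∀ q .{{_ : NonZero q}} → 16 ≤ 16 ^ q
  16≤ (suc q) = *-monoʳ-≤ 16 (m^n>0 16 q)
  l< : l < suc m * q
  l< = ≤-trans (s≤s (≤-reflexive (m≡m%n+[m/n]*n l q))) (+-monoˡ-≤ (m * q) (m%n<n l q))
  lem : ∀ C m q → 16 * (C * (suc m * q)) ≡ 16 * C * q * suc m
  lem = solve-∀
  m≥ : 16 * C * q ≤ m
  m≥ = ≤-trans (≤-reflexive (sym (m*n/n≡m (16 * C * q) q))) (/-mono-≤ large (≤-refl {q}))

-- d ≥ n^(1/2 + p/q) makes d² larger than n log n, here with l ≈ log₂ n.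
superlogarithmic : ∀ p q → 0 < p → 0 < q → ∀ C → 1 ≤ C → ∀ n d l → suc (2 ^ (16 * C * q * q)) ≤ n →
                   suc n ≤ 2 ^ l → 2 ^ l ≤ 2 * suc n → n ^ (q + 2 * p) ≤ d ^ (2 * q) → C * n * l ≤ d * d
superlogarithmic p q 0<p 0<q C 1≤C n d l n-large lo hi power with C * n * l ≤? d * d
... | yes h = h
-- Otherwise `n^(q + 2p) ≤ d^(2q)` and `d² < C n l` give `n² ≤ (C l)^q`, because `p ≥ 1`. As
-- `4 ^ l ≤ 16 n²`, an exponential in `l` would be bounded by a polynomial.
... | no ¬h = ⊥-elim (<⇒≱ (polynomial<exponential C q {{>-nonZero 0<q}} l 1≤C l-large) (begin
  4 ^ l ≡⟨ *-^ 2 2 l ⟩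
  2 ^ l * 2 ^ l ≤⟨ *-mono-≤ 2^l≤ 2^l≤ ⟩
  4 * n * (4 * n) ≡⟨ lem₁ n ⟩
  16 * (n * n) ≤⟨ *-monoʳ-≤ 16 square ⟩
  16 * (C * l) ^ q ∎))
  where
  open ≤-Reasoning
  1≤n : 1 ≤ n
  1≤n = ≤-trans (s≤s z≤n) n-large
  instance
    n≢0 : NonZero n
    n≢0 = >-nonZero 1≤n
  lem₁ : ∀ n → 4 * n * (4 * n) ≡ 16 * (n * n)
  lem₁ = solve-∀
  l-large : 16 * C * q * q ≤ l
  l-large with 16 * C * q * q ≤? l
  ... | yes h = h
  ... | no ¬h = ⊥-elim (<⇒≱ n-large (≤-trans (n≤1+n n) (≤-trans lo (^-monoʳ-≤ 2 (<⇒≤ (≰⇒> ¬h))))))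
  2^l≤ : 2 ^ l ≤ 4 * n
  2^l≤ = ≤-trans hi (≤-trans (*-monoʳ-≤ 2 (≤-trans (+-monoˡ-≤ n 1≤n) (≤-reflexive (cong (n +_) (sym (+-identityʳ n)))))) (≤-reflexive (sym (*-assoc 2 2 n))))
  square : n * n ≤ (C * l) ^ q
  square = *-cancelˡ-≤ (n ^ q) {{m^n≢0 n q}} (begin
    n ^ q * (n * n) ≡⟨ cong (λ z → n ^ q * (n * z)) (sym (*-identityʳ n)) ⟩
    n ^ q * n ^ 2 ≤⟨ *-monoʳ-≤ (n ^ q) (^-monoʳ-≤ n (*-monoʳ-≤ 2 0<p)) ⟩
    n ^ q * n ^ (2 * p) ≡⟨ sym (^-distribˡ-+-* n q (2 * p)) ⟩
    n ^ (q + 2 * p) ≤⟨ power ⟩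
    d ^ (2 * q) ≡⟨ trans (sym (^-*-assoc d 2 q)) (cong (λ z → (d * z) ^ q) (*-identityʳ d)) ⟩
    (d * d) ^ q ≤⟨ ^-monoˡ-≤ q (<⇒≤ (≰⇒> ¬h)) ⟩
    (C * n * l) ^ q ≡⟨ cong (_^ q) (lem₂ C n l) ⟩
    (n * (C * l)) ^ q ≡⟨ *-^ n (C * l) q ⟩
    n ^ q * (C * l) ^ q ∎)
    where
    lem₂ : ∀ C n l → C * n * l ≡ n * (C * l)
    lem₂ = solve-∀

-- (1 + 1/h)ʰ ≥ 2
doubling : ∀ h j I → 1 ≤ h → h * j ≤ I → 2 ^ j * h ^ I ≤ suc h ^ I
doubling h j I 1≤h hj≤I with m≤n⇒∃[o]m+o≡n hj≤I
... | o , refl = begin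
  2 ^ j * h ^ (h * j + o) ≡⟨ cong (2 ^ j *_) (trans (^-distribˡ-+-* h (h * j) o) (cong (_* h ^ o) (sym (^-*-assoc h h j)))) ⟩
  2 ^ j * ((h ^ h) ^ j * h ^ o) ≡⟨ trans (sym (*-assoc (2 ^ j) _ _)) (cong (_* h ^ o) (sym (*-^ 2 (h ^ h) j))) ⟩
  (2 * h ^ h) ^ j * h ^ o ≤⟨ *-mono-≤ (^-monoˡ-≤ j twice) (^-monoˡ-≤ o (n≤1+n h)) ⟩
  (suc h ^ h) ^ j * suc h ^ o ≡⟨ trans (cong (_* suc h ^ o) (^-*-assoc (suc h) h j)) (sym (^-distribˡ-+-* (suc h) (h * j) o)) ⟩
  suc h ^ (h * j + o) ∎
  where
  open ≤-Reasoning
  linear : ∀ i → (h + i) * h ^ i ≤ h * suc h ^ i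
  linear zero = ≤-reflexive (cong (_* 1) (+-identityʳ h))
  linear (suc i) = begin
    (h + suc i) * (h * h ^ i) ≡⟨ lem₁ h i (h ^ i) ⟩
    (h + suc i) * h * h ^ i ≤⟨ *-monoˡ-≤ (h ^ i) (≤-trans (m≤m+n _ i) (≤-reflexive (lem₂ h i))) ⟩
    suc h * (h + i) * h ^ i ≡⟨ *-assoc (suc h) (h + i) (h ^ i) ⟩
    suc h * ((h + i) * h ^ i) ≤⟨ *-monoʳ-≤ (suc h) (linear i) ⟩
    suc h * (h * suc h ^ i) ≡⟨ lem₃ h (suc h) (suc h ^ i) ⟩
    h * (suc h * suc h ^ i) ∎
    where
    lem₁ : ∀ h i x → (h + suc i) * (h * x) ≡ (h + suc i) * h * x
    lem₁ = solve-∀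
    lem₂ : ∀ h i → (h + suc i) * h + i ≡ suc h * (h + i)
    lem₂ = solve-∀
    lem₃ : ∀ h y x → y * (h * x) ≡ h * (y * x)
    lem₃ = solve-∀
  twice : 2 * h ^ h ≤ suc h ^ h
  twice = *-cancelˡ-≤ h {{>-nonZero 1≤h}} (≤-trans (≤-reflexive (lem h (h ^ h))) (linear h))
    where
    lem : ∀ h x → h * (2 * x) ≡ (h + h) * x
    lem = solve-∀

-- Choice of the constants

module Numbers (k c : ℕ) (1≤k : 1 ≤ k) where

  opaque
    -- `G` makes deviating pairs rare. With `s ≥ n / (512 k²)` pairs, `w` ensures that `2 ^ (w * s)`
    -- beats about `2^(5n)` configurations, where `2560 = 5 * 512`; `K` gains this per pair after
    -- the loss of 4. `T` is the order of the differences of typical rows, and `q` the loss in a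
    -- sparse switch. `C₁` yields `8 * q * l * L ≤ s`, where `4096 = 8 * 512`. The summands of `C`
    -- provide enough switches for the codegrees, absorb the rounding in the codegree bound, and
    -- ensure `C₁ * l * L ≤ n`.
    G w K T q C₁ C N₀ : ℕ
    G = 1024 * (k * k)
    w = 2560 * (k * k)
    K = 4 * 2 ^ w
    T = 4 * G + 4 * (16 * K * K)
    q = suc (2 * suc T) * suc (2 * suc T)
    C₁ = 4096 * (k * k) * q
    C = 36 * G * (4 * (36 * G + 1) + 1) + 84 * G + C₁ * suc T
    N₀ = 256 * (k * k) + c + 8

  θ β h : ℕ
  θ = 16 * K * K
  β = 2 * suc T
  h = 36 * G + 1

  1≤k² : 1 ≤ k * k
  1≤k² = *-mono-≤ 1≤k 1≤k

  opaque
    unfolding G w K T q C₁ C N₀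

    G-def : G ≡ 1024 * (k * k)
    G-def = refl

    w-def : w ≡ 2560 * (k * k)
    w-def = refl

    K-def : K ≡ 4 * 2 ^ w
    K-def = refl

    q-def : q ≡ suc β * suc β
    q-def = refl

    C₁-def : C₁ ≡ 4096 * (k * k) * q
    C₁-def = refl

    4G≤T : 4 * G ≤ T
    4G≤T = m≤m+n (4 * G) (4 * (16 * K * K))

    4θ≤T : 4 * θ ≤ T
    4θ≤T = m≤n+m (4 * (16 * K * K)) (4 * G)

    C≥₁ : 36 * G * (4 * h + 1) ≤ C
    C≥₁ = ≤-trans (m≤m+n (36 * G * (4 * (36 * G + 1) + 1)) (84 * G)) (m≤m+n (36 * G * (4 * (36 * G + 1) + 1) + 84 * G) (C₁ * suc T))

    C≥₂ : 84 * G ≤ C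
    C≥₂ = ≤-trans (m≤n+m (84 * G) (36 * G * (4 * (36 * G + 1) + 1))) (m≤m+n (36 * G * (4 * (36 * G + 1) + 1) + 84 * G) (C₁ * suc T))

    C≥₃ : C₁ * suc T ≤ C
    C≥₃ = m≤n+m (C₁ * suc T) (36 * G * (4 * (36 * G + 1) + 1) + 84 * G)

    N₀≥₁ : 256 * (k * k) ≤ N₀
    N₀≥₁ = ≤-trans (m≤m+n (256 * (k * k)) c) (m≤m+n (256 * (k * k) + c) 8)

    N₀≥₂ : c ≤ N₀
    N₀≥₂ = ≤-trans (m≤n+m c (256 * (k * k))) (m≤m+n (256 * (k * k) + c) 8)

    N₀≥₃ : 8 ≤ N₀
    N₀≥₃ = m≤n+m 8 (256 * (k * k) + c)

    1≤K : 1 ≤ K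
    1≤K = *-mono-≤ {1} {4} (s≤s z≤n) (m^n>0 2 w)

  1≤G : 1 ≤ G
  1≤G = ≤-trans (*-mono-≤ {1} {1024} (s≤s z≤n) 1≤k²) (≤-reflexive (sym G-def))

  1≤C : 1 ≤ C
  1≤C = ≤-trans (*-mono-≤ {1} {84} (s≤s z≤n) 1≤G) C≥₂

  1≤q : 1 ≤ q
  1≤q = ≤-trans (s≤s z≤n) (≤-reflexive (sym q-def))

  1≤C₁ : 1 ≤ C₁
  1≤C₁ = ≤-trans (*-mono-≤ (*-mono-≤ {1} {4096} (s≤s z≤n) 1≤k²) 1≤q) (≤-reflexive (sym C₁-def))

  module At (n d l : ℕ) (n≥ : N₀ ≤ n) (n<2^l : suc n ≤ 2 ^ l) (dense : C * n * l ≤ d * d) (2d≤n : 2 * d ≤ n) where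

    256k²≤n : 256 * (k * k) ≤ n
    256k²≤n = ≤-trans N₀≥₁ n≥

    c≤n : c ≤ n
    c≤n = ≤-trans N₀≥₂ n≥

    8≤n : 8 ≤ n
    8≤n = ≤-trans N₀≥₃ n≥

    1≤n : 1 ≤ n
    1≤n = ≤-trans (s≤s z≤n) 8≤n

    1≤l : 1 ≤ l
    1≤l = positive l n<2^l
      where
      positive : ∀ l → suc n ≤ 2 ^ l → 1 ≤ l
      positive zero lt = ⊥-elim (<⇒≱ (s≤s 1≤n) lt)
      positive (suc _) _ = s≤s z≤n

    1≤d : 1 ≤ d
    1≤d = positive d dense
      where
      positive : ∀ d → C * n * l ≤ d * d → 1 ≤ d
      positive zero h = ⊥-elim (<⇒≱ (*-mono-≤ (*-mono-≤ 1≤C 1≤n) 1≤l) h)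
      positive (suc _) _ = s≤s z≤n

    instance
      n≢0 : NonZero n
      n≢0 = >-nonZero 1≤n
      d≢0 : NonZero d
      d≢0 = >-nonZero 1≤d

    d-large : 2 * (C * l) ≤ d
    d-large = *-cancelʳ-≤ _ _ d (begin
      2 * (C * l) * d ≡⟨ lem₁ C l d ⟩
      2 * d * (C * l) ≤⟨ *-monoˡ-≤ (C * l) 2d≤n ⟩
      n * (C * l) ≡⟨ lem₂ n C l ⟩
      C * n * l ≤⟨ dense ⟩
      d * d ∎)
      where
      open ≤-Reasoning
      lem₁ : ∀ C l d → 2 * (C * l) * d ≡ 2 * d * (C * l)
      lem₁ = solve-∀
      lem₂ : ∀ n C l → n * (C * l) ≡ C * n * l
      lem₂ = solve-∀

    Cl≤d : C * l ≤ d
    Cl≤d = ≤-trans (m≤m+n _ _) d-large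

    -- `L` is the least number with `L * d > T * n`. `Q` is `d² / n` rounded down, and `B` exceeds
    -- it by one so that `average` holds. `3 * I` is at most `Q / (12 G)`, half of the relative
    -- error `1 / (6 G)` granted to `cod`; still `I` is of order `d² / n` and so at least the
    -- required multiple of `l`.
    L s Q I B cod : ℕ
    L = suc (T * n / d)
    s = n / (256 * (k * k))
      where instance _ = >-nonZero (*-mono-≤ {1} {256} (s≤s z≤n) 1≤k²)
    Q = d * d / n
    I = Q / (36 * G)
      where instance _ = >-nonZero (*-mono-≤ {1} {36} (s≤s z≤n) 1≤G)
    B = suc Q
    cod = B + (3 * I + 6)

    below-next : ∀ a b .{{_ : NonZero b}} → a < suc (a / b) * b
    below-next a b = ≤-trans (s≤s (≤-reflexive (m≡m%n+[m/n]*n a b))) (+-monoˡ-≤ (a / b * b) (m%n<n a b))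

    lowL : T * n ≤ L * d
    lowL = <⇒≤ (below-next (T * n) d)

    highL : L * d ≤ suc T * n
    highL = +-mono-≤ (≤-trans (m≤m+n d _) 2d≤n) (m/n*n≤m (T * n) d)

    1≤L : 1 ≤ L
    1≤L = s≤s z≤n

    Ll≤n : C₁ * (l * L) ≤ n
    Ll≤n = *-cancelʳ-≤ _ _ d (begin
      C₁ * (l * L) * d ≡⟨ lem₁ C₁ l L d ⟩
      C₁ * l * (L * d) ≤⟨ *-monoʳ-≤ (C₁ * l) highL ⟩
      C₁ * l * (suc T * n) ≡⟨ lem₂ C₁ l (suc T) n ⟩
      C₁ * suc T * l * n ≤⟨ *-monoˡ-≤ n (≤-trans (*-monoˡ-≤ l C≥₃) Cl≤d) ⟩
      d * n ≡⟨ *-comm d n ⟩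
      n * d ∎)
      where
      open ≤-Reasoning
      lem₁ : ∀ C l L d → C * (l * L) * d ≡ C * l * (L * d)
      lem₁ = solve-∀
      lem₂ : ∀ C l t n → C * l * (t * n) ≡ C * t * l * n
      lem₂ = solve-∀

    32kL≤n : 32 * k * L ≤ n
    32kL≤n = ≤-trans (*-mono-≤ {32 * k} {C₁} (≤-trans (*-mono-≤ {32} {4096} (m≤m+n 32 4064) (≤-trans (≤-reflexive (sym (*-identityʳ k))) (*-monoʳ-≤ k 1≤k)))
                                                  (≤-trans (≤-reflexive (sym (*-identityʳ (4096 * (k * k))))) (≤-trans (*-monoʳ-≤ (4096 * (k * k)) 1≤q) (≤-reflexive (sym C₁-def)))))
                                (≤-trans (≤-reflexive (sym (*-identityˡ L))) (*-monoˡ-≤ L 1≤l))) Ll≤n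

    L≤d : L ≤ d
    L≤d = *-cancelʳ-≤ L d d (begin
      L * d ≤⟨ highL ⟩
      suc T * n ≤⟨ *-monoˡ-≤ n (≤-trans (≤-trans (≤-reflexive (sym (*-identityˡ (suc T)))) (*-monoˡ-≤ (suc T) 1≤C₁)) C≥₃) ⟩
      C * n ≡⟨ sym (*-identityʳ (C * n)) ⟩
      C * n * 1 ≤⟨ *-monoʳ-≤ (C * n) 1≤l ⟩
      C * n * l ≤⟨ dense ⟩
      d * d ∎)
      where open ≤-Reasoning

    64k²≤n : 64 * (k * k) ≤ n
    64k²≤n = ≤-trans (*-monoˡ-≤ (k * k) {64} {256} (m≤m+n 64 192)) 256k²≤n

    s-small : 256 * (k * k) * s ≤ n
    s-small = ≤-trans (≤-reflexive (*-comm (256 * (k * k)) s)) (m/n*n≤m n (256 * (k * k)))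
      where instance _ = >-nonZero (*-mono-≤ {1} {256} (s≤s z≤n) 1≤k²)

    s-large : n ≤ 512 * (k * k) * s
    s-large = begin
      n ≤⟨ <⇒≤ (below-next n (256 * (k * k))) ⟩
      suc s * (256 * (k * k)) ≤⟨ *-monoˡ-≤ (256 * (k * k)) (≤-trans (+-monoˡ-≤ s 1≤s) (≤-reflexive (cong (s +_) (sym (+-identityʳ s))))) ⟩
      2 * s * (256 * (k * k)) ≡⟨ lem s (k * k) ⟩
      512 * (k * k) * s ∎
      where
      open ≤-Reasoning
      instance _ = >-nonZero (*-mono-≤ {1} {256} (s≤s z≤n) 1≤k²)
      1≤s : 1 ≤ s
      1≤s = ≤-trans (≤-reflexive (sym (trans (cong (_/ (256 * (k * k))) (sym (*-identityˡ (256 * (k * k))))) (m*n/n≡m 1 (256 * (k * k)))))) (/-mono-≤ 256k²≤n (≤-refl {256 * (k * k)}))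
      lem : ∀ s u → 2 * s * (256 * u) ≡ 512 * u * s
      lem = solve-∀

    4l≤n : 4 * l ≤ n
    4l≤n = ≤-trans (≤-trans (≤-reflexive (*-assoc 2 2 l)) (*-monoʳ-≤ 2 (≤-trans (*-monoʳ-≤ 2 (≤-trans (≤-reflexive (sym (*-identityˡ l))) (*-monoˡ-≤ l 1≤C))) d-large))) 2d≤n

    Q-low : Q * n ≤ d * d
    Q-low = m/n*n≤m (d * d) n

    Q-high : d * d < suc Q * n
    Q-high = below-next (d * d) n

    I-low : 36 * G * I ≤ Q
    I-low = ≤-trans (≤-reflexive (*-comm (36 * G) I)) (m/n*n≤m Q (36 * G))
      where instance _ = >-nonZero (*-mono-≤ {1} {36} (s≤s z≤n) 1≤G)

    I-high : suc Q ≤ 36 * G * suc I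
    I-high = ≤-trans (below-next Q (36 * G)) (≤-reflexive (*-comm (suc I) (36 * G)))
      where instance _ = >-nonZero (*-mono-≤ {1} {36} (s≤s z≤n) 1≤G)

    I-large : h * (4 * l) ≤ I
    I-large = ≤-trans (≤-trans (≤-reflexive (lem h l)) (*-monoˡ-≤ l (m≤m+n (4 * h) 1))) (s≤s⁻¹ (*-cancelˡ-< (36 * G) _ _ (begin-strict
      36 * G * ((4 * h + 1) * l) ≡⟨ sym (*-assoc (36 * G) (4 * h + 1) l) ⟩
      36 * G * (4 * h + 1) * l ≤⟨ *-monoˡ-≤ l C≥₁ ⟩
      C * l <⟨ *-cancelʳ-< n _ _ (≤-<-trans (≤-trans (≤-reflexive (lem′ C l n)) dense) Q-high) ⟩
      suc Q ≤⟨ I-high ⟩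
      36 * G * suc I ∎)))
      where
      open ≤-Reasoning
      lem : ∀ h l → h * (4 * l) ≡ 4 * h * l
      lem = solve-∀
      lem′ : ∀ C l n → C * l * n ≡ C * n * l
      lem′ = solve-∀

    BI : B + I ≤ h * (I + 2)
    BI = begin
      suc Q + I ≤⟨ +-monoˡ-≤ I I-high ⟩
      36 * G * suc I + I ≤⟨ +-mono-≤ (*-monoʳ-≤ (36 * G) (≤-trans (≤-reflexive (+-comm 1 I)) (+-monoʳ-≤ I (s≤s z≤n)))) (m≤m+n I 2) ⟩
      36 * G * (I + 2) + (I + 2) ≡⟨ lem G (I + 2) ⟩
      h * (I + 2) ∎
      where
      open ≤-Reasoning
      lem : ∀ G x → 36 * G * x + x ≡ (36 * G + 1) * x
      lem = solve-∀

    average : d * d + 2 * suc B < n * suc B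
    average = begin-strict
      d * d + 2 * suc B <⟨ +-monoˡ-< (2 * suc B) Q-high ⟩
      suc Q * n + 2 * suc (suc Q) ≤⟨ +-monoʳ-≤ (suc Q * n) (*-cancelˡ-≤ 2 small) ⟩
      suc Q * n + n ≡⟨ trans (+-comm (suc Q * n) n) (*-comm (suc (suc Q)) n) ⟩
      n * suc B ∎
      where
      open ≤-Reasoning
      4Q≤n : 4 * Q ≤ n
      4Q≤n = *-cancelʳ-≤ _ _ n (begin
        4 * Q * n ≡⟨ *-assoc 4 Q n ⟩
        4 * (Q * n) ≤⟨ *-monoʳ-≤ 4 Q-low ⟩
        4 * (d * d) ≡⟨ lem d ⟩
        2 * d * (2 * d) ≤⟨ *-mono-≤ 2d≤n 2d≤n ⟩
        n * n ∎)
        where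
        lem : ∀ d → 4 * (d * d) ≡ 2 * d * (2 * d)
        lem = solve-∀
      small : 2 * (2 * suc (suc Q)) ≤ 2 * n
      small = begin
        2 * (2 * suc (suc Q)) ≡⟨ lem Q ⟩
        8 + 4 * Q ≤⟨ +-mono-≤ 8≤n 4Q≤n ⟩
        n + n ≡⟨ cong (n +_) (sym (+-identityʳ n)) ⟩
        2 * n ∎
        where
        lem : ∀ Q → 2 * (2 * suc (suc Q)) ≡ 8 + 4 * Q
        lem = solve-∀

    cod-small : 6 * G * (n * cod) ≤ suc (6 * G) * (d * d)
    cod-small = *-cancelˡ-≤ 2 (begin
      2 * (6 * G * (n * (suc Q + (3 * I + 6)))) ≡⟨ lem₁ G n Q I ⟩
      12 * G * (Q * n) + 36 * G * I * n + 84 * G * n * 1 ≤⟨ +-mono-≤ (+-mono-≤ (*-monoʳ-≤ (12 * G) Q-low) (≤-trans (*-monoˡ-≤ n I-low) Q-low))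
                                                                (≤-trans (*-mono-≤ (*-monoˡ-≤ n C≥₂) 1≤l) dense) ⟩
      12 * G * (d * d) + d * d + d * d ≡⟨ lem₂ G (d * d) ⟩
      2 * (suc (6 * G) * (d * d)) ∎)
      where
      open ≤-Reasoning
      lem₁ : ∀ G n Q I → 2 * (6 * G * (n * (suc Q + (3 * I + 6)))) ≡ 12 * G * (Q * n) + 36 * G * I * n + 84 * G * n * 1
      lem₁ = solve-∀
      lem₂ : ∀ G x → 12 * G * x + x + x ≡ 2 * (suc (6 * G) * x)
      lem₂ = solve-∀

    n≤2^l : n ≤ 2 ^ l
    n≤2^l = ≤-trans (n≤1+n n) n<2^l

    c≤2^l : c ≤ 2 ^ l
    c≤2^l = ≤-trans c≤n n≤2^l

    ^-merge : ∀ {x y} a b → x ≤ 2 ^ a → y ≤ 2 ^ b → x * y ≤ 2 ^ (a + b)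
    ^-merge a b p r = ≤-trans (*-mono-≤ p r) (≤-reflexive (sym (^-distribˡ-+-* 2 a b)))

    -- The triples and `c` together cost at most `2 ^ (4 * l)`, and `h` switches gain a factor of at
    -- least 2.
    numericA : c * (n * (n * n)) * h ^ I ≤ suc h ^ I
    numericA = ≤-trans (*-monoˡ-≤ (h ^ I) (≤-trans (^-merge l _ c≤2^l (^-merge l _ n≤2^l (^-merge l l n≤2^l n≤2^l))) (≤-reflexive (cong (2 ^_) (lem l)))))
                       (doubling h (4 * l) I (m≤n+m 1 (36 * G)) I-large)
      where
      lem : ∀ l → l + (l + (l + l)) ≡ 4 * l
      lem = solve-∀

    grid : suc n * (2 * n) ≤ 2 ^ (l + (1 + l))
    grid = ^-merge l (1 + l) n<2^l (*-monoʳ-≤ 2 n≤2^l)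

    -- The exponent of 2 is `4 * n` plus logarithmic terms, at most `5 * n ≤ w * s`; and `2 ^ w * 4`
    -- is `K`.
    numericB : c * (2 ^ n * (2 ^ n * (2 ^ n * (2 ^ n * (suc n * (2 * n)))))) * 4 ^ s ≤ (K + 4) ^ s
    numericB = begin
      c * (2 ^ n * (2 ^ n * (2 ^ n * (2 ^ n * (suc n * (2 * n)))))) * 4 ^ s
        ≤⟨ *-monoˡ-≤ (4 ^ s) (^-merge l _ c≤2^l (^-merge n _ ≤-refl (^-merge n _ ≤-refl (^-merge n _ ≤-refl (^-merge n _ ≤-refl grid))))) ⟩
      2 ^ (l + (n + (n + (n + (n + (l + (1 + l))))))) * 4 ^ s
        ≤⟨ *-monoˡ-≤ (4 ^ s) (^-monoʳ-≤ 2 exponent) ⟩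
      2 ^ (w * s) * 4 ^ s
        ≡⟨ trans (*-comm (2 ^ (w * s)) (4 ^ s)) (trans (cong (4 ^ s *_) (sym (^-*-assoc 2 w s))) (trans (sym (*-^ 4 (2 ^ w) s)) (cong (_^ s) (sym K-def)))) ⟩
      K ^ s
        ≤⟨ ^-monoˡ-≤ s (m≤m+n K 4) ⟩
      (K + 4) ^ s ∎
      where
      open ≤-Reasoning
      exponent : l + (n + (n + (n + (n + (l + (1 + l)))))) ≤ w * s
      exponent = begin
        l + (n + (n + (n + (n + (l + (1 + l)))))) ≡⟨ lem₁ l n ⟩
        4 * n + (3 * l + 1) ≤⟨ +-monoʳ-≤ (4 * n) (+-monoʳ-≤ (3 * l) 1≤l) ⟩
        4 * n + (3 * l + l) ≡⟨ cong (4 * n +_) (+-comm (3 * l) l) ⟩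
        4 * n + 4 * l ≤⟨ +-monoʳ-≤ (4 * n) 4l≤n ⟩
        4 * n + n ≡⟨ +-comm (4 * n) n ⟩
        5 * n ≤⟨ *-monoʳ-≤ 5 s-large ⟩
        5 * (512 * (k * k) * s) ≡⟨ trans (lem₂ (k * k) s) (cong (_* s) (sym w-def)) ⟩
        w * s ∎
        where
        lem₁ : ∀ l n → l + (n + (n + (n + (n + (l + (1 + l)))))) ≡ 4 * n + (3 * l + 1)
        lem₁ = solve-∀
        lem₂ : ∀ u s → 5 * (512 * u * s) ≡ 2560 * u * s
        lem₂ = solve-∀

    -- All sets together cost about `2 ^ (4 * l * L)`, and every `q` pairs gain a factor of at least
    -- 2. The lower-order terms are absorbed by doubling the exponent to `8 * l * L`.
    numericC : c * (suc n ^ L * (suc n ^ L * (suc n ^ (2 * L) * (suc n * (2 * n))))) * q ^ s ≤ suc q ^ s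
    numericC = ≤-trans (*-monoˡ-≤ (q ^ s) (^-merge l _ c≤2^l (^-merge (l * L) _ (power L) (^-merge (l * L) _ (power L) (^-merge (l * (2 * L)) _ (power (2 * L)) grid)))))
                       (doubling q (l + (l * L + (l * L + (l * (2 * L) + (l + (1 + l)))))) s 1≤q exponent)
      where
      open ≤-Reasoning
      power : ∀ i → suc n ^ i ≤ 2 ^ (l * i)
      power i = ≤-trans (^-monoˡ-≤ i n<2^l) (≤-reflexive (^-*-assoc 2 l i))
      1≤lL : 1 ≤ l * L
      1≤lL = *-mono-≤ 1≤l 1≤L
      l≤lL : l ≤ l * L
      l≤lL = ≤-trans (≤-reflexive (sym (*-identityʳ l))) (*-monoʳ-≤ l 1≤L)
      exponent : q * (l + (l * L + (l * L + (l * (2 * L) + (l + (1 + l)))))) ≤ s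
      exponent = *-cancelˡ-≤ (512 * (k * k)) {{>-nonZero (*-mono-≤ {1} {512} (s≤s z≤n) 1≤k²)}} (begin
        512 * (k * k) * (q * (l + (l * L + (l * L + (l * (2 * L) + (l + (1 + l))))))) ≡⟨ cong (λ z → 512 * (k * k) * (q * z)) (lem₁ l L) ⟩
        512 * (k * k) * (q * (4 * (l * L) + (3 * l + 1))) ≤⟨ *-monoʳ-≤ (512 * (k * k)) (*-monoʳ-≤ q (+-monoʳ-≤ (4 * (l * L)) (+-mono-≤ (*-monoʳ-≤ 3 l≤lL) 1≤lL))) ⟩
        512 * (k * k) * (q * (4 * (l * L) + (3 * (l * L) + l * L))) ≡⟨ trans (lem₂ (k * k) q (l * L)) (cong (_* (l * L)) (sym C₁-def)) ⟩
        C₁ * (l * L) ≤⟨ Ll≤n ⟩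
        n ≤⟨ s-large ⟩
        512 * (k * k) * s ∎)
        where
        lem₁ : ∀ l L → l + (l * L + (l * L + (l * (2 * L) + (l + (1 + l))))) ≡ 4 * (l * L) + (3 * l + 1)
        lem₁ = solve-∀
        lem₂ : ∀ u q z → 512 * u * (q * (4 * z + (3 * z + z))) ≡ 4096 * u * q * z
        lem₂ = solve-∀

-- Enumeration of the regular graphs

listSum-cong : ∀ {X : Set} {f g : X → ℕ} → (∀ x → f x ≡ g x) → ∀ L → listSum f L ≡ listSum g L
listSum-cong h [] = refl
listSum-cong h (x ∷ L) = cong₂ _+_ (h x) (listSum-cong h L)

listSum-*ˡ : ∀ {X : Set} c (g : X → ℕ) L → listSum (λ x → c * g x) L ≡ c * listSum g L
listSum-*ˡ c g [] = sym (*-zeroʳ c)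
listSum-*ˡ c g (x ∷ L) = trans (cong (c * g x +_) (listSum-*ˡ c g L)) (sym (*-distribˡ-+ c (g x) _))

listSum-concatMap : ∀ {X Y : Set} (g : Y → ℕ) (f : X → List Y) L → listSum g (concatMap f L) ≡ listSum (λ x → listSum g (f x)) L
listSum-concatMap g f [] = refl
listSum-concatMap g f (x ∷ L) = trans (listSum-++ g (f x) (concatMap f L)) (cong (listSum g (f x) +_) (listSum-concatMap g f L))

listSum-lookup : ∀ {X : Set} (g : X → ℕ) L → ∑ (λ i → g (lookup L i)) ≡ listSum g L
listSum-lookup g [] = sum-zero {f = λ i → g (lookup [] i)} (λ ())
listSum-lookup g (x ∷ L) = trans (sum-suc (λ i → g (lookup (x ∷ L) i))) (cong (g x +_) (listSum-lookup g L))

length-filter : ∀ {X : Set} {P : X → Set} (P? : ∀ x → Dec (P x)) L → length (filter P? L) ≡ listSum (λ x → [ P? x ]) L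
length-filter P? [] = refl
length-filter P? (x ∷ L) with P? x
... | yes _ = cong suc (length-filter P? L)
... | no _ = length-filter P? L

-- Listed functions are compared with vectors after tabulation, since vectors have decidable
-- equality. `f` transforms the entries: the identity yields rows, and `tabulate` then yields
-- matrices row by row.
allFunsTo-once : ∀ {A B : Set} (_≟_ : DecidableEquality B) (f : A → B) (xs : List A) → (∀ b → listSum (λ a → [ f a ≟ b ]) xs ≡ 1) →
                 ∀ k (v : Vec B k) → listSum (λ g → [ ≡-dec _≟_ (tabulate (f ∘ g)) v ]) (allFunsTo xs k) ≡ 1
allFunsTo-once _≟_ f xs once zero [] = refl
allFunsTo-once _≟_ f xs once (suc k) (b ∷ v) = begin
  listSum F (concatMap (λ a → map (consF a) (allFunsTo xs k)) xs) ≡⟨ listSum-concatMap F (λ a → map (consF a) (allFunsTo xs k)) xs ⟩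
  listSum (λ a → listSum F (map (consF a) (allFunsTo xs k))) xs ≡⟨ listSum-cong (λ a → trans (listSum-map F (consF a) (allFunsTo xs k)) (listSum-cong (λ g → factor a g) (allFunsTo xs k))) xs ⟩
  listSum (λ a → listSum (λ g → [ f a ≟ b ] * H g) (allFunsTo xs k)) xs ≡⟨ listSum-cong (λ a → trans (listSum-*ˡ [ f a ≟ b ] H (allFunsTo xs k))
                                                                                           (trans (cong ([ f a ≟ b ] *_) (allFunsTo-once _≟_ f xs once k v)) (*-identityʳ _))) xs ⟩
  listSum (λ a → [ f a ≟ b ]) xs ≡⟨ once b ⟩
  1 ∎
  where
  open ≡-Reasoning
  F = λ g → [ ≡-dec _≟_ (tabulate (f ∘ g)) (b ∷ v) ]
  H = λ g → [ ≡-dec _≟_ (tabulate (f ∘ g)) v ]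
  factor : ∀ a g → F (consF a g) ≡ [ f a ≟ b ] * H g
  factor a g = trans ([]-cong (≡-dec _≟_ (tabulate (f ∘ consF a g)) (b ∷ v)) ((f a ≟ b) ×-dec ≡-dec _≟_ (tabulate (f ∘ g)) v)
                        (λ { refl → refl , refl }) (λ { (refl , refl) → refl }))
                     ([]-× (f a ≟ b) (≡-dec _≟_ (tabulate (f ∘ g)) v))

bool-once : ∀ b → listSum (λ a → [ a ≟B b ]) (true ∷ false ∷ []) ≡ 1
bool-once true = refl
bool-once false = refl

row-list : ∀ n → List (Fin n → Bool)
row-list n = allFunsTo (true ∷ false ∷ []) n

toVG : ∀ {n} → Graph n → VG n
toVG G = tabulate (λ i → tabulate (G i))

toVG-at : ∀ {n} (G : Graph n) i j → toVG G ! i ! j ≡ G i j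
toVG-at G i j = trans (cong (_! j) (lookup∘tabulate (λ i → tabulate (G i)) i)) (lookup∘tabulate (G i) j)

countTrue-cong : ∀ {n} {f g : Fin n → Bool} → (∀ i → f i ≡ g i) → countTrue f ≡ countTrue g
countTrue-cong {zero} h = refl
countTrue-cong {suc n} h = cong₂ (λ b z → ⟦ b ⟧ + z) (h zero) (countTrue-cong (h ∘ suc))

allB-cong : ∀ {n} {f g : Fin n → Bool} → (∀ i → f i ≡ g i) → allB f ≡ allB g
allB-cong {zero} h = refl
allB-cong {suc n} h = cong₂ _∧_ (h zero) (allB-cong (h ∘ suc))

sameColour-cong : ∀ {n} {G H : Graph n} → (∀ i j → G i j ≡ H i j) → ∀ part t v w → sameColour G part t v w ≡ sameColour H part t v w
sameColour-cong h part zero v w = refl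
sameColour-cong h part (suc t) v w = cong₂ _∧_ (sameColour-cong h part t v w) (allB-cong (λ u →
  cong₂ _≡ᵇ_ (countTrue-cong (λ x → cong₂ _∧_ (h v x) (sameColour-cong h part t x u)))
             (countTrue-cong (λ x → cong₂ _∧_ (h w x) (sameColour-cong h part t x u)))))

isRegular⇒Reg : ∀ {n} d (G : Graph n) → isRegular d G ≡ true → Reg d (toVG G)
isRegular⇒Reg {n} d G h = (λ i j → trans (toVG-at G i j) (trans (==B-elim _ _ (allB-elim _ (proj₁ (∧-true (at i))) j)) (sym (toVG-at G j i)))) ,
                          (λ i → trans (toVG-at G i i) (not-true (proj₁ (∧-true (proj₂ (∧-true {allB (λ j → G i j ==B G j i)} (at i))))))) ,
                          (λ i → trans (degree-at i) (≡ᵇ-elim _ _ (proj₂ (∧-true {not (G i i)} (proj₂ (∧-true {allB (λ j → G i j ==B G j i)} (at i)))))))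
  where
  at : ∀ i → allB (λ j → G i j ==B G j i) ∧ not (G i i) ∧ (degree G i ≡ᵇ d) ≡ true
  at i = allB-elim _ h i
  degree-at : ∀ i → dg (λ _ → true) (toVG G ! i) ≡ degree G i
  degree-at i = trans (sum-cong (λ j → cong ⟦_⟧ (toVG-at G i j))) (sym (countTrue≡∑ (G i)))

Reg⇒isRegular : ∀ {n} d (G : Graph n) → Reg d (toVG G) → isRegular d G ≡ true
Reg⇒isRegular d G (symm , irr , deg) = allB-intro _ (λ i → ∧-intro
  (allB-intro _ (λ j → subst (λ z → (G i j ==B z) ≡ true) (trans (sym (toVG-at G i j)) (trans (symm i j) (toVG-at G j i))) (==B-refl (G i j))))
  (∧-intro (not-false (trans (sym (toVG-at G i i)) (irr i)))
           (≡ᵇ-intro _ _ (trans (countTrue≡∑ (G i)) (trans (sum-cong (λ j → cong ⟦_⟧ (sym (toVG-at G i j)))) (deg i))))))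

-- Bad graphs and the final count

module Conclusion (k t n d l : ℕ) (1≤k : 1 ≤ k)
  (n≥ : Numbers.N₀ k (3 * suc t) 1≤k ≤ n) (n<2^l : suc n ≤ 2 ^ l)
  (dense : Numbers.C k (3 * suc t) 1≤k * n * l ≤ d * d) (2d≤n : 2 * d ≤ n) where

  c : ℕ
  c = 3 * suc t

  open Numbers k c 1≤k
  open At n d l n≥ n<2^l dense 2d≤n

  ω : Fin (length (allGraphs n)) → VG n
  ω i = toVG (lookup (allGraphs n) i)

  ρ : Fin (length (row-list n)) → Row n
  ρ i = tabulate (lookup (row-list n) i)

  row-list-once : ∀ r → listSum (λ f → [ tabulate f ≟R r ]) (row-list n) ≡ 1
  row-list-once r = allFunsTo-once _≟B_ id (true ∷ false ∷ []) bool-once n r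

  row-once : ∀ r → ∑ (λ i → [ ρ i ≟R r ]) ≡ 1
  row-once r = trans (listSum-lookup (λ f → [ tabulate f ≟R r ]) (row-list n)) (row-list-once r)

  once : ∀ M → ∑ (λ i → [ ω i ≟G M ]) ≡ 1
  once M = trans (listSum-lookup (λ G → [ toVG G ≟G M ]) (allGraphs n)) (allFunsTo-once _≟R_ tabulate (row-list n) row-list-once n M)

  open Switches ω once
  open Rare ω once ρ row-once d

  Bad : VG n → Set
  Bad M = Any (λ x → BadTriple B (3 * I + 6) x M) triples ⊎
          (Any (λ p → LargeRigid θ s p M) (params θ s) ⊎ Any (λ p → SparseRigid β L s p M) (sparse-params β L s))

  Bad? : ∀ M → Dec (Bad M)
  Bad? M = BadCodegrees? B (3 * I + 6) M ⊎-dec (SomeLargeRigid? θ s M ⊎-dec SomeSparseRigid? β L s M)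

  []-⊎ : ∀ {P Q : Set} (p : Dec P) (q : Dec Q) → [ p ⊎-dec q ] ≤ [ p ] + [ q ]
  []-⊎ (yes _) q = s≤s z≤n
  []-⊎ (no _) (yes _) = s≤s z≤n
  []-⊎ (no _) (no _) = z≤n

  -- Each of the three bad events has at most a share `1 / c` of the regular graphs, and
  -- `c = 3 * suc t` leaves `1 / suc t` for their union.
  bad-rare : suc t * # Bad? ≤ # (Reg? d)
  bad-rare = *-cancelˡ-≤ 3 (begin
    3 * (suc t * # Bad?) ≡⟨ sym (*-assoc 3 (suc t) (# Bad?)) ⟩
    c * # Bad? ≤⟨ *-monoʳ-≤ c union ⟩
    c * (X + (Y + Z)) ≡⟨ trans (*-distribˡ-+ c X _) (cong (c * X +_) (*-distribˡ-+ c Y Z)) ⟩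
    c * X + (c * Y + c * Z) ≤⟨ +-mono-≤ (codegrees-rare c h I B 1≤n (m≤n+m 1 (36 * G)) BI numericA)
                                                        (+-mono-≤ (large-rigid-rare c K s 1≤n 1≤K numericB)
                                                                  (sparse-rigid-rare c β L s 1≤n (subst (λ z → c * (suc n ^ L * (suc n ^ L * (suc n ^ (2 * L) * (suc n * (2 * n))))) * z ^ s ≤ suc z ^ s) q-def numericC))) ⟩
    # (Reg? d) + (# (Reg? d) + # (Reg? d)) ≡⟨ cong (λ z → # (Reg? d) + (# (Reg? d) + z)) (sym (+-identityʳ (# (Reg? d)))) ⟩
    3 * # (Reg? d) ∎)
    where
    open ≤-Reasoning
    X Y Z : ℕ
    X = # (BadCodegrees? B (3 * I + 6))
    Y = # (SomeLargeRigid? θ s)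
    Z = # (SomeSparseRigid? β L s)
    union : # Bad? ≤ X + (Y + Z)
    union = begin
      # Bad? ≡⟨ #≡total Bad? ⟩
      total (λ M → [ Bad? M ]) ≤⟨ total-mono (λ M → ≤-trans ([]-⊎ (BadCodegrees? B (3 * I + 6) M) (SomeLargeRigid? θ s M ⊎-dec SomeSparseRigid? β L s M))
                                                                   (+-monoʳ-≤ [ BadCodegrees? B (3 * I + 6) M ] ([]-⊎ (SomeLargeRigid? θ s M) (SomeSparseRigid? β L s M)))) ⟩
      total (λ M → [ BadCodegrees? B (3 * I + 6) M ] + ([ SomeLargeRigid? θ s M ] + [ SomeSparseRigid? β L s M ]))
                                              ≡⟨ trans (total-+ (λ M → [ BadCodegrees? B (3 * I + 6) M ]) (λ M → [ SomeLargeRigid? θ s M ] + [ SomeSparseRigid? β L s M ]))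
                                                       (cong₂ _+_ (sym (#≡total (BadCodegrees? B (3 * I + 6))))
                                                         (trans (total-+ (λ M → [ SomeLargeRigid? θ s M ]) (λ M → [ SomeSparseRigid? β L s M ]))
                                                           (cong₂ _+_ (sym (#≡total (SomeLargeRigid? θ s))) (sym (#≡total (SomeSparseRigid? β L s)))))) ⟩
      X + (Y + Z) ∎

  d+m≡n : d + (d + (n ∸ 2 * d)) ≡ n
  d+m≡n = trans (lem d (n ∸ 2 * d)) (m+[n∸m]≡n 2d≤n)
    where
    lem : ∀ d z → d + (d + z) ≡ 2 * d + z
    lem = solve-∀

  classes : ∀ M → Reg d M → ¬ Bad M → (part : Fin n → Bool) → ∃[ v ] part v ≡ true → ∃[ w ] part w ≡ false →
            ∀ v → 2 * k * size (sameColour (graph M) part 2 v) < n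
  classes M reg ok part (v₀ , pv) (w₀ , pw) = Refined.classes-small ω once d (n ∸ 2 * d) d+m≡n M reg 1≤n cod G T L 1≤G 4G≤T lowL highL cod-small codegrees
    k θ s 1≤k G-def 4θ≤T 32kL≤n 64k²≤n s-small L≤d 1≤L
    (no-large-rigid θ s {M} (ok ∘ inj₂ ∘ inj₁)) (no-sparse-rigid β L s {M} (ok ∘ inj₂ ∘ inj₂)) part v₀ w₀ pv pw
    where
    codegrees : ∀ x y → ¬ x ≡ y → codeg M x y ≤ cod
    codegrees x y x≢y = go (Regular.low-codegree d (d + (n ∸ 2 * d)) d+m≡n M reg B x y average)
      where
      go : ∃[ z ] (¬ z ≡ x × ¬ z ≡ y × codeg M x z ≤ B) → codeg M x y ≤ cod
      go (z , z≢x , z≢y , low) = ≮⇒≥ (λ high → balanced-codegrees B (3 * I + 6) {M} (ok ∘ inj₁) x y z x≢y (z≢x ∘ sym) (z≢y ∘ sym) (reg , (low , <⇒≤ high)))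

  not-bad⇒Good : ∀ (G₀ : Graph n) → isRegular d G₀ ≡ true → ¬ Bad (toVG G₀) → Good k G₀
  not-bad⇒Good G₀ regular ok part pv pw = W , sizes , (λ v w h → respects v w (trans (sameColour-cong (toVG-at G₀) part 2 v w) h))
    where
    packed = pack k 1≤k 1≤n (graph (toVG G₀)) part (λ v → <⇒≤ (classes (toVG G₀) (isRegular⇒Reg d G₀ regular) ok part pv pw v))
    W = proj₁ packed
    sizes = proj₁ (proj₂ packed)
    respects = proj₂ (proj₂ packed)

  graphs : List (Graph n)
  graphs = regGraphs n d

  regular? : ∀ (G₀ : Graph n) → Dec (Data.Bool.T (isRegular d G₀))
  regular? G₀ = T? (isRegular d G₀)

  T⇒true : ∀ {b} → Data.Bool.T b → b ≡ true
  T⇒true {true} _ = refl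

  true⇒T : ∀ {b} → b ≡ true → Data.Bool.T b
  true⇒T refl = tt

  graphs-regular : ∀ i → isRegular d (lookup graphs i) ≡ true
  graphs-regular i = T⇒true (All.lookup (all-filter regular? (allGraphs n)) (∈-lookup i))

  sel : Fin (length graphs) → Bool
  sel i = not (does (Bad? (toVG (lookup graphs i))))

  sel-good : ∀ i → sel i ≡ true → Good k (lookup graphs i)
  sel-good i h = not-bad⇒Good (lookup graphs i) (graphs-regular i)
    (λ bad → true≢false (true-does (Bad? (toVG (lookup graphs i))) bad) (not-true h))

  reg-agrees : ∀ G₀ → [ regular? G₀ ] ≡ [ Reg? d (toVG G₀) ]
  reg-agrees G₀ = []-cong (regular? G₀) (Reg? d (toVG G₀)) (λ h → isRegular⇒Reg d G₀ (T⇒true h)) (λ h → true⇒T (Reg⇒isRegular d G₀ h))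

  length-graphs : length graphs ≡ # (Reg? d)
  length-graphs = begin
    length graphs ≡⟨ length-filter regular? (allGraphs n) ⟩
    listSum (λ G₀ → [ regular? G₀ ]) (allGraphs n) ≡⟨ listSum-cong reg-agrees (allGraphs n) ⟩
    listSum (λ G₀ → [ Reg? d (toVG G₀) ]) (allGraphs n) ≡⟨ sym (listSum-lookup (λ G₀ → [ Reg? d (toVG G₀) ]) (allGraphs n)) ⟩
    ∑ (λ i → [ Reg? d (ω i) ]) ≡⟨ sym (trans (#≡total (Reg? d)) (total≡∑ (λ M → [ Reg? d M ]))) ⟩
    # (Reg? d) ∎
    where open ≡-Reasoning

  -- `regGraphs` is a sublist of `allGraphs`, so the graphs not selected are bounded by the bad
  -- matrices in the whole sample space.
  unselected : length graphs ∸ countTrue sel ≤ # Bad?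
  unselected = m≤n+o⇒m∸n≤o (length graphs) (countTrue sel) (begin
    length graphs ≡⟨ sym (size-not sel) ⟩
    size sel + size (not ∘ sel) ≤⟨ +-mono-≤ (≤-reflexive (sym (countTrue≡∑ sel))) bad ⟩
    countTrue sel + # Bad? ∎)
    where
    open ≤-Reasoning
    not-not : ∀ b → not (not b) ≡ b
    not-not true = refl
    not-not false = refl
    bad : size (not ∘ sel) ≤ # Bad?
    bad = begin
      size (not ∘ sel) ≡⟨ sum-cong (λ i → cong ⟦_⟧ (not-not (does (Bad? (toVG (lookup graphs i)))))) ⟩
      ∑ (λ i → [ Bad? (toVG (lookup graphs i)) ]) ≡⟨ listSum-lookup (λ G₀ → [ Bad? (toVG G₀) ]) graphs ⟩
      listSum (λ G₀ → [ Bad? (toVG G₀) ]) graphs ≡⟨ listSum-filter regular? (λ G₀ → [ Bad? (toVG G₀) ]) (allGraphs n) ⟩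
      listSum (λ G₀ → [ regular? G₀ ] * [ Bad? (toVG G₀) ]) (allGraphs n) ≡⟨ sym (listSum-lookup (λ G₀ → [ regular? G₀ ] * [ Bad? (toVG G₀) ]) (allGraphs n)) ⟩
      ∑ (λ i → [ regular? (lookup (allGraphs n) i) ] * [ Bad? (ω i) ]) ≤⟨ sum-mono (λ i → ≤-trans (*-monoˡ-≤ [ Bad? (ω i) ] ([]≤1 (regular? (lookup (allGraphs n) i)))) (≤-reflexive (*-identityˡ _))) ⟩
      ∑ (λ i → [ Bad? (ω i) ]) ≡⟨ sym (trans (#≡total Bad?) (total≡∑ (λ M → [ Bad? M ]))) ⟩
      # Bad? ∎

  conclusion : ∃[ sel ] (((i : Fin (length (regGraphs n d))) → sel i ≡ true → Good k (lookup (regGraphs n d) i))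
               × (suc t * (length (regGraphs n d) ∸ countTrue sel) ≤ length (regGraphs n d)))
  conclusion = sel , sel-good , ≤-trans (*-monoʳ-≤ (suc t) unselected) (≤-trans bad-rare (≤-reflexive (sym length-graphs)))

theorem8 : (p q : ℕ) → 0 < p → 2 * p < q →
    (d : ℕ → ℕ) → (n₀ : ℕ) →
    ((n : ℕ) → n₀ ≤ n →
    (n ^ (q + 2 * p) ≤ d n ^ (2 * q)) × (2 * d n ≤ n) × (2 ∣ d n * n)) →
    (k : ℕ) → 1 ≤ k →
    (t : ℕ) → ∃[ N ] ((n : ℕ) → N ≤ n →
    ∃[ sel ] (((i : Fin (length (regGraphs n (d n)))) → sel i ≡ true →
    Good k (lookup (regGraphs n (d n)) i))
    × (suc t * (length (regGraphs n (d n)) ∸ countTrue sel)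
    ≤ length (regGraphs n (d n)))))
-- `n₀` secures the hypotheses and `N₀` the inequalities between constants. The last summand forces
-- `l ≥ 16 * C * q * q`, as the comparison of polynomial and exponential requires.
theorem8 p q 0<p 2p<q d n₀ hyp k 1≤k t = n₀ + (N₀ + suc (2 ^ (16 * C * q * q))) , large
  where
  open Numbers k (3 * suc t) 1≤k using (C; N₀; 1≤C)
  large : ∀ n → n₀ + (N₀ + suc (2 ^ (16 * C * q * q))) ≤ n → _
  large n n-large with binary-length n
  ... | l , lo , hi = Conclusion.conclusion k t n (d n) l 1≤k (≤-trans (m≤m+n N₀ _) (≤-trans (m≤n+m _ n₀) n-large)) lo
        (superlogarithmic p q 0<p (≤-trans (s≤s z≤n) 2p<q) C 1≤C n (d n) l (≤-trans (m≤n+m _ N₀) (≤-trans (m≤n+m _ n₀) n-large)) lo hi (proj₁ bounds))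
        (proj₁ (proj₂ bounds))
    where
    bounds = hyp n (≤-trans (m≤m+n n₀ _) n-large)
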